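{- For every $0<\varepsilon\le 1$ there exist $\lambda>0$ and $n_0$ such that for all $n>n_0$ and every $p\ge \lambda n^{ -1/2}$ the following holds: with probability at least $1-\varepsilon$, over the choice of the random graph $G(n,p)$ and the choice of the initial state, all vertices of $V_n=\{1,\dots,n\}$ have state $\operatorname{sgn}\bigl(\sum_{v\in V_n}S_0(v)\bigr)$ after four rounds of majority dynamics, i.e. $S_4(v)=\operatorname{sgn}\bigl(\sum_{u\in V_n}S_0(u)\bigr)$ for all $v\in V_n$.
   Context: $G(n,p)$ is the binomial random graph on $V_n=\{1,\dots,n\}$ in which each pair of distinct vertices is an edge independently with probability $p$. Majority dynamics on a graph $G$: each vertex $v$ has a state $S_t(v)\in\{ -1,+1\}$ at step $t\ge 0$, and $S_{t+1}(v)=\operatorname{sgn}\bigl(\sum_{u\in N(v)}S_t(u)\bigr)$ if this sum is nonzero, and $S_{t+1}(v)=S_t(v)$ otherwise, where $N(v)$ is the neighbourhood of $v$ in $G$ and $\operatorname{sgn}(x)=-1$ for $x<0$, $+1$ for $x>0$. The initial states $\{S_0(v)\}_{v\in V_n}$ are independent, each uniform on $\{ -1,+1\}$, independent of the graph. -}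

module Defs where

open import Data.Bool.Base using (Bool; true; false; if_then_else_)
open import Data.Fin.Base using (Fin; zero; suc)
open import Data.Fin.Properties using (all?)
open import Data.Integer.Base as ℤ using (ℤ; +_; -[1+_]; _◃_)
import Data.Integer.Properties as ℤP
open import Data.List.Base as List using (List; []; _∷_; foldr; filter; cartesianProductWith)
open import Data.Maybe.Base using (Maybe; just; nothing; fromMaybe)
import Data.Maybe.Properties as MaybeP
open import Data.Nat.Base as ℕ using (ℕ; zero; suc; NonZero)
import Data.Nat.Properties as ℕP
open import Data.Nat.Tactic.RingSolver using (solve-∀)
open import Data.Product.Base using (Σ-syntax; ∃-syntax; _×_; _,_; proj₁; proj₂; uncurry)
open import Data.Rational.Base as ℚ using (ℚ; 0ℚ; 1ℚ; mkℚ; toℚᵘ; fromℚᵘ)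
import Data.Rational.Properties as ℚP
open import Data.Rational.Solver using (module +-*-Solver)
open import Data.Rational.Unnormalised.Base as ℚᵘ using (ℚᵘ; mkℚᵘ)
import Data.Rational.Unnormalised.Properties as ℚᵘP
open import Data.Sign.Base as Sign using (Sign)
import Data.Sign.Properties as SignP
open import Data.Sum.Base using (inj₁; inj₂)
open import Data.Vec.Base as Vec using (Vec; []; _∷_; lookup)
open import Function.Base using (_∘_)
open import Level using (0ℓ)
open import Relation.Binary.PropositionalEquality
  using (_≡_; refl; sym; trans; cong; cong₂; subst)
open import Relation.Nullary.Decidable.Core using (yes; no)
open import Relation.Unary using (Pred; Decidable)
open import Algebra.Definitions.RawMonoid ℤ.+-0-rawMonoid using (sum)

IsCauchy : (ℕ → ℚ) → Set
IsCauchy x = ∀ δ → 0ℚ ℚ.< δ →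
  ∃[ N ] (∀ {i j} → N ℕ.≤ i → N ℕ.≤ j → ℚ.∣ x i ℚ.- x j ∣ ℚ.≤ δ)

record ℝ : Set where
  constructor mkℝ
  field
    seq    : ℕ → ℚ
    cauchy : IsCauchy seq

open ℝ public

infix 4 _≃ℝ_ _≤ℝ_ _<ℝ_
infixl 6 _+ℝ_ _-ℝ_
infixl 7 _*ℝ_
infix 8 -ℝ_

-- Equality and order are those of the limits, so equal reals may have
-- different sequences.

_≃ℝ_ : ℝ → ℝ → Set
x ≃ℝ y = ∀ δ → 0ℚ ℚ.< δ →
  ∃[ N ] (∀ {i} → N ℕ.≤ i → ℚ.∣ seq x i ℚ.- seq y i ∣ ℚ.≤ δ)

_≤ℝ_ : ℝ → ℝ → Set
x ≤ℝ y = ∀ δ → 0ℚ ℚ.< δ →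
  ∃[ N ] (∀ {i} → N ℕ.≤ i → seq x i ℚ.≤ seq y i ℚ.+ δ)

_<ℝ_ : ℝ → ℝ → Set
x <ℝ y = Σ[ δ ∈ ℚ ] (0ℚ ℚ.< δ ×
  ∃[ N ] (∀ {i} → N ℕ.≤ i → seq x i ℚ.+ δ ℚ.≤ seq y i))

private

  half : ∀ {δ} → 0ℚ ℚ.< δ → 0ℚ ℚ.< ℚ.½ ℚ.* δ
  half {δ} 0<δ = subst (ℚ._< ℚ.½ ℚ.* δ) (ℚP.*-zeroʳ ℚ.½) (ℚP.*-monoʳ-<-pos ℚ.½ 0<δ)

  half+half : ∀ δ → ℚ.½ ℚ.* δ ℚ.+ ℚ.½ ℚ.* δ ≡ δ
  half+half δ = trans (sym (ℚP.*-distribʳ-+ δ ℚ.½ ℚ.½)) (ℚP.*-identityˡ δ)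

  +-cauchy : ∀ {x y} → IsCauchy x → IsCauchy y → IsCauchy (λ k → x k ℚ.+ y k)
  +-cauchy {x} {y} cx cy δ 0<δ with cx _ (half 0<δ) | cy _ (half 0<δ)
  ... | M , hM | N , hN = M ℕ.⊔ N , λ {i} {j} p q → begin
    ℚ.∣ (x i ℚ.+ y i) ℚ.- (x j ℚ.+ y j) ∣
      ≡⟨ cong ℚ.∣_∣ (solve 4 (λ a b c d → (a :+ b) :- (c :+ d) := (a :- c) :+ (b :- d))
                       refl (x i) (y i) (x j) (y j)) ⟩
    ℚ.∣ (x i ℚ.- x j) ℚ.+ (y i ℚ.- y j) ∣
      ≤⟨ ℚP.∣p+q∣≤∣p∣+∣q∣ (x i ℚ.- x j) (y i ℚ.- y j) ⟩
    ℚ.∣ x i ℚ.- x j ∣ ℚ.+ ℚ.∣ y i ℚ.- y j ∣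
      ≤⟨ ℚP.+-mono-≤ (hM (ℕP.m⊔n≤o⇒m≤o M N p) (ℕP.m⊔n≤o⇒m≤o M N q))
                     (hN (ℕP.m⊔n≤o⇒n≤o M N p) (ℕP.m⊔n≤o⇒n≤o M N q)) ⟩
    ℚ.½ ℚ.* δ ℚ.+ ℚ.½ ℚ.* δ
      ≡⟨ half+half δ ⟩
    δ ∎
    where open ℚP.≤-Reasoning
          open +-*-Solver

  neg-cauchy : ∀ {x} → IsCauchy x → IsCauchy (λ k → ℚ.- x k)
  neg-cauchy {x} cx δ 0<δ with cx δ 0<δ
  ... | N , hN = N , λ {i} {j} p q → begin
    ℚ.∣ (ℚ.- x i) ℚ.- (ℚ.- x j) ∣
      ≡⟨ cong ℚ.∣_∣ (sym (ℚP.neg-distrib-+ (x i) (ℚ.- x j))) ⟩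
    ℚ.∣ ℚ.- (x i ℚ.- x j) ∣
      ≡⟨ ℚP.∣-p∣≡∣p∣ (x i ℚ.- x j) ⟩
    ℚ.∣ x i ℚ.- x j ∣
      ≤⟨ hN p q ⟩
    δ ∎
    where open ℚP.≤-Reasoning

  0<1 : 0ℚ ℚ.< 1ℚ
  0<1 = ℚP.positive⁻¹ 1ℚ

  bounded : ∀ {x} → IsCauchy x →
    Σ[ B ∈ ℚ ] (ℚ.Positive B × ∃[ N ] (∀ {i} → N ℕ.≤ i → ℚ.∣ x i ∣ ℚ.≤ B))
  bounded {x} cx with cx 1ℚ 0<1
  ... | N , hN = 1ℚ ℚ.+ ℚ.∣ x N ∣
               , ℚP.pos+nonNeg⇒pos 1ℚ ℚ.∣ x N ∣ {{ℚP.∣-∣-nonNeg (x N)}}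
               , N , λ {i} p → begin
    ℚ.∣ x i ∣
      ≡⟨ cong ℚ.∣_∣ (solve 2 (λ a b → a := (a :- b) :+ b) refl (x i) (x N)) ⟩
    ℚ.∣ (x i ℚ.- x N) ℚ.+ x N ∣
      ≤⟨ ℚP.∣p+q∣≤∣p∣+∣q∣ (x i ℚ.- x N) (x N) ⟩
    ℚ.∣ x i ℚ.- x N ∣ ℚ.+ ℚ.∣ x N ∣
      ≤⟨ ℚP.+-monoˡ-≤ ℚ.∣ x N ∣ (hN p ℕP.≤-refl) ⟩
    1ℚ ℚ.+ ℚ.∣ x N ∣ ∎
    where open ℚP.≤-Reasoning
          open +-*-Solver

  abs-*-≤ : ∀ {b c} u v → 0ℚ ℚ.≤ c → ℚ.∣ u ∣ ℚ.≤ b → ℚ.∣ v ∣ ℚ.≤ c → ℚ.∣ u ℚ.* v ∣ ℚ.≤ b ℚ.* c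
  abs-*-≤ {b} {c} u v 0≤c u≤b v≤c = begin
    ℚ.∣ u ℚ.* v ∣          ≡⟨ ℚP.∣p*q∣≡∣p∣*∣q∣ u v ⟩
    ℚ.∣ u ∣ ℚ.* ℚ.∣ v ∣    ≤⟨ ℚP.*-monoˡ-≤-nonNeg ℚ.∣ u ∣ {{ℚP.∣-∣-nonNeg u}} v≤c ⟩
    ℚ.∣ u ∣ ℚ.* c          ≤⟨ ℚP.*-monoʳ-≤-nonNeg c {{ℚ.nonNegative 0≤c}} u≤b ⟩
    b ℚ.* c ∎
    where open ℚP.≤-Reasoning

  split : ∀ B C δ → ℚ.Positive B → ℚ.Positive C → 0ℚ ℚ.< δ →
    Σ[ η ∈ ℚ ] (0ℚ ℚ.< η × B ℚ.* η ℚ.+ C ℚ.* η ≡ δ)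
  split B C δ B>0 C>0 0<δ = go (B ℚ.+ C) refl (ℚP.pos+pos⇒pos B {{B>0}} C {{C>0}})
    where
    go : ∀ D → B ℚ.+ C ≡ D → ℚ.Positive D → Σ[ η ∈ ℚ ] (0ℚ ℚ.< η × B ℚ.* η ℚ.+ C ℚ.* η ≡ δ)
    go D eq D>0 = D⁻¹ ℚ.* δ
      , ℚP.positive⁻¹ (D⁻¹ ℚ.* δ)
          {{ℚP.pos*pos⇒pos D⁻¹ {{ℚP.1/pos⇒pos D {{D>0}}}} δ {{ℚ.positive 0<δ}}}}
      , trans (sym (ℚP.*-distribʳ-+ (D⁻¹ ℚ.* δ) B C))
          (trans (cong (ℚ._* (D⁻¹ ℚ.* δ)) eq)
            (trans (sym (ℚP.*-assoc D D⁻¹ δ))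
              (trans (cong (ℚ._* δ) (ℚP.*-inverseʳ D {{D≢0}})) (ℚP.*-identityˡ δ))))
      where
      D≢0 = ℚP.pos⇒nonZero D {{D>0}}
      D⁻¹ = ℚ.1/_ D {{D≢0}}

  *-close : ∀ {B C η} a b c d → 0ℚ ℚ.≤ η →
    ℚ.∣ a ∣ ℚ.≤ B → ℚ.∣ d ∣ ℚ.≤ C → ℚ.∣ b ℚ.- d ∣ ℚ.≤ η → ℚ.∣ a ℚ.- c ∣ ℚ.≤ η →
    ℚ.∣ a ℚ.* b ℚ.- c ℚ.* d ∣ ℚ.≤ B ℚ.* η ℚ.+ C ℚ.* η
  *-close {B} {C} {η} a b c d 0≤η ha hd hbd hac = begin
    ℚ.∣ a ℚ.* b ℚ.- c ℚ.* d ∣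
      ≡⟨ cong ℚ.∣_∣ (rearrange a b c d) ⟩
    ℚ.∣ a ℚ.* (b ℚ.- d) ℚ.+ d ℚ.* (a ℚ.- c) ∣
      ≤⟨ ℚP.∣p+q∣≤∣p∣+∣q∣ (a ℚ.* (b ℚ.- d)) (d ℚ.* (a ℚ.- c)) ⟩
    ℚ.∣ a ℚ.* (b ℚ.- d) ∣ ℚ.+ ℚ.∣ d ℚ.* (a ℚ.- c) ∣
      ≤⟨ ℚP.+-mono-≤ (abs-*-≤ a (b ℚ.- d) 0≤η ha hbd) (abs-*-≤ d (a ℚ.- c) 0≤η hd hac) ⟩
    B ℚ.* η ℚ.+ C ℚ.* η ∎
    where
    open ℚP.≤-Reasoning
    rearrange : ∀ a b c d → a ℚ.* b ℚ.- c ℚ.* d ≡ a ℚ.* (b ℚ.- d) ℚ.+ d ℚ.* (a ℚ.- c)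
    rearrange = solve 4 (λ a b c d → a :* b :- c :* d := a :* (b :- d) :+ d :* (a :- c)) refl
      where open +-*-Solver

  *-cauchy : ∀ {x y} → IsCauchy x → IsCauchy y → IsCauchy (λ k → x k ℚ.* y k)
  *-cauchy {x} {y} cx cy δ 0<δ = bound (bounded {x} cx) (bounded {y} cy)
    where
    Goal = ∃[ N ] (∀ {i j} → N ℕ.≤ i → N ℕ.≤ j → ℚ.∣ x i ℚ.* y i ℚ.- x j ℚ.* y j ∣ ℚ.≤ δ)

    combine : ∀ B C η → 0ℚ ℚ.≤ η → B ℚ.* η ℚ.+ C ℚ.* η ℚ.≤ δ →
      ∃[ K ] (∀ {i} → K ℕ.≤ i → ℚ.∣ x i ∣ ℚ.≤ B) →
      ∃[ L ] (∀ {i} → L ℕ.≤ i → ℚ.∣ y i ∣ ℚ.≤ C) →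
      ∃[ M ] (∀ {i j} → M ℕ.≤ i → M ℕ.≤ j → ℚ.∣ x i ℚ.- x j ∣ ℚ.≤ η) →
      ∃[ N ] (∀ {i j} → N ℕ.≤ i → N ℕ.≤ j → ℚ.∣ y i ℚ.- y j ∣ ℚ.≤ η) →
      Goal
    combine B C η 0≤η le (K , hK) (L , hL) (M , hM) (N , hN) =
      (K ℕ.⊔ L) ℕ.⊔ (M ℕ.⊔ N) , λ {i} {j} p q →
      let K≤i = ℕP.m⊔n≤o⇒m≤o K L (ℕP.m⊔n≤o⇒m≤o (K ℕ.⊔ L) (M ℕ.⊔ N) p)
          L≤j = ℕP.m⊔n≤o⇒n≤o K L (ℕP.m⊔n≤o⇒m≤o (K ℕ.⊔ L) (M ℕ.⊔ N) q)
          M⊔N≤i = ℕP.m⊔n≤o⇒n≤o (K ℕ.⊔ L) (M ℕ.⊔ N) p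
          M⊔N≤j = ℕP.m⊔n≤o⇒n≤o (K ℕ.⊔ L) (M ℕ.⊔ N) q
      in ℚP.≤-trans
           (*-close {B} {C} {η} (x i) (y i) (x j) (y j) 0≤η (hK K≤i) (hL L≤j)
             (hN (ℕP.m⊔n≤o⇒n≤o M N M⊔N≤i) (ℕP.m⊔n≤o⇒n≤o M N M⊔N≤j))
             (hM (ℕP.m⊔n≤o⇒m≤o M N M⊔N≤i) (ℕP.m⊔n≤o⇒m≤o M N M⊔N≤j)))
           le

    bound : Σ[ B ∈ ℚ ] (ℚ.Positive B × ∃[ K ] (∀ {i} → K ℕ.≤ i → ℚ.∣ x i ∣ ℚ.≤ B)) →
            Σ[ C ∈ ℚ ] (ℚ.Positive C × ∃[ L ] (∀ {i} → L ℕ.≤ i → ℚ.∣ y i ∣ ℚ.≤ C)) → Goal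
    bound (B , B>0 , hK) (C , C>0 , hL) =
      let η , 0<η , eq = split B C δ B>0 C>0 0<δ in
      combine B C η (ℚP.<⇒≤ 0<η) (ℚP.≤-reflexive eq) hK hL (cx η 0<η) (cy η 0<η)

fromℚ : ℚ → ℝ
fromℚ q = mkℝ (λ _ → q) λ δ 0<δ → 0 , λ _ _ →
  subst (ℚ._≤ δ) (cong ℚ.∣_∣ (sym (ℚP.+-inverseʳ q))) (ℚP.<⇒≤ 0<δ)

0ℝ 1ℝ ½ℝ : ℝ
0ℝ = fromℚ 0ℚ
1ℝ = fromℚ 1ℚ
½ℝ = fromℚ ℚ.½

_+ℝ_ : ℝ → ℝ → ℝ
x +ℝ y = mkℝ (λ k → seq x k ℚ.+ seq y k) (+-cauchy {seq x} {seq y} (cauchy x) (cauchy y))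

_*ℝ_ : ℝ → ℝ → ℝ
x *ℝ y = mkℝ (λ k → seq x k ℚ.* seq y k) (*-cauchy {seq x} {seq y} (cauchy x) (cauchy y))

-ℝ_ : ℝ → ℝ
-ℝ x = mkℝ (λ k → ℚ.- seq x k) (neg-cauchy {seq x} (cauchy x))

_-ℝ_ : ℝ → ℝ → ℝ
x -ℝ y = x +ℝ (-ℝ y)

-- The largest a ≤ b with a²n ≤ m².
largest : (n m b : ℕ) → ℕ
largest n m zero    = zero
largest n m (suc b) with suc b ℕ.* suc b ℕ.* n ℕP.≤? m ℕ.* m
... | yes _ = suc b
... | no  _ = largest n m b

⌊_/√_⌋ : ℕ → ℕ → ℕ
⌊ m /√ n ⌋ = largest n m m

private

  largest-lower : ∀ n m b → largest n m b ℕ.* largest n m b ℕ.* n ℕ.≤ m ℕ.* m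
  largest-lower n m zero    = ℕ.z≤n
  largest-lower n m (suc b) with suc b ℕ.* suc b ℕ.* n ℕP.≤? m ℕ.* m
  ... | yes p = p
  ... | no  _ = largest-lower n m b

  largest-upper : ∀ n m b → m ℕ.* m ℕ.< suc b ℕ.* suc b ℕ.* n →
    m ℕ.* m ℕ.< suc (largest n m b) ℕ.* suc (largest n m b) ℕ.* n
  largest-upper n m zero    h = h
  largest-upper n m (suc b) h with suc b ℕ.* suc b ℕ.* n ℕP.≤? m ℕ.* m
  ... | yes _ = h
  ... | no ¬p = largest-upper n m b (ℕP.≰⇒> ¬p)

  largest-bound : ∀ n m b → largest n m b ℕ.≤ b
  largest-bound n m zero    = ℕ.z≤n
  largest-bound n m (suc b) with suc b ℕ.* suc b ℕ.* n ℕP.≤? m ℕ.* m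
  ... | yes _ = ℕP.≤-refl
  ... | no  _ = ℕP.m≤n⇒m≤1+n (largest-bound n m b)

  floor-upper : ∀ n m .{{_ : NonZero n}} →
    m ℕ.* m ℕ.< suc ⌊ m /√ n ⌋ ℕ.* suc ⌊ m /√ n ⌋ ℕ.* n
  floor-upper n m = largest-upper n m m
    (ℕP.<-≤-trans (ℕP.*-mono-< (ℕP.n<1+n m) (ℕP.n<1+n m))
                  (ℕP.m≤m*n (suc m ℕ.* suc m) n))

  sq-cancel-< : ∀ {x y} → x ℕ.* x ℕ.< y ℕ.* y → x ℕ.< y
  sq-cancel-< {x} {y} h with x ℕP.<? y
  ... | yes p = p
  ... | no ¬p = let y≤x = ℕP.≮⇒≥ ¬p in
    Data.Empty.⊥-elim (ℕP.<⇒≱ h (ℕP.*-mono-≤ y≤x y≤x))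
    where import Data.Empty

  floor-cross : ∀ n m k .{{_ : NonZero n}} → .{{_ : NonZero k}} → .{{_ : NonZero m}} →
    ⌊ m /√ n ⌋ ℕ.* k ℕ.≤ suc ⌊ k /√ n ⌋ ℕ.* m
  floor-cross n m k = ℕP.<⇒≤ (sq-cancel-< (ℕP.*-cancelʳ-< n ((a ℕ.* k) ℕ.* (a ℕ.* k)) ((b ℕ.* m) ℕ.* (b ℕ.* m)) (begin-strict
    (a ℕ.* k) ℕ.* (a ℕ.* k) ℕ.* n      ≡⟨ eq₁ a k n ⟩
    (a ℕ.* a ℕ.* n) ℕ.* (k ℕ.* k)      ≤⟨ ℕP.*-monoˡ-≤ (k ℕ.* k) (largest-lower n m m) ⟩
    (m ℕ.* m) ℕ.* (k ℕ.* k)            <⟨ ℕP.*-monoʳ-< (m ℕ.* m) {{ℕP.m*n≢0 m m}} (floor-upper n k) ⟩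
    (m ℕ.* m) ℕ.* (b ℕ.* b ℕ.* n)      ≡⟨ eq₂ m b n ⟩
    (b ℕ.* m) ℕ.* (b ℕ.* m) ℕ.* n      ∎)))
    where
    open ℕP.≤-Reasoning
    a = ⌊ m /√ n ⌋
    b = suc ⌊ k /√ n ⌋
    eq₁ : ∀ a k n → (a ℕ.* k) ℕ.* (a ℕ.* k) ℕ.* n ≡ (a ℕ.* a ℕ.* n) ℕ.* (k ℕ.* k)
    eq₁ = solve-∀
    eq₂ : ∀ m b n → (m ℕ.* m) ℕ.* (b ℕ.* b ℕ.* n) ≡ (b ℕ.* m) ℕ.* (b ℕ.* m) ℕ.* n
    eq₂ = solve-∀

  +≤+ᵘ : ∀ {a b i j} → a ℕ.* suc j ℕ.≤ b ℕ.* suc i → mkℚᵘ (+ a) i ℚᵘ.≤ mkℚᵘ (+ b) j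
  +≤+ᵘ {a} {b} {i} {j} h = ℚᵘ.*≤* (begin
    + a ℤ.* + suc j      ≡⟨ ℤP.pos-* a (suc j) ⟨
    + (a ℕ.* suc j)      ≤⟨ ℤ.+≤+ h ⟩
    + (b ℕ.* suc i)      ≡⟨ ℤP.pos-* b (suc i) ⟩
    + b ℤ.* + suc i      ∎)
    where open ℤP.≤-Reasoning

  eventually-small : ∀ k δ → 0ℚ ℚ.< δ →
    ∃[ N ] (∀ {i} → N ℕ.≤ i → mkℚᵘ (+ k) i ℚᵘ.≤ toℚᵘ δ)
  eventually-small k (mkℚ (+ zero) d _) (ℚ.*<* (ℤ.+<+ ()))
  eventually-small k (mkℚ -[1+ _ ] d _) (ℚ.*<* ())
  eventually-small k (mkℚ (+ suc c) d _) _ = k ℕ.* suc d , λ {i} h →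
    +≤+ᵘ (ℕP.≤-trans h (ℕP.≤-trans (ℕP.n≤1+n i) (ℕP.m≤n*m (suc i) (suc c))))

  +-same-denominator : ∀ a b j → mkℚᵘ (+ (a ℕ.+ b)) j ℚᵘ.≃ mkℚᵘ (+ a) j ℚᵘ.+ mkℚᵘ (+ b) j
  +-same-denominator a b j = ℚᵘ.*≡* (trans (cong (λ z → + (a ℕ.+ b) ℤ.* z) (ℤP.pos-* (suc j) (suc j)))
    (trans (cong (ℤ._* (s ℤ.* s)) (ℤP.pos-+ a b)) (sym (eq (+ a) (+ b) s))))
    where
    s = + suc j
    eq : ∀ a b s → (a ℤ.* s ℤ.+ b ℤ.* s) ℤ.* s ≡ (a ℤ.+ b) ℤ.* (s ℤ.* s)
    eq a b s = trans (cong (ℤ._* s) (sym (ℤP.*-distribʳ-+ s a b))) (ℤP.*-assoc (a ℤ.+ b) s s)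

  ∣p-q∣≤ : ∀ {p q δ} → p ℚ.≤ q ℚ.+ δ → q ℚ.≤ p ℚ.+ δ → ℚ.∣ p ℚ.- q ∣ ℚ.≤ δ
  ∣p-q∣≤ {p} {q} {δ} h₁ h₂ with ℚP.∣p∣≡p∨∣p∣≡-p (p ℚ.- q)
  ... | inj₁ e = begin
    ℚ.∣ p ℚ.- q ∣      ≡⟨ e ⟩
    p ℚ.- q            ≤⟨ ℚP.+-monoˡ-≤ (ℚ.- q) h₁ ⟩
    q ℚ.+ δ ℚ.- q      ≡⟨ solve 2 (λ q d → q :+ d :- q := d) refl q δ ⟩
    δ ∎
    where open ℚP.≤-Reasoning
          open +-*-Solver
  ... | inj₂ e = begin
    ℚ.∣ p ℚ.- q ∣      ≡⟨ e ⟩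
    ℚ.- (p ℚ.- q)      ≡⟨ solve 2 (λ p q → :- (p :- q) := q :- p) refl p q ⟩
    q ℚ.- p            ≤⟨ ℚP.+-monoˡ-≤ (ℚ.- p) h₂ ⟩
    p ℚ.+ δ ℚ.- p      ≡⟨ solve 2 (λ q d → q :+ d :- q := d) refl p δ ⟩
    δ ∎
    where open ℚP.≤-Reasoning
          open +-*-Solver

invSqrtSeq : ℕ → ℕ → ℚ
invSqrtSeq n k = + ⌊ suc k /√ n ⌋ ℚ./ suc k

private

  invSqrt-close : ∀ n .{{_ : NonZero n}} i j δ → mkℚᵘ (+ 1) j ℚᵘ.≤ toℚᵘ δ →
    invSqrtSeq n i ℚ.≤ invSqrtSeq n j ℚ.+ δ
  invSqrt-close n i j δ small = ℚP.toℚᵘ-cancel-≤ (begin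
    toℚᵘ (invSqrtSeq n i)             ≃⟨ ℚP.toℚᵘ-fromℚᵘ (mkℚᵘ (+ a) i) ⟩
    mkℚᵘ (+ a) i                      ≤⟨ +≤+ᵘ (floor-cross n (suc i) (suc j)) ⟩
    mkℚᵘ (+ suc b) j                  ≡⟨ cong (λ z → mkℚᵘ (+ z) j) (ℕP.+-comm 1 b) ⟩
    mkℚᵘ (+ (b ℕ.+ 1)) j              ≃⟨ +-same-denominator b 1 j ⟩
    mkℚᵘ (+ b) j ℚᵘ.+ mkℚᵘ (+ 1) j    ≤⟨ ℚᵘP.+-monoʳ-≤ (mkℚᵘ (+ b) j) small ⟩
    mkℚᵘ (+ b) j ℚᵘ.+ toℚᵘ δ          ≃⟨ ℚᵘP.+-congˡ (toℚᵘ δ) (ℚP.toℚᵘ-fromℚᵘ (mkℚᵘ (+ b) j)) ⟨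
    toℚᵘ (invSqrtSeq n j) ℚᵘ.+ toℚᵘ δ ≃⟨ ℚP.toℚᵘ-homo-+ (invSqrtSeq n j) δ ⟨
    toℚᵘ (invSqrtSeq n j ℚ.+ δ)       ∎)
    where
    open ℚᵘP.≤-Reasoning
    a = ⌊ suc i /√ n ⌋
    b = ⌊ suc j /√ n ⌋

-- n^(-1/2), as the limit of ⌊m/√n⌋/m; it is characterised by
-- invSqrt-nonNegative and invSqrt-square below.
invSqrt : (n : ℕ) → .{{_ : NonZero n}} → ℝ
invSqrt n = mkℝ (invSqrtSeq n) λ δ 0<δ → let N , small = eventually-small 1 δ 0<δ in
  N , λ {i} {j} p q → ∣p-q∣≤ (invSqrt-close n i j δ (small q)) (invSqrt-close n j i δ (small p))

invSqrt-nonNegative : ∀ n .{{_ : NonZero n}} → 0ℝ ≤ℝ invSqrt n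
invSqrt-nonNegative n δ 0<δ = 0 , λ {i} _ → begin
  0ℚ                        ≤⟨ ℚP.nonNegative⁻¹ (invSqrtSeq n i) {{ℚP.normalize-nonNeg ⌊ suc i /√ n ⌋ (suc i)}} ⟩
  invSqrtSeq n i            ≡⟨ ℚP.+-identityʳ (invSqrtSeq n i) ⟨
  invSqrtSeq n i ℚ.+ 0ℚ     ≤⟨ ℚP.+-monoʳ-≤ (invSqrtSeq n i) (ℚP.<⇒≤ 0<δ) ⟩
  invSqrtSeq n i ℚ.+ δ      ∎
  where open ℚP.≤-Reasoning

private

  square≃ : ∀ n i → let a = ⌊ suc i /√ n ⌋ in
    toℚᵘ (invSqrtSeq n i ℚ.* invSqrtSeq n i ℚ.* (+ n ℚ./ 1))
      ℚᵘ.≃ mkℚᵘ (+ (a ℕ.* a ℕ.* n)) (i ℕ.+ i ℕ.* suc i)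
  square≃ n i = begin
    toℚᵘ (t ℚ.* t ℚ.* (+ n ℚ./ 1))
      ≈⟨ ℚP.toℚᵘ-homo-* (t ℚ.* t) (+ n ℚ./ 1) ⟩
    toℚᵘ (t ℚ.* t) ℚᵘ.* toℚᵘ (+ n ℚ./ 1)
      ≈⟨ ℚᵘP.*-cong (ℚᵘP.≃-trans (ℚP.toℚᵘ-homo-* t t) (ℚᵘP.*-cong t≃ t≃)) (ℚP.toℚᵘ-fromℚᵘ (mkℚᵘ (+ n) 0)) ⟩
    mkℚᵘ (+ a) i ℚᵘ.* mkℚᵘ (+ a) i ℚᵘ.* mkℚᵘ (+ n) 0
      ≈⟨ ℚᵘ.*≡* (cong₂ ℤ._*_ (trans (cong (ℤ._* + n) (sym (ℤP.pos-* a a))) (sym (ℤP.pos-* (a ℕ.* a) n)))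
                              (cong +_ (sym (ℕP.*-identityʳ (suc i ℕ.* suc i))))) ⟩
    mkℚᵘ (+ (a ℕ.* a ℕ.* n)) (i ℕ.+ i ℕ.* suc i) ∎
    where
    open import Relation.Binary.Reasoning.Setoid ℚᵘP.≃-setoid
    a = ⌊ suc i /√ n ⌋
    t = invSqrtSeq n i
    t≃ = ℚP.toℚᵘ-fromℚᵘ (mkℚᵘ (+ a) i)

  floor-gap : ∀ n m .{{_ : NonZero n}} .{{_ : NonZero m}} → let a = ⌊ m /√ n ⌋ in
    m ℕ.* m ℕ.≤ a ℕ.* a ℕ.* n ℕ.+ 3 ℕ.* n ℕ.* m
  floor-gap n m = begin
    m ℕ.* m
      ≤⟨ ℕP.<⇒≤ (floor-upper n m) ⟩
    suc a ℕ.* suc a ℕ.* n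
      ≡⟨ eq₁ a n ⟩
    a ℕ.* a ℕ.* n ℕ.+ (a ℕ.+ a ℕ.+ 1) ℕ.* n
      ≤⟨ ℕP.+-monoʳ-≤ (a ℕ.* a ℕ.* n) (ℕP.*-monoˡ-≤ n
           (ℕP.+-mono-≤ (ℕP.+-mono-≤ a≤m a≤m) (ℕ.>-nonZero⁻¹ m))) ⟩
    a ℕ.* a ℕ.* n ℕ.+ (m ℕ.+ m ℕ.+ m) ℕ.* n
      ≡⟨ cong (a ℕ.* a ℕ.* n ℕ.+_) (eq₂ m n) ⟩
    a ℕ.* a ℕ.* n ℕ.+ 3 ℕ.* n ℕ.* m ∎
    where
    open ℕP.≤-Reasoning
    a = ⌊ m /√ n ⌋
    a≤m = largest-bound n m m
    eq₁ : ∀ a n → suc a ℕ.* suc a ℕ.* n ≡ a ℕ.* a ℕ.* n ℕ.+ (a ℕ.+ a ℕ.+ 1) ℕ.* n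
    eq₁ = solve-∀
    eq₂ : ∀ m n → (m ℕ.+ m ℕ.+ m) ℕ.* n ≡ 3 ℕ.* n ℕ.* m
    eq₂ = solve-∀

invSqrt-square : ∀ n .{{_ : NonZero n}} →
  invSqrt n *ℝ invSqrt n *ℝ fromℚ (+ n ℚ./ 1) ≃ℝ 1ℝ
invSqrt-square n δ 0<δ = let N , small = eventually-small (3 ℕ.* n) δ 0<δ in
  N , λ {i} p → ∣p-q∣≤ (upper i) (lower i (small p))
  where
  open ℚᵘP.≤-Reasoning
  tt : ℕ → ℚ
  tt i = invSqrtSeq n i ℚ.* invSqrtSeq n i ℚ.* (+ n ℚ./ 1)
  upper : ∀ i → tt i ℚ.≤ 1ℚ ℚ.+ δ
  upper i = ℚP.≤-trans (ℚP.toℚᵘ-cancel-≤ (begin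
    toℚᵘ (tt i)                                    ≃⟨ square≃ n i ⟩
    mkℚᵘ (+ (a ℕ.* a ℕ.* n)) (i ℕ.+ i ℕ.* suc i)   ≤⟨ +≤+ᵘ {b = 1} {j = 0} le ⟩
    mkℚᵘ (+ 1) 0                                   ∎))
    (ℚP.≤-trans (ℚP.≤-reflexive (sym (ℚP.+-identityʳ 1ℚ))) (ℚP.+-monoʳ-≤ 1ℚ (ℚP.<⇒≤ 0<δ)))
    where
    a = ⌊ suc i /√ n ⌋
    le : a ℕ.* a ℕ.* n ℕ.* 1 ℕ.≤ 1 ℕ.* (suc i ℕ.* suc i)
    le rewrite ℕP.*-identityʳ (a ℕ.* a ℕ.* n) | ℕP.*-identityˡ (suc i ℕ.* suc i) =
      largest-lower n (suc i) (suc i)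
  lower : ∀ i → mkℚᵘ (+ (3 ℕ.* n)) i ℚᵘ.≤ toℚᵘ δ → 1ℚ ℚ.≤ tt i ℚ.+ δ
  lower i small = ℚP.toℚᵘ-cancel-≤ (begin
    mkℚᵘ (+ 1) 0                                       ≤⟨ +≤+ᵘ {a = 1} {i = 0} {j = s} le ⟩
    mkℚᵘ (+ (A ℕ.+ 3 ℕ.* n ℕ.* suc i)) s               ≃⟨ +-same-denominator A (3 ℕ.* n ℕ.* suc i) s ⟩
    mkℚᵘ (+ A) s ℚᵘ.+ mkℚᵘ (+ (3 ℕ.* n ℕ.* suc i)) s   ≤⟨ ℚᵘP.+-monoʳ-≤ (mkℚᵘ (+ A) s)
                                                           (ℚᵘP.≤-trans (+≤+ᵘ {a = 3 ℕ.* n ℕ.* suc i} {b = 3 ℕ.* n} {i = s} {j = i} cancel) small) ⟩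
    mkℚᵘ (+ A) s ℚᵘ.+ toℚᵘ δ                           ≃⟨ ℚᵘP.+-congˡ (toℚᵘ δ) (square≃ n i) ⟨
    toℚᵘ (tt i) ℚᵘ.+ toℚᵘ δ                            ≃⟨ ℚP.toℚᵘ-homo-+ (tt i) δ ⟨
    toℚᵘ (tt i ℚ.+ δ)                                  ∎)
    where
    a = ⌊ suc i /√ n ⌋
    A = a ℕ.* a ℕ.* n
    s = i ℕ.+ i ℕ.* suc i
    le : 1 ℕ.* (suc i ℕ.* suc i) ℕ.≤ (A ℕ.+ 3 ℕ.* n ℕ.* suc i) ℕ.* 1
    le rewrite ℕP.*-identityʳ (A ℕ.+ 3 ℕ.* n ℕ.* suc i) | ℕP.*-identityˡ (suc i ℕ.* suc i) =
      floor-gap n (suc i)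
    cancel : 3 ℕ.* n ℕ.* suc i ℕ.* suc i ℕ.≤ 3 ℕ.* n ℕ.* (suc i ℕ.* suc i)
    cancel = ℕP.≤-reflexive (ℕP.*-assoc (3 ℕ.* n) (suc i) (suc i))

-- A list of outcomes with their weights; an outcome may be listed several
-- times, its probability then being the total of its weights.
Dist : Set → Set
Dist A = List (A × ℝ)

mapDist : ∀ {A B} → (A → B) → Dist A → Dist B
mapDist f = List.map λ (a , x) → f a , x

pure : ∀ {A} → A → Dist A
pure a = (a , 1ℝ) ∷ []

bernoulli : ℝ → Dist Bool
bernoulli p = (true , p) ∷ (false , 1ℝ -ℝ p) ∷ []

uniformSign : Dist Sign
uniformSign = (Sign.+ , ½ℝ) ∷ (Sign.- , ½ℝ) ∷ []

infixr 5 _⊗_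

-- Joint distribution of independent samples.
_⊗_ : ∀ {A B} → Dist A → Dist B → Dist (A × B)
_⊗_ = cartesianProductWith λ (a , x) (b , y) → (a , b) , x *ℝ y

iid : ∀ {A} → Dist A → (n : ℕ) → Dist (Vec A n)
iid d zero    = pure []
iid d (suc n) = mapDist (uncurry _∷_) (d ⊗ iid d n)

ℙ : ∀ {A} → Dist A → {E : Pred A 0ℓ} → Decidable E → ℝ
ℙ d E? = foldr (λ (_ , x) s → x +ℝ s) 0ℝ (filter (E? ∘ proj₁) d)

-- extend N G adds to G a new vertex zero; entry v of N says whether the
-- new vertex is adjacent to the vertex v of G.  So a graph consists of
-- one bit for each pair of distinct vertices.
data Graph : ℕ → Set where
  empty  : Graph 0
  extend : ∀ {n} → Vec Bool n → Graph n → Graph (suc n)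

adj : ∀ {n} → Graph n → Fin n → Fin n → Bool
adj (extend N G) zero    zero    = false
adj (extend N G) zero    (suc v) = lookup N v
adj (extend N G) (suc u) zero    = lookup N u
adj (extend N G) (suc u) (suc v) = adj G u v

adj-irrefl : ∀ {n} (G : Graph n) v → adj G v v ≡ false
adj-irrefl (extend N G) zero    = refl
adj-irrefl (extend N G) (suc v) = adj-irrefl G v

adj-sym : ∀ {n} (G : Graph n) u v → adj G u v ≡ adj G v u
adj-sym (extend N G) zero    zero    = refl
adj-sym (extend N G) zero    (suc v) = refl
adj-sym (extend N G) (suc u) zero    = refl
adj-sym (extend N G) (suc u) (suc v) = adj-sym G u v

gnp : (n : ℕ) → ℝ → Dist (Graph n)
gnp zero    p = pure empty
gnp (suc n) p = mapDist (uncurry extend) (iid (bernoulli p) n ⊗ gnp n p)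

State : ℕ → Set
State n = Fin n → Sign

value : Sign → ℤ
value s = s ◃ 1

sgn : ℤ → Maybe Sign
sgn (+ zero)  = nothing
sgn (+ suc _) = just Sign.+
sgn -[1+ _ ]  = just Sign.-

neighbourSum : ∀ {n} → Graph n → State n → Fin n → ℤ
neighbourSum G S v = sum λ u → if adj G v u then value (S u) else ℤ.0ℤ

step : ∀ {n} → Graph n → State n → State n
step G S v = fromMaybe (S v) (sgn (neighbourSum G S v))

majority : ∀ {n} → Graph n → State n → ℕ → State n
majority G S₀ zero    = S₀
majority G S₀ (suc t) = step G (majority G S₀ t)

-- If the initial states sum to zero then the sign of the sum is undefined
-- and the event does not occur.
UnanimousAfter : (t : ℕ) → ∀ {n} → Pred (Graph n × Vec Sign n) 0ℓ
UnanimousAfter t (G , S) = let S₀ = lookup S in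
  ∀ v → just (majority G S₀ t v) ≡ sgn (sum λ u → value (S₀ u))

unanimousAfter? : ∀ t {n} → Decidable (UnanimousAfter t {n})
unanimousAfter? t (G , S) = all? λ v → MaybeP.≡-dec SignP._≟_ _ _

randomInstance : (n : ℕ) → ℝ → Dist (Graph n × Vec Sign n)
randomInstance n p = gnp n p ⊗ iid uniformSign n

{-# OPTIONS --safe #-}
-- Conditioned on an initial imbalance of order √n (Stein's identity makes smaller ones unlikely),
-- the bias of S₁(u), given the edge uv, is at least of order √p: the neighbourhood sum is a lazy
-- symmetric walk, unimodal with spread √(np), started from a binomial with mean of order p√n.
-- An edge lies in only two rows of the adjacency matrix, so the variance of a sum of functions of
-- single rows is at most twice the sum of their variances.  For Σ_u A_vu S₁(u) this gives variance
-- O(np) against a mean of order np·√p, so by Chebyshev only a fraction O(1/(np²)) of the vertices is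
-- wrong after two steps.  A union bound over pairs of vertex sets, via E 2^e(W,B), shows that so few
-- wrong vertices can mislead only a small multiple of np vertices in the third step; since all
-- degrees are larger than twice that, none is misled in the fourth.
module Submission where

open import Defs
open import Data.Bool.Base using (Bool; true; false; if_then_else_; T; _∧_)
open import Data.Empty using (⊥-elim)
open import Data.Fin.Base using (Fin; zero; suc)
import Data.Fin.Properties as FinP
open import Data.Integer.Base as ℤ using (ℤ; 0ℤ; 1ℤ; -1ℤ; -[1+_])
open import Algebra.Definitions.RawMonoid ℤ.+-0-rawMonoid using (sum)
import Data.Integer.Properties as ℤP
import Data.Integer.Tactic.RingSolver as ℤSolver
open import Data.List.Base as List using ([]; _∷_)
open import Data.Maybe.Base using (just; fromMaybe)
open import Data.Nat.Base as ℕ using (ℕ; zero; suc; _<_; NonZero)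
import Data.Nat.Properties as ℕP
import Data.Nat.DivMod as ℕD
import Data.Nat.Tactic.RingSolver as ℕSolver
open import Data.Product.Base using (Σ-syntax; ∃-syntax; _×_; _,_; proj₁; proj₂; uncurry)
open import Data.Rational.Base as ℚ using (ℚ; 0ℚ; 1ℚ; ½; toℚᵘ; _+_; _*_; _-_; -_; _≤_; ∣_∣; _⊔_; _⊓_)
open import Data.Rational.Properties as ℚP using
  ( ≤-trans; ≤-refl; ≤-reflexive; <-≤-trans; ≤-<-trans; <⇒≤; positive⁻¹; nonNegative⁻¹; *-identityʳ;
    *-identityˡ; +-identityˡ; +-identityʳ; *-zeroˡ; *-zeroʳ; *-comm; *-assoc; +-assoc; +-comm;
    +-mono-≤; +-monoʳ-≤; +-monoˡ-≤; ≤-antisym; <-irrefl; ≰⇒>; neg-antimono-≤; *-distribˡ-+; +-inverseʳ;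
    +-monoˡ-<; ⊔-lub; ≤-total)
open import Data.Rational.Unnormalised.Base as ℚᵘ using (mkℚᵘ)
import Data.Rational.Unnormalised.Properties as ℚᵘP
open import Data.Sign.Base as Sign using (Sign)
open import Data.Sum.Base using (inj₁; inj₂)
open import Data.Unit.Base using (tt)
open import Data.Vec.Base as Vec using (Vec; []; _∷_; lookup; tabulate; _[_]≔_)
import Data.Vec.Properties as VecP
open import Function.Base using (_∘_)
open import Level using (0ℓ)
open import Relation.Binary.PropositionalEquality
  using (_≡_; _≢_; refl; sym; trans; cong; cong₂; subst; subst₂; module ≡-Reasoning)
open import Relation.Nullary.Decidable.Core using (Dec; does; yes; no)
open import Relation.Unary using (Pred; Decidable)
open import Tactic.RingSolver using (solve-∀)
open import Tactic.RingSolver.Core.AlmostCommutativeRing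
  using (AlmostCommutativeRing; fromCommutativeRing)
open import Relation.Nullary.Decidable using (dec⇒maybe)

-- Rational arithmetic and finite expectations

-- Two obstacles shape the details. The edge probability p is a Cauchy sequence, whose terms may
-- leave the interval from 0 to 1; so the argument is carried out for a rational q, with constants
-- depending only on an integer N of order 1/ε, and is transferred to p index by index. And the
-- rationals offer neither roots nor exponentials: integer parts replace the former (m = ⌊1/q⌋, s =
-- ⌊√n⌋, L of order N√(nq)), powers of 2 and ½ with Bernoulli's inequality the latter, and
-- unimodality with two moments replaces a local limit theorem.
--
-- The bias has order √p because it is drift over spread, p√n divided by √(np).
--
-- The unit of degree is j, with nq between 54j and 216j; up to mj vertices, at least about n/216,
-- may be wrong after two steps. The constants arise backwards: mj wrong vertices cost a factor
-- 2^(6j) per misled vertex; demanding 12j wrong neighbours pays for this twice, leaving enough for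
-- the sum over pairs of sets; degrees must then reach 24j = 2·12j; a decay ½^(27j) leaves ½^(3j)
-- for the vertices, at most j² in number; and 108 = 4·27 relates n to jm.

ℚ-ring : AlmostCommutativeRing 0ℓ 0ℓ
ℚ-ring = fromCommutativeRing ℚP.+-*-commutativeRing (λ x → dec⇒maybe (0ℚ ℚP.≟ x))

0≤1 : 0ℚ ≤ 1ℚ
0≤1 = nonNegative⁻¹ 1ℚ

0≤½ : 0ℚ ≤ ½
0≤½ = nonNegative⁻¹ ½

+-nonneg : ∀ {x y} → 0ℚ ≤ x → 0ℚ ≤ y → 0ℚ ≤ x + y
+-nonneg {x} {y} p q = subst (_≤ x + y) (+-identityˡ 0ℚ) (+-mono-≤ p q)

*-nonneg : ∀ {x y} → 0ℚ ≤ x → 0ℚ ≤ y → 0ℚ ≤ x * y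
*-nonneg {x} {y} p q = nonNegative⁻¹ (x * y)
  {{ℚP.nonNeg*nonNeg⇒nonNeg x {{ℚ.nonNegative p}} y {{ℚ.nonNegative q}}}}

≤⇒0≤- : ∀ {x y} → x ≤ y → 0ℚ ≤ y - x
≤⇒0≤- {x} {y} p = subst (_≤ y - x) (+-inverseʳ x) (+-monoˡ-≤ (- x) p)

-- Most inequalities below are proved in this form: the slack `y - x` is written as a visibly
-- nonnegative certificate `t`, and the ring solver checks the identity.
≤-by : ∀ {x y t} → 0ℚ ≤ t → y - x ≡ t → x ≤ y
≤-by {x} {y} {t} p eq = subst₂ _≤_ (+-identityʳ x) (lem x y)
  (+-monoʳ-≤ x (subst (0ℚ ≤_) (sym eq) p))
  where
  lem : ∀ x y → x + (y - x) ≡ y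
  lem = solve-∀ ℚ-ring

0≤-⇒≤ : ∀ {x y} → 0ℚ ≤ y - x → x ≤ y
0≤-⇒≤ p = ≤-by p refl

x+y-x : ∀ x y → x + y - x ≡ y
x+y-x = solve-∀ ℚ-ring

x+y-y : ∀ x y → x + y - y ≡ x
x+y-y = solve-∀ ℚ-ring

square-nonneg : ∀ x → 0ℚ ≤ x * x
square-nonneg x with ≤-total 0ℚ x
... | inj₁ p = *-nonneg p p
... | inj₂ p = subst (0ℚ ≤_) (lem x) (*-nonneg (≤⇒0≤- p) (≤⇒0≤- p))
  where
  lem : ∀ x → (0ℚ - x) * (0ℚ - x) ≡ x * x
  lem = solve-∀ ℚ-ring

*-monoˡ : ∀ {x y} z → 0ℚ ≤ z → x ≤ y → z * x ≤ z * y
*-monoˡ z p = ℚP.*-monoˡ-≤-nonNeg z {{ℚ.nonNegative p}}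

*-monoʳ : ∀ {x y} z → 0ℚ ≤ z → x ≤ y → x * z ≤ y * z
*-monoʳ z p = ℚP.*-monoʳ-≤-nonNeg z {{ℚ.nonNegative p}}

*-mono : ∀ {a b c d} → 0ℚ ≤ a → 0ℚ ≤ d → a ≤ b → c ≤ d → a * c ≤ b * d
*-mono {a} {b} {c} {d} 0≤a 0≤d p q = ≤-trans (*-monoˡ a 0≤a q) (*-monoʳ d 0≤d p)

0<* : ∀ {x y} → 0ℚ ℚ.< x → 0ℚ ℚ.< y → 0ℚ ℚ.< x * y
0<* {x} {y} p q = positive⁻¹ (x * y) {{ℚP.pos*pos⇒pos x {{ℚ.positive p}} y {{ℚ.positive q}}}}

*-cancelˡ-≤ : ∀ {x y} z → 0ℚ ℚ.< z → z * x ≤ z * y → x ≤ y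
*-cancelˡ-≤ z p = ℚP.*-cancelˡ-≤-pos z {{ℚ.positive p}}

square-cancel-≤ : ∀ {x y} → 0ℚ ≤ y → x * x ≤ y * y → x ≤ y
square-cancel-≤ {x} {y} 0≤y h with x ℚP.≤? y
... | yes p = p
... | no ¬p = ⊥-elim (<-irrefl refl (<-≤-trans
  (≤-<-trans (*-monoʳ y 0≤y (<⇒≤ y<x))
                (ℚP.*-monoʳ-<-pos x {{ℚ.positive (≤-<-trans 0≤y y<x)}} y<x)) h))
  where y<x = ≰⇒> ¬p

-- Recursive rather than a quotient, so that `ι (suc n)` and small numerals unfold to sums of `1ℚ`
-- inside ring identities.
ι : ℕ → ℚ
ι zero    = 0ℚ
ι (suc n) = 1ℚ + ι n

ι-nonneg : ∀ n → 0ℚ ≤ ι n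
ι-nonneg zero    = ≤-refl
ι-nonneg (suc n) = +-nonneg 0≤1 (ι-nonneg n)

ι-+ : ∀ m n → ι (m ℕ.+ n) ≡ ι m + ι n
ι-+ zero    n = sym (+-identityˡ (ι n))
ι-+ (suc m) n = trans (cong (1ℚ +_) (ι-+ m n)) (sym (+-assoc 1ℚ (ι m) (ι n)))

ι-* : ∀ m n → ι (m ℕ.* n) ≡ ι m * ι n
ι-* zero    n = sym (*-zeroˡ (ι n))
ι-* (suc m) n = trans (ι-+ n (m ℕ.* n)) (trans (cong (ι n +_) (ι-* m n)) (lem (ι m) (ι n)))
  where
  lem : ∀ x y → y + x * y ≡ (1ℚ + x) * y
  lem = solve-∀ ℚ-ring

ι-mono : ∀ {m n} → m ℕ.≤ n → ι m ≤ ι n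
ι-mono {n = n} ℕ.z≤n     = ι-nonneg n
ι-mono         (ℕ.s≤s p) = +-monoʳ-≤ 1ℚ (ι-mono p)

0<ι : ∀ n → 0ℚ ℚ.< ι (suc n)
0<ι n = <-≤-trans (positive⁻¹ 1ℚ)
  (subst (_≤ 1ℚ + ι n) (+-identityʳ 1ℚ) (+-monoʳ-≤ 1ℚ (ι-nonneg n)))

infixr 8 _^_
_^_ : ℚ → ℕ → ℚ
x ^ zero  = 1ℚ
x ^ suc n = x * x ^ n

^-nonneg : ∀ {x} n → 0ℚ ≤ x → 0ℚ ≤ x ^ n
^-nonneg zero    p = 0≤1
^-nonneg (suc n) p = *-nonneg p (^-nonneg n p)

^-+ : ∀ x m n → x ^ (m ℕ.+ n) ≡ x ^ m * x ^ n
^-+ x zero    n = sym (*-identityˡ _)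
^-+ x (suc m) n = trans (cong (x *_) (^-+ x m n)) (sym (*-assoc x _ _))

^-distrib-* : ∀ x y n → (x * y) ^ n ≡ x ^ n * y ^ n
^-distrib-* x y zero    = refl
^-distrib-* x y (suc n) = trans (cong (x * y *_) (^-distrib-* x y n)) (lem x y (x ^ n) (y ^ n))
  where
  lem : ∀ x y u v → x * y * (u * v) ≡ x * u * (y * v)
  lem = solve-∀ ℚ-ring

^-* : ∀ x m n → x ^ (m ℕ.* n) ≡ (x ^ n) ^ m
^-* x zero    n = refl
^-* x (suc m) n = trans (^-+ x n (m ℕ.* n)) (cong (x ^ n *_) (^-* x m n))

1^ : ∀ n → 1ℚ ^ n ≡ 1ℚ
1^ zero    = refl
1^ (suc n) = trans (*-identityˡ _) (1^ n)

^-monoˡ : ∀ {x y} n → 0ℚ ≤ x → x ≤ y → x ^ n ≤ y ^ n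
^-monoˡ zero    0≤x p = ≤-refl
^-monoˡ (suc n) 0≤x p = *-mono 0≤x (^-nonneg n (≤-trans 0≤x p)) p (^-monoˡ n 0≤x p)

1≤^ : ∀ {x} n → 1ℚ ≤ x → 1ℚ ≤ x ^ n
1≤^ {x} n p = subst (_≤ x ^ n) (1^ n) (^-monoˡ n 0≤1 p)

^-monoʳ : ∀ {x m n} → 1ℚ ≤ x → m ℕ.≤ n → x ^ m ≤ x ^ n
^-monoʳ {x} {m} {n} p q = subst₂ _≤_ (*-identityʳ (x ^ m))
  (trans (sym (^-+ x m (n ℕ.∸ m))) (cong (x ^_) (ℕP.m+[n∸m]≡n q)))
  (*-monoˡ (x ^ m) (^-nonneg m (≤-trans 0≤1 p)) (1≤^ (n ℕ.∸ m) p))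

bernoulli-ineq : ∀ {x} n → 0ℚ ≤ x → 1ℚ + ι n * x ≤ (1ℚ + x) ^ n
bernoulli-ineq {x} zero    p = ≤-reflexive (trans (cong (1ℚ +_) (*-zeroˡ x)) (+-identityʳ 1ℚ))
bernoulli-ineq {x} (suc n) p = ≤-trans
  (≤-by (*-nonneg (ι-nonneg n) (*-nonneg p p)) (lem (ι n) x))
  (*-monoˡ (1ℚ + x) (+-nonneg 0≤1 p) (bernoulli-ineq n p))
  where
  lem : ∀ k x → (1ℚ + x) * (1ℚ + k * x) - (1ℚ + (1ℚ + k) * x) ≡ k * (x * x)
  lem = solve-∀ ℚ-ring

-- A positive normalised linear functional. Supports and weights never appear, so products, images
-- and mixtures are mere compositions; the lists of real weights meet this notion only through
-- `Approx`.
record Expectation (A : Set) : Set where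
  field
    𝔼      : (A → ℚ) → ℚ
    𝔼-mono : ∀ {f g} → (∀ a → f a ≤ g a) → 𝔼 f ≤ 𝔼 g
    𝔼-+    : ∀ f g → 𝔼 (λ a → f a + g a) ≡ 𝔼 f + 𝔼 g
    𝔼-*ˡ   : ∀ c f → 𝔼 (λ a → c * f a) ≡ c * 𝔼 f
    𝔼-1    : 𝔼 (λ _ → 1ℚ) ≡ 1ℚ

  𝔼-cong : ∀ {f g} → (∀ a → f a ≡ g a) → 𝔼 f ≡ 𝔼 g
  𝔼-cong h = ≤-antisym (𝔼-mono λ a → ≤-reflexive (h a))
                          (𝔼-mono λ a → ≤-reflexive (sym (h a)))

  𝔼-const : ∀ c → 𝔼 (λ _ → c) ≡ c
  𝔼-const c = trans (𝔼-cong λ _ → sym (*-identityʳ c))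
    (trans (𝔼-*ˡ c (λ _ → 1ℚ)) (trans (cong (c *_) 𝔼-1) (*-identityʳ c)))

  𝔼-neg : ∀ f → 𝔼 (λ a → - f a) ≡ - 𝔼 f
  𝔼-neg f = trans (𝔼-cong λ a → lem (f a)) (trans (𝔼-*ˡ (- 1ℚ) f) (sym (lem (𝔼 f))))
    where
    lem : ∀ x → - x ≡ (- 1ℚ) * x
    lem = solve-∀ ℚ-ring

  𝔼-- : ∀ f g → 𝔼 (λ a → f a - g a) ≡ 𝔼 f - 𝔼 g
  𝔼-- f g = trans (𝔼-+ f (λ a → - g a)) (cong (𝔼 f +_) (𝔼-neg g))

  𝔼-nonneg : ∀ {f} → (∀ a → 0ℚ ≤ f a) → 0ℚ ≤ 𝔼 f
  𝔼-nonneg {f} h = subst (_≤ 𝔼 f) (𝔼-const 0ℚ) (𝔼-mono h)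

  Var : (A → ℚ) → ℚ
  Var f = 𝔼 (λ a → f a * f a) - 𝔼 f * 𝔼 f

  𝔼-center : ∀ c f → 𝔼 (λ a → (f a - c) * (f a - c)) ≡ Var f + (𝔼 f - c) * (𝔼 f - c)
  𝔼-center c f = trans (𝔼-cong λ a → lem₁ (f a) c)
    (trans (trans (𝔼-+ (λ a → f a * f a) _)
                  (cong (𝔼 (λ a → f a * f a) +_)
                    (trans (𝔼-+ (λ a → (- (c + c)) * f a) _)
                           (cong₂ _+_ (𝔼-*ˡ (- (c + c)) f) (𝔼-const (c * c))))))
           (lem₂ (𝔼 (λ a → f a * f a)) (𝔼 f) c))
    where
    lem₁ : ∀ x c → (x - c) * (x - c) ≡ x * x + ((- (c + c)) * x + c * c)
    lem₁ = solve-∀ ℚ-ring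
    lem₂ : ∀ s m c → s + ((- (c + c)) * m + c * c) ≡ s - m * m + (m - c) * (m - c)
    lem₂ = solve-∀ ℚ-ring

  Var-center : ∀ f → Var f ≡ 𝔼 (λ a → (f a - 𝔼 f) * (f a - 𝔼 f))
  Var-center f = sym (trans (𝔼-center (𝔼 f) f) (lem (Var f) (𝔼 f)))
    where
    lem : ∀ v m → v + (m - m) * (m - m) ≡ v
    lem = solve-∀ ℚ-ring

  Var-nonneg : ∀ f → 0ℚ ≤ Var f
  Var-nonneg f = subst (0ℚ ≤_) (sym (Var-center f)) (𝔼-nonneg λ a → square-nonneg (f a - 𝔼 f))

  𝔼²≤𝔼-square : ∀ f → 𝔼 f * 𝔼 f ≤ 𝔼 (λ a → f a * f a)
  𝔼²≤𝔼-square f = 0≤-⇒≤ (Var-nonneg f)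

  Var-cong : ∀ {f g} → (∀ a → f a ≡ g a) → Var f ≡ Var g
  Var-cong h = cong₂ _-_ (𝔼-cong λ a → cong₂ _*_ (h a) (h a)) (cong₂ _*_ (𝔼-cong h) (𝔼-cong h))

  Var-const-+ : ∀ c f → Var (λ a → c + f a) ≡ Var f
  Var-const-+ c f = trans (Var-center (λ a → c + f a))
    (trans (𝔼-cong λ a → trans (cong (λ z → (c + f a - z) * (c + f a - z)) shift) (lem c (f a) (𝔼 f)))
      (sym (Var-center f)))
    where
    shift : 𝔼 (λ a → c + f a) ≡ c + 𝔼 f
    shift = trans (𝔼-+ (λ _ → c) f) (cong (_+ 𝔼 f) (𝔼-const c))
    lem : ∀ c x m → (c + x - (c + m)) * (c + x - (c + m)) ≡ (x - m) * (x - m)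
    lem = solve-∀ ℚ-ring

  -- From (x + y)² ≤ 2(x² + y²) for the centred variables; valid for dependent summands, at the
  -- price of the factor 2.
  Var-+≤ : ∀ f g → Var (λ a → f a + g a) ≤ (1ℚ + 1ℚ) * (Var f + Var g)
  Var-+≤ f g = begin
    Var (λ a → f a + g a)
      ≡⟨ Var-center _ ⟩
    𝔼 (λ a → (f a + g a - 𝔼 (λ a → f a + g a)) * (f a + g a - 𝔼 (λ a → f a + g a)))
      ≤⟨ 𝔼-mono (λ a → ≤-by (square-nonneg (u a - v a))
           (trans (cong (λ z → (1ℚ + 1ℚ) * (u a * u a + v a * v a) - (f a + g a - z) * (f a + g a - z)) (𝔼-+ f g))
                  (lem (f a) (g a) (𝔼 f) (𝔼 g)))) ⟩
    𝔼 (λ a → (1ℚ + 1ℚ) * (u a * u a + v a * v a))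
      ≡⟨ 𝔼-*ˡ (1ℚ + 1ℚ) (λ a → u a * u a + v a * v a) ⟩
    (1ℚ + 1ℚ) * 𝔼 (λ a → u a * u a + v a * v a)
      ≡⟨ cong ((1ℚ + 1ℚ) *_) (trans (𝔼-+ (λ a → u a * u a) (λ a → v a * v a))
        (sym (cong₂ _+_ (Var-center f) (Var-center g)))) ⟩
    (1ℚ + 1ℚ) * (Var f + Var g) ∎
    where
    open ℚP.≤-Reasoning
    u v : A → ℚ
    u a = f a - 𝔼 f
    v a = g a - 𝔼 g
    lem : ∀ x y m k → (1ℚ + 1ℚ) * ((x - m) * (x - m) + (y - k) * (y - k)) - (x + y - (m + k)) * (x + y - (m + k))
      ≡ (x - m - (y - k)) * (x - m - (y - k))
    lem = solve-∀ ℚ-ring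

  Var≤𝔼-square : ∀ f → Var f ≤ 𝔼 (λ a → f a * f a)
  Var≤𝔼-square f = ≤-by (square-nonneg (𝔼 f)) (lem (𝔼 (λ a → f a * f a)) (𝔼 f * 𝔼 f))
    where
    lem : ∀ s t → s - (s - t) ≡ t
    lem = solve-∀ ℚ-ring

open Expectation

infixr 5 _⊛_
_⊛_ : ∀ {A B} → Expectation A → Expectation B → Expectation (A × B)
μ ⊛ ν = record
  { 𝔼      = λ f → 𝔼 μ λ a → 𝔼 ν λ b → f (a , b)
  ; 𝔼-mono = λ h → 𝔼-mono μ λ a → 𝔼-mono ν λ b → h (a , b)
  ; 𝔼-+    = λ f g → trans (𝔼-cong μ λ a → 𝔼-+ ν _ _) (𝔼-+ μ _ _)
  ; 𝔼-*ˡ   = λ c f → trans (𝔼-cong μ λ a → 𝔼-*ˡ ν c _) (𝔼-*ˡ μ c _)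
  ; 𝔼-1    = trans (𝔼-cong μ λ a → 𝔼-1 ν) (𝔼-1 μ)
  }

image : ∀ {A B} → (A → B) → Expectation A → Expectation B
image φ μ = record
  { 𝔼      = λ f → 𝔼 μ λ a → f (φ a)
  ; 𝔼-mono = λ h → 𝔼-mono μ λ a → h (φ a)
  ; 𝔼-+    = λ f g → 𝔼-+ μ _ _
  ; 𝔼-*ˡ   = λ c f → 𝔼-*ˡ μ c _
  ; 𝔼-1    = 𝔼-1 μ
  }

dirac : ∀ {A} → A → Expectation A
dirac a = record
  { 𝔼      = λ f → f a
  ; 𝔼-mono = λ h → h a
  ; 𝔼-+    = λ f g → refl
  ; 𝔼-*ˡ   = λ c f → refl
  ; 𝔼-1    = refl
  }

-- Law of total variance, conditioning on the first component.
Var-⊛ : ∀ {A B} (μ : Expectation A) (ν : Expectation B) f →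
  Var (μ ⊛ ν) f ≡ Var μ (λ a → 𝔼 ν λ b → f (a , b)) + 𝔼 μ (λ a → Var ν λ b → f (a , b))
Var-⊛ μ ν f = trans (lem (𝔼 μ λ a → 𝔼 ν λ b → f (a , b) * f (a , b)) (𝔼 μ (λ a → m a * m a)) (𝔼 μ m))
  (cong (Var μ m +_) (sym (𝔼-- μ (λ a → 𝔼 ν λ b → f (a , b) * f (a , b)) (λ a → m a * m a))))
  where
  m = λ a → 𝔼 ν λ b → f (a , b)
  lem : ∀ s t e → s - e * e ≡ t - e * e + (s - t)
  lem = solve-∀ ℚ-ring

⊛-fst : ∀ {A B} (μ : Expectation A) (ν : Expectation B) f → 𝔼 (μ ⊛ ν) (λ ab → f (proj₁ ab)) ≡ 𝔼 μ f
⊛-fst μ ν f = 𝔼-cong μ λ a → 𝔼-const ν (f a)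

iidE : ∀ {A} → Expectation A → (n : ℕ) → Expectation (Vec A n)
iidE μ zero    = dirac []
iidE μ (suc n) = image (uncurry _∷_) (μ ⊛ iidE μ n)

bernoulliE : (q : ℚ) → 0ℚ ≤ q → q ≤ 1ℚ → Expectation Bool
bernoulliE q 0≤q q≤1 = record
  { 𝔼      = λ f → q * f true + (1ℚ - q) * f false
  ; 𝔼-mono = λ h → +-mono-≤ (*-monoˡ q 0≤q (h true)) (*-monoˡ (1ℚ - q) (≤⇒0≤- q≤1) (h false))
  ; 𝔼-+    = λ f g → lem₁ q (f true) (f false) (g true) (g false)
  ; 𝔼-*ˡ   = λ c f → lem₂ q c (f true) (f false)
  ; 𝔼-1    = lem₃ q
  }
  where
  lem₁ : ∀ q a b c d → q * (a + c) + (1ℚ - q) * (b + d) ≡ q * a + (1ℚ - q) * b + (q * c + (1ℚ - q) * d)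
  lem₁ = solve-∀ ℚ-ring
  lem₂ : ∀ q c a b → q * (c * a) + (1ℚ - q) * (c * b) ≡ c * (q * a + (1ℚ - q) * b)
  lem₂ = solve-∀ ℚ-ring
  lem₃ : ∀ q → q * 1ℚ + (1ℚ - q) * 1ℚ ≡ 1ℚ
  lem₃ = solve-∀ ℚ-ring

graphE : Expectation Bool → (n : ℕ) → Expectation (Graph n)
graphE μ zero    = dirac empty
graphE μ (suc n) = image (uncurry extend) (iidE μ n ⊛ graphE μ n)

-- Random graphs: variance of sums over rows, law of a row

∑ : ∀ {n} → (Fin n → ℚ) → ℚ
∑ {zero}  f = 0ℚ
∑ {suc n} f = f zero + ∑ (λ u → f (suc u))

∑-cong : ∀ {n} {f g : Fin n → ℚ} → (∀ u → f u ≡ g u) → ∑ f ≡ ∑ g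
∑-cong {zero}  h = refl
∑-cong {suc n} h = cong₂ _+_ (h zero) (∑-cong λ u → h (suc u))

∑-mono : ∀ {n} {f g : Fin n → ℚ} → (∀ u → f u ≤ g u) → ∑ f ≤ ∑ g
∑-mono {zero}  h = ≤-refl
∑-mono {suc n} h = +-mono-≤ (h zero) (∑-mono λ u → h (suc u))

∑-const : ∀ n c → ∑ {n} (λ _ → c) ≡ ι n * c
∑-const zero    c = sym (*-zeroˡ c)
∑-const (suc n) c = trans (cong (c +_) (∑-const n c)) (lem (ι n) c)
  where
  lem : ∀ k c → c + k * c ≡ (1ℚ + k) * c
  lem = solve-∀ ℚ-ring

∑-+ : ∀ {n} (f g : Fin n → ℚ) → ∑ (λ u → f u + g u) ≡ ∑ f + ∑ g
∑-+ {zero}  f g = refl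
∑-+ {suc n} f g = trans (cong (f zero + g zero +_) (∑-+ (λ u → f (suc u)) (λ u → g (suc u))))
  (lem (f zero) (g zero) _ _)
  where
  lem : ∀ a b c d → a + b + (c + d) ≡ a + c + (b + d)
  lem = solve-∀ ℚ-ring

∑-nonneg : ∀ {n} {f : Fin n → ℚ} → (∀ u → 0ℚ ≤ f u) → 0ℚ ≤ ∑ f
∑-nonneg {zero}  h = ≤-refl
∑-nonneg {suc n} h = +-nonneg (h zero) (∑-nonneg λ u → h (suc u))

∑-member : ∀ {n} {f : Fin n → ℚ} → (∀ u → 0ℚ ≤ f u) → ∀ u → f u ≤ ∑ f
∑-member {suc n} {f} h zero    = ≤-by (∑-nonneg λ u → h (suc u)) (x+y-x (f zero) _)
∑-member {suc n} {f} h (suc u) = ≤-trans (∑-member (λ v → h (suc v)) u) (≤-by (h zero) (x+y-y (f zero) _))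

𝔼-∑ : ∀ {A} (μ : Expectation A) {n} (f : Fin n → A → ℚ) →
  𝔼 μ (λ a → ∑ λ u → f u a) ≡ ∑ λ u → 𝔼 μ (f u)
𝔼-∑ μ {zero}  f = 𝔼-const μ 0ℚ
𝔼-∑ μ {suc n} f = trans (𝔼-+ μ (f zero) _) (cong (𝔼 μ (f zero) +_) (𝔼-∑ μ (λ u → f (suc u))))

module _ {A : Set} (μ : Expectation A) where

  iid-marginal : ∀ {n} (u : Fin n) f → 𝔼 (iidE μ n) (λ N → f (lookup N u)) ≡ 𝔼 μ f
  iid-marginal {suc n} zero    f = ⊛-fst μ (iidE μ n) f
  iid-marginal {suc n} (suc u) f = trans (𝔼-const μ _) (iid-marginal u f)

  iid-Var : ∀ n (χ : Fin n → A → ℚ) →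
    Var (iidE μ n) (λ N → ∑ λ u → χ u (lookup N u)) ≡ ∑ λ u → Var μ (χ u)
  iid-Var zero    χ = refl
  iid-Var (suc n) χ = trans (Var-⊛ μ (iidE μ n) (λ (b , N) → χ zero b + rest N)) (cong₂ _+_
    (trans (Var-cong μ λ b → trans (𝔼-+ (iidE μ n) (λ _ → χ zero b) rest)
                               (trans (cong (_+ 𝔼 (iidE μ n) rest) (𝔼-const (iidE μ n) (χ zero b)))
                                 (+-comm (χ zero b) _)))
           (Var-const-+ μ (𝔼 (iidE μ n) rest) (χ zero)))
    (trans (𝔼-cong μ λ b → Var-const-+ (iidE μ n) (χ zero b) rest)
           (trans (𝔼-const μ (Var (iidE μ n) rest)) (iid-Var n (λ u → χ (suc u))))))
    where
    rest : Vec A n → ℚ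
    rest N = ∑ λ u → χ (suc u) (lookup N u)

noEdges : ∀ n → Graph n
noEdges zero    = empty
noEdges (suc n) = extend (Vec.replicate n false) (noEdges n)

RowLocal : ∀ {n} → Fin n → (Graph n → ℚ) → Set
RowLocal u X = ∀ G H → (∀ v → adj G u v ≡ adj H u v) → X G ≡ X H

2ℚ : ℚ
2ℚ = 1ℚ + 1ℚ

0≤2 : 0ℚ ≤ 2ℚ
0≤2 = nonNegative⁻¹ 2ℚ

module _ (μ : Expectation Bool) where

  -- Each edge belongs to only two rows, so the rows are almost independent.
  Var-rows : ∀ n (X : Fin n → Graph n → ℚ) → (∀ u → RowLocal u (X u)) →
    Var (graphE μ n) (λ G → ∑ λ u → X u G) ≤ 2ℚ * ∑ λ u → Var (graphE μ n) (X u)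
  Var-rows zero    X local = ≤-refl
  Var-rows (suc n) X local = begin
    Var (graphE μ (suc n)) (λ G → ∑ λ u → X u G)
      ≡⟨ Var-⊛ νN νG (λ (N , G) → ∑ λ u → X u (extend N G)) ⟩
    Var νN (λ N → 𝔼 νG λ G → ∑ λ u → X u (extend N G)) + 𝔼 νN (λ N → Var νG λ G → ∑ λ u → X u (extend N G))
      -- The part within is handled by induction and the part between loses a factor 2 once. The two
      -- parts add, so the factor does not compound over the vertices.
      ≤⟨ +-mono-≤ between within ⟩
    2ℚ * (Var νN X₀ + ∑ λ u → Var μ (χ u)) + 2ℚ * ∑ (λ u → 𝔼 νN λ N → Var νG λ G → X (suc u) (extend N G))
      ≡⟨ trans (lem (Var νN X₀) _ _) (cong (λ z → 2ℚ * (Var νN X₀ + z)) (sym (∑-+ (λ u → Var μ (χ u)) _))) ⟩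
    2ℚ * (Var νN X₀ + ∑ λ u → Var μ (χ u) + 𝔼 νN λ N → Var νG λ G → X (suc u) (extend N G))
      ≡⟨ cong (2ℚ *_) (cong₂ _+_ total₀ (∑-cong totalₛ)) ⟨
    2ℚ * ∑ (λ u → Var (graphE μ (suc n)) (X u)) ∎
    where
    open ℚP.≤-Reasoning
    νN = iidE μ n
    νG = graphE μ n
    X₀ : Vec Bool n → ℚ
    X₀ N = X zero (extend N (noEdges n))
    -- Averaged over `G`, `X (suc u)` sees only bit `u` of the new row, so the constant row with
    -- that bit may stand in for it. These means are functions of independent bits.
    χ : Fin n → Bool → ℚ
    χ u b = 𝔼 νG λ G → X (suc u) (extend (Vec.replicate n b) G)
    X₀-const : ∀ N G → X zero (extend N G) ≡ X₀ N
    X₀-const N G = local zero _ _ λ { zero → refl ; (suc v) → refl }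
    χ-correct : ∀ u N → 𝔼 νG (λ G → X (suc u) (extend N G)) ≡ χ u (lookup N u)
    χ-correct u N = 𝔼-cong νG λ G → local (suc u) _ _
      λ { zero → sym (VecP.lookup-replicate u (lookup N u)) ; (suc v) → refl }
    total₀ : Var (graphE μ (suc n)) (X zero) ≡ Var νN X₀
    total₀ = trans (Var-cong (graphE μ (suc n)) {X zero} {λ { (extend N G) → X₀ N }}
      λ { (extend N G) → X₀-const N G })
      (cong₂ _-_ (⊛-fst νN νG (λ N → X₀ N * X₀ N)) (cong₂ _*_ (⊛-fst νN νG X₀) (⊛-fst νN νG X₀)))
    totalₛ : ∀ u → Var (graphE μ (suc n)) (X (suc u)) ≡
      Var μ (χ u) + 𝔼 νN (λ N → Var νG λ G → X (suc u) (extend N G))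
    totalₛ u = trans (Var-⊛ νN νG (λ (N , G) → X (suc u) (extend N G)))
      (cong (_+ 𝔼 νN (λ N → Var νG λ G → X (suc u) (extend N G)))
      (trans (Var-cong νN (χ-correct u))
        (cong₂ _-_ (iid-marginal μ u (λ b → χ u b * χ u b))
                   (cong₂ _*_ (iid-marginal μ u (χ u)) (iid-marginal μ u (χ u))))))
    within : 𝔼 νN (λ N → Var νG λ G → ∑ λ u → X u (extend N G)) ≤
      2ℚ * ∑ (λ u → 𝔼 νN λ N → Var νG λ G → X (suc u) (extend N G))
    within = begin
      𝔼 νN (λ N → Var νG λ G → ∑ λ u → X u (extend N G))
        ≤⟨ 𝔼-mono νN (λ N → ≤-trans
             (≤-reflexive (trans (Var-cong νG λ G → cong (_+ ∑ λ u → X (suc u) (extend N G)) (X₀-const N G))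
                                    (Var-const-+ νG (X₀ N) _)))
             (Var-rows n (λ u G → X (suc u) (extend N G))
                (λ u G H eq → local (suc u) _ _ λ { zero → refl ; (suc v) → eq v }))) ⟩
      𝔼 νN (λ N → 2ℚ * ∑ λ u → Var νG λ G → X (suc u) (extend N G))
        ≡⟨ trans (𝔼-*ˡ νN 2ℚ (λ N → ∑ λ u → Var νG λ G → X (suc u) (extend N G)))
                  (cong (2ℚ *_) (𝔼-∑ νN (λ u N → Var νG λ G → X (suc u) (extend N G)))) ⟩
      2ℚ * ∑ (λ u → 𝔼 νN λ N → Var νG λ G → X (suc u) (extend N G)) ∎
    between : Var νN (λ N → 𝔼 νG λ G → ∑ λ u → X u (extend N G)) ≤ 2ℚ * (Var νN X₀ + ∑ λ u → Var μ (χ u))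
    between = begin
      Var νN (λ N → 𝔼 νG λ G → ∑ λ u → X u (extend N G))
        ≡⟨ Var-cong νN (λ N → trans (𝔼-+ νG _ (λ G → ∑ λ u → X (suc u) (extend N G))) (cong₂ _+_
             (trans (𝔼-cong νG (X₀-const N)) (𝔼-const νG (X₀ N)))
             (trans (𝔼-∑ νG (λ u G → X (suc u) (extend N G))) (∑-cong λ u → χ-correct u N)))) ⟩
      Var νN (λ N → X₀ N + ∑ λ u → χ u (lookup N u))
        -- Row `zero` shares one bit with each other row; this is the only dependence that remains
        -- here.
        ≤⟨ Var-+≤ νN X₀ _ ⟩
      2ℚ * (Var νN X₀ + Var νN λ N → ∑ λ u → χ u (lookup N u))
        ≡⟨ cong (λ z → 2ℚ * (Var νN X₀ + z)) (iid-Var μ n χ) ⟩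
      2ℚ * (Var νN X₀ + ∑ λ u → Var μ (χ u)) ∎
    lem : ∀ a b c → 2ℚ * (a + b) + 2ℚ * c ≡ 2ℚ * (a + (b + c))
    lem = solve-∀ ℚ-ring

row : ∀ {n} → Graph n → Fin n → Vec Bool n
row G u = tabulate (adj G u)

-- A full vector of bits is sampled and its diagonal entry `u` erased afterwards, which keeps the
-- index type `Fin n` for the n - 1 other vertices.
row-marginal : ∀ μ {n} (u : Fin n) f →
  𝔼 (graphE μ n) (λ G → f (row G u)) ≡ 𝔼 (iidE μ n) (λ N → f (N [ u ]≔ false))
row-marginal μ {suc n} zero f = trans
  (𝔼-cong (iidE μ n) λ N → trans (𝔼-const (graphE μ n) _) (cong (λ z → f (false ∷ z)) (VecP.tabulate∘lookup N)))
  (sym (𝔼-const μ _))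
row-marginal μ {suc n} (suc u) f = trans
  (𝔼-cong (iidE μ n) λ N → row-marginal μ u (λ r → f (lookup N u ∷ r)))
  (iid-marginal μ u (λ b → 𝔼 (iidE μ n) λ M → f (b ∷ (M [ u ]≔ false))))

-- Symmetric walks

bind : ∀ {A B} → Expectation A → (A → Expectation B) → Expectation B
bind μ κ = record
  { 𝔼      = λ f → 𝔼 μ λ a → 𝔼 (κ a) f
  ; 𝔼-mono = λ h → 𝔼-mono μ λ a → 𝔼-mono (κ a) h
  ; 𝔼-+    = λ f g → trans (𝔼-cong μ λ a → 𝔼-+ (κ a) f g) (𝔼-+ μ _ _)
  ; 𝔼-*ˡ   = λ c f → trans (𝔼-cong μ λ a → 𝔼-*ˡ (κ a) c f) (𝔼-*ˡ μ c _)
  ; 𝔼-1    = trans (𝔼-cong μ λ a → 𝔼-1 (κ a)) (𝔼-1 μ)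
  }

Kernel : Set
Kernel = ℤ → Expectation ℤ

iterate : Kernel → ℕ → Kernel
iterate κ zero    x = dirac x
iterate κ (suc n) x = bind (iterate κ n x) κ

Commute : Kernel → Kernel → Set
Commute κ η = ∀ g x → 𝔼 (κ x) (λ y → 𝔼 (η y) g) ≡ 𝔼 (η x) (λ y → 𝔼 (κ y) g)

iterate-commute : ∀ κ η → Commute κ η → ∀ n → Commute (iterate κ n) η
iterate-commute κ η comm zero    g x = refl
iterate-commute κ η comm (suc n) g x = trans (𝔼-cong (iterate κ n x) (comm g))
  (iterate-commute κ η comm n (λ y → 𝔼 (κ y) g) x)

data Step : Set where
  up stay down : Step

shift : Step → ℤ
shift up   = 1ℤ
shift stay = 0ℤ
shift down = -1ℤ

dot : ∀ {n} → (Fin n → Step) → Vec Bool n → ℤ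
dot c []      = 0ℤ
dot c (b ∷ N) = (if b then shift (c zero) else 0ℤ) ℤ.+ dot (λ u → c (suc u)) N

addUp addDown : Step → ℕ → ℕ
addUp up   k = suc k
addUp stay k = k
addUp down k = k
addDown up   k = k
addDown stay k = k
addDown down k = suc k

ups downs : ∀ {n} → (Fin n → Step) → ℕ
ups {zero}  c = 0
ups {suc n} c = addUp (c zero) (ups λ u → c (suc u))
downs {zero}  c = 0
downs {suc n} c = addDown (c zero) (downs λ u → c (suc u))

-- Decreasing sequences and their partial sums

partialSum : (ℕ → ℚ) → ℕ → ℚ
partialSum f zero    = 0ℚ
partialSum f (suc k) = partialSum f k + f k

Decreasing : (ℕ → ℚ) → Set
Decreasing f = ∀ k → f (suc k) ≤ f k

module _ {f : ℕ → ℚ} (dec : Decreasing f) (nonneg : ∀ k → 0ℚ ≤ f k) where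

  decreasing-≤₀ : ∀ k → f k ≤ f 0
  decreasing-≤₀ zero    = ≤-refl
  decreasing-≤₀ (suc k) = ≤-trans (dec k) (decreasing-≤₀ k)

  partialSum-mono : ∀ m k → partialSum f m ≤ partialSum f (k ℕ.+ m)
  partialSum-mono m zero    = ≤-refl
  partialSum-mono m (suc k) = ≤-trans (partialSum-mono m k)
    (≤-by (nonneg (k ℕ.+ m)) (x+y-x (partialSum f (k ℕ.+ m)) (f (k ℕ.+ m))))

  partialSum≥ : ∀ k → ι k * f k ≤ partialSum f k
  partialSum≥ zero    = ≤-reflexive (*-zeroˡ (f 0))
  partialSum≥ (suc k) = ≤-by
    (+-nonneg (≤⇒0≤- (partialSum≥ k)) (*-nonneg (+-nonneg 0≤1 (ι-nonneg k)) (≤⇒0≤- (dec k))))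
    (lem (ι k) (f k) (f (suc k)) (partialSum f k))
    where
    lem : ∀ k a b s → s + a - (1ℚ + k) * b ≡ s - k * a + (1ℚ + k) * (a - b)
    lem = solve-∀ ℚ-ring

  partialSum≤ : ∀ k → partialSum f k ≤ ι k * f 0
  partialSum≤ zero    = ≤-reflexive (sym (*-zeroˡ (f 0)))
  partialSum≤ (suc k) = ≤-by (+-nonneg (≤⇒0≤- (partialSum≤ k)) (≤⇒0≤- (decreasing-≤₀ k)))
    (lem (ι k) (f 0) (f k) (partialSum f k))
    where
    lem : ∀ k a b s → (1ℚ + k) * a - (s + b) ≡ k * a - s + (a - b)
    lem = solve-∀ ℚ-ring

  decreasing-+ : ∀ k m → f (k ℕ.+ m) ≤ f m
  decreasing-+ zero    m = ≤-refl
  decreasing-+ (suc k) m = ≤-trans (dec (k ℕ.+ m)) (decreasing-+ k m)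

  -- The averages of a decreasing sequence decrease: each further term is at most `f m`, while
  -- `partialSum f m` is at least m times `f m`.
  partialSum-concave : ∀ m k → ι m * partialSum f (k ℕ.+ m) ≤ ι (k ℕ.+ m) * partialSum f m
  partialSum-concave m zero    = ≤-refl
  partialSum-concave m (suc k) = ≤-by
    (+-nonneg (≤⇒0≤- (partialSum-concave m k))
      (+-nonneg (≤⇒0≤- (partialSum≥ m)) (*-nonneg (ι-nonneg m) (≤⇒0≤- (decreasing-+ k m)))))
    (lem (ι m) (ι (k ℕ.+ m)) (partialSum f (k ℕ.+ m)) (partialSum f m) (f m) (f (k ℕ.+ m)))
    where
    lem : ∀ m l s t a b → (1ℚ + l) * t - m * (s + b) ≡ l * t - m * s + (t - m * a + m * (a - b))
    lem = solve-∀ ℚ-ring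

-- The lazy symmetric walk and its unimodal law

δℕ : ℕ → ℚ
δℕ zero    = 1ℚ
δℕ (suc _) = 0ℚ

δ : ℤ → ℚ
δ x = δℕ ℤ.∣ x ∣

module Walk (q : ℚ) (0≤q : 0ℚ ≤ q) (q≤1 : q ≤ 1ℚ) where

  bern : Expectation Bool
  bern = bernoulliE q 0≤q q≤1

  move : ℤ → Kernel
  move c x = image (λ b → if b then c ℤ.+ x else x) bern

  lazy : Kernel
  lazy x = bind (move 1ℤ x) (move -1ℤ)

  move-commute : ∀ c d → Commute (move c) (move d)
  move-commute c d g x = trans (lem q (g (d ℤ.+ (c ℤ.+ x))) (g (c ℤ.+ x)) (g (d ℤ.+ x)) (g x))
    (cong (λ z → q * (q * g z + (1ℚ - q) * g (d ℤ.+ x)) + (1ℚ - q) * (q * g (c ℤ.+ x) + (1ℚ - q) * g x)) (swap c d x))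
    where
    lem : ∀ q a b c d → q * (q * a + (1ℚ - q) * b) + (1ℚ - q) * (q * c + (1ℚ - q) * d)
      ≡ q * (q * a + (1ℚ - q) * c) + (1ℚ - q) * (q * b + (1ℚ - q) * d)
    lem = solve-∀ ℚ-ring
    swap : ∀ c d x → d ℤ.+ (c ℤ.+ x) ≡ c ℤ.+ (d ℤ.+ x)
    swap = ℤSolver.solve-∀

  -- The bits are independent and the moves commute, so the moves can be sorted with all ups before
  -- all downs. Only their numbers matter.
  dot-walk : ∀ {n} (c : Fin n → Step) g x →
    𝔼 (iidE bern n) (λ N → g (dot c N ℤ.+ x)) ≡
    𝔼 (iterate (move 1ℤ) (ups c) x) (λ y → 𝔼 (iterate (move -1ℤ) (downs c) y) g)
  dot-walk {zero}  c g x = cong g (ℤP.+-identityˡ x)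
  dot-walk {suc n} c g x = trans (first (shift (c zero))) (rest (c zero))
    where
    c′ = λ u → c (suc u)
    D = dot c′
    first : ∀ k → 𝔼 bern (λ b → 𝔼 (iidE bern n) λ N → g ((if b then k else 0ℤ) ℤ.+ D N ℤ.+ x))
      ≡ 𝔼 (iidE bern n) (λ N → 𝔼 (move k (D N ℤ.+ x)) g)
    first k = trans (cong₂ _+_
        (trans (sym (𝔼-*ˡ (iidE bern n) q (λ N → g (k ℤ.+ D N ℤ.+ x))))
               (𝔼-cong (iidE bern n) λ N → cong (λ z → q * g z) (ℤP.+-assoc k (D N) x)))
        (trans (sym (𝔼-*ˡ (iidE bern n) (1ℚ - q) (λ N → g (0ℤ ℤ.+ D N ℤ.+ x))))
               (𝔼-cong (iidE bern n) λ N → cong (λ z → (1ℚ - q) * g (z ℤ.+ x)) (ℤP.+-identityˡ (D N)))))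
      (sym (𝔼-+ (iidE bern n) (λ N → q * g (k ℤ.+ (D N ℤ.+ x))) (λ N → (1ℚ - q) * g (D N ℤ.+ x))))
    rest : ∀ c₀ → 𝔼 (iidE bern n) (λ N → 𝔼 (move (shift c₀) (D N ℤ.+ x)) g) ≡
      𝔼 (iterate (move 1ℤ) (addUp c₀ (ups c′)) x) (λ y → 𝔼 (iterate (move -1ℤ) (addDown c₀ (downs c′)) y) g)
    rest up   = trans (dot-walk c′ (λ z → 𝔼 (move 1ℤ z) g) x)
      (𝔼-cong (iterate (move 1ℤ) (ups c′) x)
        (iterate-commute (move -1ℤ) (move 1ℤ) (move-commute -1ℤ 1ℤ) (downs c′) g))
    rest down = dot-walk c′ (λ z → 𝔼 (move -1ℤ z) g) x
    rest stay = trans (𝔼-cong (iidE bern n) λ N →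
        trans (cong (λ z → q * g z + (1ℚ - q) * g (D N ℤ.+ x)) (ℤP.+-identityˡ (D N ℤ.+ x)))
              (lem q (g (D N ℤ.+ x))))
      (dot-walk c′ g x)
      where
      lem : ∀ q a → q * a + (1ℚ - q) * a ≡ a
      lem = solve-∀ ℚ-ring

  iterate-+ : ∀ κ m n x g → 𝔼 (iterate κ (m ℕ.+ n) x) g ≡ 𝔼 (iterate κ n x) (λ y → 𝔼 (iterate κ m y) g)
  iterate-+ κ zero    n x g = refl
  iterate-+ κ (suc m) n x g = iterate-+ κ m n x (λ y → 𝔼 (κ y) g)

  -- Commuting moves can be interleaved, so that each up together with a down forms one `lazy` step.
  balance : ∀ a x g → 𝔼 (iterate (move 1ℤ) a x) (λ y → 𝔼 (iterate (move -1ℤ) a y) g) ≡ 𝔼 (iterate lazy a x) g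
  balance zero    x g = refl
  balance (suc a) x g = trans
    (𝔼-cong (iterate (move 1ℤ) a x) λ y → sym (iterate-commute (move -1ℤ) (move 1ℤ) (move-commute -1ℤ 1ℤ) a
      (λ z → 𝔼 (move -1ℤ z) g) y))
    (balance a x (λ z → 𝔼 (lazy z) g))

  unbalanced-walk : ∀ a d x g →
    𝔼 (iterate (move 1ℤ) (a ℕ.+ d) x) (λ y → 𝔼 (iterate (move -1ℤ) a y) g) ≡
    𝔼 (iterate (move 1ℤ) d x) (λ y → 𝔼 (iterate lazy a y) g)
  unbalanced-walk a d x g = trans (iterate-+ (move 1ℤ) a d x _) (𝔼-cong (iterate (move 1ℤ) d x) λ y → balance a y g)

  r : ℚ
  r = q * (1ℚ - q)

  0≤r : 0ℚ ≤ r
  0≤r = *-nonneg 0≤q (≤⇒0≤- q≤1)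

  4r≤1 : 2ℚ * (2ℚ * r) ≤ 1ℚ
  4r≤1 = ≤-by (square-nonneg (1ℚ - 2ℚ * q)) (lem q)
    where
    lem : ∀ q → 1ℚ - 2ℚ * (2ℚ * (q * (1ℚ - q))) ≡ (1ℚ - 2ℚ * q) * (1ℚ - 2ℚ * q)
    lem = solve-∀ ℚ-ring

  -- The action of `lazy` on even functions, folded to absolute values; at 0 both neighbours fold to
  -- 1.
  lazyℕ : (ℕ → ℚ) → ℕ → ℚ
  lazyℕ f zero    = (1ℚ - 2ℚ * r) * f 0 + 2ℚ * r * f 1
  lazyℕ f (suc k) = r * f k + (1ℚ - 2ℚ * r) * f (suc k) + r * f (suc (suc k))

  lazy-form : ∀ g x → 𝔼 (lazy x) g ≡ r * g (1ℤ ℤ.+ x) + (1ℚ - 2ℚ * r) * g x + r * g (-1ℤ ℤ.+ x)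
  lazy-form g x = trans (cong
    (λ z → q * (q * g z + (1ℚ - q) * g (1ℤ ℤ.+ x)) + (1ℚ - q) * (q * g (-1ℤ ℤ.+ x) + (1ℚ - q) * g x)) (back x))
    (lem q (g (1ℤ ℤ.+ x)) (g x) (g (-1ℤ ℤ.+ x)))
    where
    back : ∀ x → -1ℤ ℤ.+ (1ℤ ℤ.+ x) ≡ x
    back = ℤSolver.solve-∀
    lem : ∀ q a b c → q * (q * b + (1ℚ - q) * a) + (1ℚ - q) * (q * c + (1ℚ - q) * b) ≡
      q * (1ℚ - q) * a + (1ℚ - 2ℚ * (q * (1ℚ - q))) * b + q * (1ℚ - q) * c
    lem = solve-∀ ℚ-ring

  lazy-∣∣ : ∀ f x → 𝔼 (lazy x) (λ y → f ℤ.∣ y ∣) ≡ lazyℕ f ℤ.∣ x ∣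
  lazy-∣∣ f x = trans (lazy-form (λ y → f ℤ.∣ y ∣) x) (cases x)
    where
    lem₀ : ∀ r a b → r * b + (1ℚ - 2ℚ * r) * a + r * b ≡ (1ℚ - 2ℚ * r) * a + 2ℚ * r * b
    lem₀ = solve-∀ ℚ-ring
    lem₁ : ∀ r a b c → r * c + (1ℚ - 2ℚ * r) * b + r * a ≡ r * a + (1ℚ - 2ℚ * r) * b + r * c
    lem₁ = solve-∀ ℚ-ring
    cases : ∀ x → r * f ℤ.∣ 1ℤ ℤ.+ x ∣ + (1ℚ - 2ℚ * r) * f ℤ.∣ x ∣ + r * f ℤ.∣ -1ℤ ℤ.+ x ∣ ≡ lazyℕ f ℤ.∣ x ∣
    cases (ℤ.+ zero)         = lem₀ r (f 0) (f 1)
    cases (ℤ.+ suc k)        = lem₁ r (f k) (f (suc k)) (f (suc (suc k)))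
    cases -[1+ zero ]        = refl
    cases -[1+ suc k ]       = refl

  -- Evolved backwards: `law a k` is the probability of being at 0 after `a` steps from k, which by
  -- symmetry is also that of being at k, or at -k, after starting from 0.
  law : ℕ → ℕ → ℚ
  law zero    = δℕ
  law (suc a) = lazyℕ (law a)

  iterate-inner : ∀ κ n x g → 𝔼 (κ x) (λ y → 𝔼 (iterate κ n y) g) ≡ 𝔼 (iterate κ (suc n) x) g
  iterate-inner κ n x g = sym (iterate-commute κ κ (λ _ _ → refl) n g x)

  iterate-law : ∀ a x → 𝔼 (iterate lazy a x) δ ≡ law a ℤ.∣ x ∣
  iterate-law zero    x = refl
  iterate-law (suc a) x = trans (sym (iterate-inner lazy a x δ))
    (trans (𝔼-cong (lazy x) (iterate-law a)) (lazy-∣∣ (law a) x))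

  law-nonneg : ∀ a k → 0ℚ ≤ law a k
  law-nonneg a k = subst (0ℚ ≤_) (iterate-law a (ℤ.+ k)) (𝔼-nonneg (iterate lazy a (ℤ.+ k)) λ x → δ-nonneg ℤ.∣ x ∣)
    where
    δ-nonneg : ∀ k → 0ℚ ≤ δℕ k
    δ-nonneg zero    = 0≤1
    δ-nonneg (suc k) = ≤-refl

  -- Since r ≤ 1/4, the walk stays put with probability at least 1/2, and this weight outweighs what
  -- leaks across a descent. A simple walk alternates between the parities and is not unimodal.
  lazyℕ-decreasing : ∀ {f} → Decreasing f → Decreasing (lazyℕ f)
  lazyℕ-decreasing {f} dec zero = ≤-by
    (+-nonneg (*-nonneg 1-3r (≤⇒0≤- (dec 0))) (*-nonneg 0≤r (≤⇒0≤- (dec 1))))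
    (lem r (f 0) (f 1) (f 2))
    where
    1-3r : 0ℚ ≤ 1ℚ - 2ℚ * (2ℚ * r) + r
    1-3r = +-nonneg (≤⇒0≤- 4r≤1) 0≤r
    lem : ∀ r a b c → (1ℚ - 2ℚ * r) * a + 2ℚ * r * b - (r * a + (1ℚ - 2ℚ * r) * b + r * c) ≡
      (1ℚ - 2ℚ * (2ℚ * r) + r) * (a - b) + r * (b - c)
    lem = solve-∀ ℚ-ring
  lazyℕ-decreasing {f} dec (suc k) = ≤-by
    (+-nonneg (*-nonneg 0≤r (≤⇒0≤- (dec k)))
      (+-nonneg (*-nonneg 1-2r (≤⇒0≤- (dec (suc k)))) (*-nonneg 0≤r (≤⇒0≤- (dec (suc (suc k)))))))
    (lem r (f k) (f (suc k)) (f (suc (suc k))) (f (suc (suc (suc k)))))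
    where
    1-2r : 0ℚ ≤ 1ℚ - 2ℚ * (2ℚ * r) + (r + r)
    1-2r = +-nonneg (≤⇒0≤- 4r≤1) (+-nonneg 0≤r 0≤r)
    lem : ∀ r a b c d → r * a + (1ℚ - 2ℚ * r) * b + r * c - (r * b + (1ℚ - 2ℚ * r) * c + r * d) ≡
      r * (a - b) + ((1ℚ - 2ℚ * (2ℚ * r) + (r + r)) * (b - c) + r * (c - d))
    lem = solve-∀ ℚ-ring

  law-decreasing : ∀ a → Decreasing (law a)
  law-decreasing zero    zero    = 0≤1
  law-decreasing zero    (suc k) = ≤-refl
  law-decreasing (suc a) = lazyℕ-decreasing (law-decreasing a)

  lazy-shift : ∀ a c g x → 𝔼 (iterate lazy a x) (λ y → g (c ℤ.+ y)) ≡ 𝔼 (iterate lazy a (c ℤ.+ x)) g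
  lazy-shift zero    c g x = refl
  lazy-shift (suc a) c g x = trans (𝔼-cong (iterate lazy a x) λ y → trans (lazy-form (λ y → g (c ℤ.+ y)) y)
      (trans (cong₂ (λ u v → r * g u + (1ℚ - 2ℚ * r) * g (c ℤ.+ y) + r * g v) (swap c y 1ℤ) (swap c y -1ℤ))
             (sym (lazy-form g (c ℤ.+ y)))))
    (lazy-shift a c (λ y → 𝔼 (lazy y) g) x)
    where
    swap : ∀ c y d → c ℤ.+ (d ℤ.+ y) ≡ d ℤ.+ (c ℤ.+ y)
    swap = ℤSolver.solve-∀

  lazy-reflect : ∀ a g x → 𝔼 (iterate lazy a x) (λ y → g (ℤ.- y)) ≡ 𝔼 (iterate lazy a (ℤ.- x)) g
  lazy-reflect zero    g x = refl
  lazy-reflect (suc a) g x = trans (𝔼-cong (iterate lazy a x) λ y → trans (lazy-form (λ y → g (ℤ.- y)) y)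
      (trans (cong₂ (λ u v → r * g u + (1ℚ - 2ℚ * r) * g (ℤ.- y) + r * g v)
               (ℤP.neg-distrib-+ 1ℤ y) (ℤP.neg-distrib-+ -1ℤ y))
             (trans (lem r _ _ _) (sym (lazy-form g (ℤ.- y))))))
    (lazy-reflect a (λ y → 𝔼 (lazy y) g) x)
    where
    lem : ∀ r a b c → r * a + (1ℚ - 2ℚ * r) * b + r * c ≡ r * c + (1ℚ - 2ℚ * r) * b + r * a
    lem = solve-∀ ℚ-ring

  second-moment : ∀ a x → 𝔼 (iterate lazy a x) (λ y → ι ℤ.∣ y ∣ * ι ℤ.∣ y ∣) ≡ ι ℤ.∣ x ∣ * ι ℤ.∣ x ∣ + ι a * (2ℚ * r)
  second-moment zero    x = lem (ι ℤ.∣ x ∣ * ι ℤ.∣ x ∣) (2ℚ * r)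
    where
    lem : ∀ s r → s ≡ s + 0ℚ * r
    lem = solve-∀ ℚ-ring
  second-moment (suc a) x = trans
    (𝔼-cong (iterate lazy a x) λ y → trans (lazy-∣∣ (λ k → ι k * ι k) y) (square ℤ.∣ y ∣))
    (trans (𝔼-+ (iterate lazy a x) (λ y → ι ℤ.∣ y ∣ * ι ℤ.∣ y ∣) (λ _ → 2ℚ * r))
      (trans (cong₂ _+_ (second-moment a x) (𝔼-const (iterate lazy a x) (2ℚ * r)))
        (lem (ι ℤ.∣ x ∣ * ι ℤ.∣ x ∣) (ι a) (2ℚ * r))))
    where
    square : ∀ k → lazyℕ (λ k → ι k * ι k) k ≡ ι k * ι k + 2ℚ * r
    square zero    = lem₀ r
      where
      lem₀ : ∀ r → (1ℚ - 2ℚ * r) * (0ℚ * 0ℚ) + 2ℚ * r * ((1ℚ + 0ℚ) * (1ℚ + 0ℚ)) ≡ 0ℚ * 0ℚ + 2ℚ * r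
      lem₀ = solve-∀ ℚ-ring
    square (suc k) = lem₁ r (ι k)
      where
      lem₁ : ∀ r k → r * (k * k) + (1ℚ - 2ℚ * r) * ((1ℚ + k) * (1ℚ + k)) + r * ((1ℚ + (1ℚ + k)) * (1ℚ + (1ℚ + k))) ≡
        (1ℚ + k) * (1ℚ + k) + 2ℚ * r
      lem₁ = solve-∀ ℚ-ring
    lem : ∀ s a r → s + a * r + r ≡ s + (1ℚ + a) * r
    lem = solve-∀ ℚ-ring

-- The bias of a majority

-- A sum of spins is forced to be positive, whatever one further spin is, once it reaches 2.
sgn₂ : ℤ → ℚ
sgn₂ (ℤ.+ zero)        = - 1ℚ
sgn₂ (ℤ.+ suc zero)    = - 1ℚ
sgn₂ (ℤ.+ suc (suc _)) = 1ℚ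
sgn₂ -[1+ _ ]          = - 1ℚ

module Bias (q : ℚ) (0≤q : 0ℚ ≤ q) (q≤1 : q ≤ 1ℚ) where

  open Walk q 0≤q q≤1

  -- An up walk started in ℕ stays there, so the comparison takes place on ℕ, where `H-quadratic` is
  -- stated.
  up-mono : ∀ d x {f g} → (∀ z → f (ℤ.+ z) ≤ g (ℤ.+ z)) →
    𝔼 (iterate (move 1ℤ) d (ℤ.+ x)) f ≤ 𝔼 (iterate (move 1ℤ) d (ℤ.+ x)) g
  up-mono zero    x h = h x
  up-mono (suc d) x h = up-mono d x λ z →
    +-mono-≤ (*-monoˡ q 0≤q (h (suc z))) (*-monoˡ (1ℚ - q) (≤⇒0≤- q≤1) (h z))

  up-cong : ∀ d x {f g} → (∀ z → f (ℤ.+ z) ≡ g (ℤ.+ z)) →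
    𝔼 (iterate (move 1ℤ) d (ℤ.+ x)) f ≡ 𝔼 (iterate (move 1ℤ) d (ℤ.+ x)) g
  up-cong d x h = ≤-antisym (up-mono d x λ z → ≤-reflexive (h z))
                               (up-mono d x λ z → ≤-reflexive (sym (h z)))

  up-mean : ∀ d → 𝔼 (iterate (move 1ℤ) d 0ℤ) (λ y → ι ℤ.∣ y ∣) ≡ ι d * q
  up-mean zero    = sym (*-zeroˡ q)
  up-mean (suc d) = trans (up-cong d 0 {g = λ y → q + ι ℤ.∣ y ∣} λ z → lem q (ι z))
    (trans (𝔼-+ Z (λ _ → q) _) (trans (cong₂ _+_ (𝔼-const Z q) (up-mean d)) (lem₂ q (ι d))))
    where
    Z = iterate (move 1ℤ) d 0ℤ
    lem : ∀ q z → q * (1ℚ + z) + (1ℚ - q) * z ≡ q + z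
    lem = solve-∀ ℚ-ring
    lem₂ : ∀ q d → q + d * q ≡ (1ℚ + d) * q
    lem₂ = solve-∀ ℚ-ring

  up-second-moment : ∀ d → 𝔼 (iterate (move 1ℤ) d 0ℤ) (λ y → ι ℤ.∣ y ∣ * ι ℤ.∣ y ∣) ≡
    (ι d * q) * (ι d * q) + ι d * r
  up-second-moment zero    = lem q r
    where
    lem : ∀ q r → 0ℚ ≡ (0ℚ * q) * (0ℚ * q) + 0ℚ * r
    lem = solve-∀ ℚ-ring
  up-second-moment (suc d) = trans
    (up-cong d 0 {g = λ y → q + (2ℚ * q * ι ℤ.∣ y ∣ + ι ℤ.∣ y ∣ * ι ℤ.∣ y ∣)} λ z → lem q (ι z))
    (trans (𝔼-+ Z (λ _ → q) _) (trans (cong₂ _+_ (𝔼-const Z q)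
        (trans (𝔼-+ Z (λ y → 2ℚ * q * ι ℤ.∣ y ∣) _)
               (cong₂ _+_ (trans (𝔼-*ˡ Z (2ℚ * q) _) (cong (2ℚ * q *_) (up-mean d))) (up-second-moment d))))
      (lem₂ q (ι d))))
    where
    Z = iterate (move 1ℤ) d 0ℤ
    lem : ∀ q z → q * ((1ℚ + z) * (1ℚ + z)) + (1ℚ - q) * (z * z) ≡ q + (2ℚ * q * z + z * z)
    lem = solve-∀ ℚ-ring
    lem₂ : ∀ q d → q + (2ℚ * q * (d * q) + ((d * q) * (d * q) + d * (q * (1ℚ - q)))) ≡
      ((1ℚ + d) * q) * ((1ℚ + d) * q) + (1ℚ + d) * (q * (1ℚ - q))
    lem₂ = solve-∀ ℚ-ring

  module _ (a : ℕ) where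

    W : Expectation ℤ
    W = iterate lazy a 0ℤ

    v : ℕ → ℚ
    v = law a

    H : ℤ → ℚ
    H y = 𝔼 (iterate lazy a y) sgn₂

    V : ℕ → ℚ
    V = partialSum v

    -- About 1, `sgn₂` is odd except for its value -1 at 1 itself; reflecting the symmetric walk
    -- cancels everything but this defect.
    H-one : H 1ℤ ≡ - v 0
    H-one = lem₂ (H 1ℤ) (v 0) (begin
      H 1ℤ + H 1ℤ
        ≡⟨ cong₂ _+_ (lazy-shift a 1ℤ sgn₂ 0ℤ)
          (trans (lazy-reflect a (λ y → sgn₂ (1ℤ ℤ.+ y)) 0ℤ) (lazy-shift a 1ℤ sgn₂ 0ℤ)) ⟨
      𝔼 W (λ y → sgn₂ (1ℤ ℤ.+ y)) + 𝔼 W (λ y → sgn₂ (1ℤ ℤ.+ ℤ.- y))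
        ≡⟨ 𝔼-+ W _ _ ⟨
      𝔼 W (λ y → sgn₂ (1ℤ ℤ.+ y) + sgn₂ (1ℤ ℤ.+ ℤ.- y))
        ≡⟨ 𝔼-cong W pointwise ⟩
      𝔼 W (λ y → - 2ℚ * δ y)
        ≡⟨ trans (𝔼-*ˡ W (- 2ℚ) δ) (cong (- 2ℚ *_) (iterate-law a 0ℤ)) ⟩
      - 2ℚ * v 0 ∎)
      where
      open ≡-Reasoning
      pointwise : ∀ y → sgn₂ (1ℤ ℤ.+ y) + sgn₂ (1ℤ ℤ.+ ℤ.- y) ≡ - 2ℚ * δ y
      pointwise (ℤ.+ zero)        = refl
      pointwise (ℤ.+ suc zero)    = refl
      pointwise (ℤ.+ suc (suc k)) = refl
      pointwise -[1+ zero ]       = refl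
      pointwise -[1+ suc k ]      = refl
      lem₁ : ∀ x → x ≡ ½ * (x + x)
      lem₁ = solve-∀ ℚ-ring
      lem₃ : ∀ v → ½ * (- 2ℚ * v) ≡ - v
      lem₃ = solve-∀ ℚ-ring
      lem₂ : ∀ x v → x + x ≡ - 2ℚ * v → x ≡ - v
      lem₂ x v eq = trans (lem₁ x) (trans (cong (½ *_) eq) (lem₃ v))

    -- The only jump of `sgn₂`, of size 2, is from 1 to 2.
    H-suc : ∀ y → H (1ℤ ℤ.+ y) ≡ H y + 2ℚ * v ℤ.∣ -1ℤ ℤ.+ y ∣
    H-suc y = begin
      H (1ℤ ℤ.+ y)
        ≡⟨ lazy-shift a 1ℤ sgn₂ y ⟨
      𝔼 (iterate lazy a y) (λ y → sgn₂ (1ℤ ℤ.+ y))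
        ≡⟨ 𝔼-cong (iterate lazy a y) pointwise ⟩
      𝔼 (iterate lazy a y) (λ y → sgn₂ y + 2ℚ * δ (-1ℤ ℤ.+ y))
        ≡⟨ 𝔼-+ (iterate lazy a y) sgn₂ _ ⟩
      H y + 𝔼 (iterate lazy a y) (λ y → 2ℚ * δ (-1ℤ ℤ.+ y))
        ≡⟨ cong (H y +_) (trans (𝔼-*ˡ (iterate lazy a y) 2ℚ _)
             (cong (2ℚ *_) (trans (lazy-shift a -1ℤ δ y) (iterate-law a (-1ℤ ℤ.+ y))))) ⟩
      H y + 2ℚ * v ℤ.∣ -1ℤ ℤ.+ y ∣ ∎
      where
      open ≡-Reasoning
      pointwise : ∀ y → sgn₂ (1ℤ ℤ.+ y) ≡ sgn₂ y + 2ℚ * δ (-1ℤ ℤ.+ y)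
      pointwise (ℤ.+ zero)        = refl
      pointwise (ℤ.+ suc zero)    = refl
      pointwise (ℤ.+ suc (suc k)) = refl
      pointwise -[1+ zero ]       = refl
      pointwise -[1+ suc k ]      = refl

    H-partialSum : ∀ k → H (ℤ.+ suc (suc k)) ≡ - v 0 + 2ℚ * V (suc k)
    H-partialSum zero    = trans (H-suc 1ℤ) (trans (cong (_+ 2ℚ * v 0) H-one) (lem (v 0)))
      where
      lem : ∀ x → - x + 2ℚ * x ≡ - x + 2ℚ * (0ℚ + x)
      lem = solve-∀ ℚ-ring
    H-partialSum (suc k) = trans (H-suc (ℤ.+ suc (suc k)))
      (trans (cong (_+ 2ℚ * v (suc k)) (H-partialSum k)) (lem (v 0) (V (suc k)) (v (suc k))))
      where
      lem : ∀ x s y → - x + 2ℚ * s + 2ℚ * y ≡ - x + 2ℚ * (s + y)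
      lem = solve-∀ ℚ-ring

    v≥0 : ∀ k → 0ℚ ≤ v k
    v≥0 = law-nonneg a

    v↓ : Decreasing v
    v↓ = law-decreasing a

    -- The parabola 4Lz − z² lies below 4L·min(z, L).
    parabola-below-V : ∀ L z → (ι 4 * ι L * ι z - ι z * ι z) * V L ≤ ι 4 * ι L * ι L * V z
    parabola-below-V L z with ℕP.≤-total z L
    ... | inj₁ z≤L = ≤-by (+-nonneg (*-nonneg (*-nonneg (ι-nonneg 4) (ι-nonneg L)) (≤⇒0≤- concave))
                                    (*-nonneg (*-nonneg (ι-nonneg z) (ι-nonneg z)) V≥0))
                          (lem (ι L) (ι z) (V L) (V z))
      where
      V≥0 : 0ℚ ≤ V L
      V≥0 = ≤-trans (*-nonneg (ι-nonneg L) (v≥0 L)) (partialSum≥ v↓ v≥0 L)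
      concave : ι z * V L ≤ ι L * V z
      concave = subst (λ m → ι z * V m ≤ ι m * V z) (ℕP.m∸n+n≡m z≤L) (partialSum-concave v↓ v≥0 z (L ℕ.∸ z))
      lem : ∀ l z s t → ι 4 * l * l * t - (ι 4 * l * z - z * z) * s ≡ ι 4 * l * (l * t - z * s) + z * z * s
      lem = solve-∀ ℚ-ring
    ... | inj₂ L≤z = ≤-by (+-nonneg
      (*-nonneg (*-nonneg (*-nonneg (ι-nonneg 4) (ι-nonneg L)) (ι-nonneg L)) (≤⇒0≤- mono))
                                    (*-nonneg (square-nonneg (2ℚ * ι L - ι z)) V≥0))
                          (lem (ι L) (ι z) (V L) (V z))
      where
      V≥0 : 0ℚ ≤ V L
      V≥0 = ≤-trans (*-nonneg (ι-nonneg L) (v≥0 L)) (partialSum≥ v↓ v≥0 L)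
      mono : V L ≤ V z
      mono = subst (λ m → V L ≤ V m) (ℕP.m∸n+n≡m L≤z) (partialSum-mono v↓ v≥0 L (z ℕ.∸ L))
      lem : ∀ l z s t → ι 4 * l * l * t - (ι 4 * l * z - z * z) * s ≡ ι 4 * l * l * (t - s) + (2ℚ * l - z) *
        (2ℚ * l - z) * s
      lem = solve-∀ ℚ-ring

    -- A lower bound for 16L²μ²H(z) that is quadratic in z, so that two moments of z suffice.
    -- The last term absorbs z ≤ 1, where H is negative.
    quadratic : (μ l A w z : ℚ) → ℚ
    quadratic μ l A w z = ι 8 * l * l * μ * μ * w + μ * μ * (ι 4 * l * z - z * z) * A
      - ι 18 * (ι 16 * l * l) * w * ((z - μ) * (z - μ))

    H-quadratic : ∀ L μ → ι 2 ≤ μ → ∀ z →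
      quadratic μ (ι L) (V L) (v 0) (ι z) ≤ ι 16 * ι L * ι L * μ * μ * H (ℤ.+ z)
    H-quadratic L μ 2≤μ zero = ≤-by
      (*-nonneg (*-nonneg (*-nonneg (*-nonneg (*-nonneg (ι-nonneg 8) l≥0) l≥0) μ≥0) μ≥0)
        (+-nonneg (*-nonneg (ι-nonneg 29) (v≥0 0)) (*-nonneg (ι-nonneg 4) (≤⇒0≤- (v↓ 0)))))
      (trans (cong (λ h → ι 16 * ι L * ι L * μ * μ * h - quadratic μ (ι L) (V L) (v 0) 0ℚ) H-zero)
        (lem μ (ι L) (V L) (v 0) (v 1)))
      where
      l≥0 = ι-nonneg L
      μ≥0 = ≤-trans (ι-nonneg 2) 2≤μ
      lem₀ : ∀ x y → x ≡ (x + y) - y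
      lem₀ = solve-∀ ℚ-ring
      H-zero : H (ℤ.+ 0) ≡ - v 0 - 2ℚ * v 1
      H-zero = trans (lem₀ (H (ℤ.+ 0)) (2ℚ * v 1))
        (cong (_- 2ℚ * v 1) (trans (sym (H-suc (ℤ.+ 0))) H-one))
      lem : ∀ μ l A w x → ι 16 * l * l * μ * μ * (- w - 2ℚ * x) -
        (ι 8 * l * l * μ * μ * w + μ * μ * (ι 4 * l * 0ℚ - 0ℚ * 0ℚ) * A - ι 18 * (ι 16 * l * l) * w *
          ((0ℚ - μ) * (0ℚ - μ)))
        ≡ ι 8 * l * l * μ * μ * (ι 29 * w + ι 4 * (w - x))
      lem = solve-∀ ℚ-ring
    H-quadratic L μ 2≤μ (suc zero) = ≤-by
      (+-nonneg (*-nonneg (*-nonneg μ≥0 μ≥0) (+-nonneg (*-nonneg (ι-nonneg 4) (*-nonneg l≥0 (≤⇒0≤- A≤))) A≥0))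
        (*-nonneg (*-nonneg (*-nonneg l≥0 l≥0) (v≥0 0))
          (+-nonneg (*-nonneg (ι-nonneg 72) (*-nonneg (≤⇒0≤- 2≤μ) 3μ-2≥0))
                    (*-nonneg (ι-nonneg 44) (*-nonneg μ≥0 μ≥0)))))
      (trans (cong (λ h → ι 16 * ι L * ι L * μ * μ * h - quadratic μ (ι L) (V L) (v 0) (ι 1)) H-one)
        (lem μ (ι L) (V L) (v 0)))
      where
      l≥0 = ι-nonneg L
      μ≥0 = ≤-trans (ι-nonneg 2) 2≤μ
      A≤ : V L ≤ ι L * v 0
      A≤ = partialSum≤ v↓ v≥0 L
      A≥0 : 0ℚ ≤ V L
      A≥0 = ≤-trans (*-nonneg l≥0 (v≥0 L)) (partialSum≥ v↓ v≥0 L)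
      -- With A ≤ lw, the slack is at least l²w times 288(μ - 1)² - 28μ², which equals 72(μ - 2)(3μ
      -- - 2) + 44μ².
      3μ-2≥0 : 0ℚ ≤ ι 3 * μ - ι 2
      3μ-2≥0 = ≤⇒0≤- (≤-trans {ι 2} {μ} {ι 3 * μ} 2≤μ (≤-by (+-nonneg μ≥0 μ≥0) (lem₁ μ)))
        where
        lem₁ : ∀ μ → ι 3 * μ - μ ≡ μ + μ
        lem₁ = solve-∀ ℚ-ring
      lem : ∀ μ l A w → ι 16 * l * l * μ * μ * (- w) -
        (ι 8 * l * l * μ * μ * w + μ * μ * (ι 4 * l * ι 1 - ι 1 * ι 1) * A - ι 18 * (ι 16 * l * l) * w *
          ((ι 1 - μ) * (ι 1 - μ)))
        ≡ μ * μ * (ι 4 * (l * (l * w - A)) + A) + l * l * w * (ι 72 * ((μ - ι 2) * (ι 3 * μ - ι 2)) + ι 44 * (μ * μ))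
      lem = solve-∀ ℚ-ring
    -- Here H is 2V(k + 1) - v(0). In units of l²μ², four of the 32 copies of V(k + 1) go to the
    -- parabola; the other 28 cover 24v(0) + 4v(k + 1), because V(k + 1) ≥ v(0) ≥ v(k + 1).
    H-quadratic L μ 2≤μ (suc (suc k)) = ≤-by
      (+-nonneg (*-nonneg (*-nonneg (*-nonneg (*-nonneg (*-nonneg (ι-nonneg 4) l≥0) l≥0) μ≥0) μ≥0)
          (+-nonneg (*-nonneg (ι-nonneg 6) (≤⇒0≤- v₀≤V₁))
            (+-nonneg (≤⇒0≤- v₀≤V₁) (≤⇒0≤- (decreasing-≤₀ v↓ v≥0 (suc k))))))
        (+-nonneg (*-nonneg (*-nonneg μ≥0 μ≥0) (≤⇒0≤- (parabola-below-V L (suc (suc k)))))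
          (*-nonneg (*-nonneg (*-nonneg (ι-nonneg 18) (*-nonneg (*-nonneg (ι-nonneg 16) l≥0) l≥0)) (v≥0 0))
            (square-nonneg (ι (suc (suc k)) - μ)))))
      (trans (cong (λ h → ι 16 * ι L * ι L * μ * μ * h - quadratic μ (ι L) (V L) (v 0) (ι (suc (suc k))))
        (H-partialSum k))
        (lem μ (ι L) (V L) (v 0) (ι k) (V (suc k)) (v (suc k))))
      where
      l≥0 = ι-nonneg L
      μ≥0 = ≤-trans (ι-nonneg 2) 2≤μ
      v₀≤V₁ : v 0 ≤ V (suc k)
      v₀≤V₁ = subst₂ (λ x m → x ≤ V m) (+-identityˡ (v 0)) (ℕP.+-comm k 1) (partialSum-mono v↓ v≥0 1 k)
      lem : ∀ μ l A w k V₁ v₁ → ι 16 * l * l * μ * μ * (- w + 2ℚ * V₁) -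
        (ι 8 * l * l * μ * μ * w + μ * μ * (ι 4 * l * (1ℚ + (1ℚ + k)) - (1ℚ + (1ℚ + k)) * (1ℚ + (1ℚ + k))) * A
          - ι 18 * (ι 16 * l * l) * w * ((1ℚ + (1ℚ + k) - μ) * (1ℚ + (1ℚ + k) - μ)))
        ≡ ι 4 * l * l * μ * μ * (ι 6 * (V₁ - w) + ((V₁ - w) + (w - v₁)))
          + (μ * μ * (ι 4 * l * l * (V₁ + v₁) - (ι 4 * l * (1ℚ + (1ℚ + k)) - (1ℚ + (1ℚ + k)) * (1ℚ + (1ℚ + k))) * A)
          + ι 18 * (ι 16 * l * l) * w * ((1ℚ + (1ℚ + k) - μ) * (1ℚ + (1ℚ + k) - μ)))
      lem = solve-∀ ℚ-ring

    -- The indicator of |y| < k, except that 0 counts twice, which makes the mean exactly 2V(k).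
    interval : ℕ → ℤ → ℚ
    interval zero    y = 0ℚ
    interval (suc k) y = interval k y + (δ (ℤ.- (ℤ.+ k) ℤ.+ y) + δ (ℤ.+ k ℤ.+ y))

    δ-nonneg : ∀ y → 0ℚ ≤ δ y
    δ-nonneg y with ℤ.∣ y ∣
    ... | zero  = 0≤1
    ... | suc _ = ≤-refl

    interval-nonneg : ∀ k y → 0ℚ ≤ interval k y
    interval-nonneg zero    y = ≤-refl
    interval-nonneg (suc k) y = +-nonneg (interval-nonneg k y)
      (+-nonneg (δ-nonneg (ℤ.- (ℤ.+ k) ℤ.+ y)) (δ-nonneg (ℤ.+ k ℤ.+ y)))

    1≤interval : ∀ k y → ℤ.∣ y ∣ < k → 1ℚ ≤ interval k y
    1≤interval (suc k) y (ℕ.s≤s p) with ℕP.m≤n⇒m<n∨m≡n p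
    ... | inj₁ y<k = ≤-trans (1≤interval k y y<k)
      (≤-by (+-nonneg (δ-nonneg (ℤ.- (ℤ.+ k) ℤ.+ y)) (δ-nonneg (ℤ.+ k ℤ.+ y))) (x+y-x (interval k y) _))
    ... | inj₂ refl = ≤-by (+-nonneg (interval-nonneg k y) (≤⇒0≤- (hit y)))
      (lem (interval k y) (δ (ℤ.- (ℤ.+ k) ℤ.+ y) + δ (ℤ.+ k ℤ.+ y)))
      where
      lem : ∀ a b → a + b - 1ℚ ≡ a + (b - 1ℚ)
      lem = solve-∀ ℚ-ring
      hit : ∀ y → 1ℚ ≤ δ (ℤ.- (ℤ.+ ℤ.∣ y ∣) ℤ.+ y) + δ (ℤ.+ ℤ.∣ y ∣ ℤ.+ y)
      hit (ℤ.+ n) = ≤-by (δ-nonneg (ℤ.+ n ℤ.+ ℤ.+ n))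
        (trans (cong (λ z → δ z + δ (ℤ.+ n ℤ.+ ℤ.+ n) - 1ℚ) (ℤP.+-inverseˡ (ℤ.+ n))) (lem₁ (δ (ℤ.+ n ℤ.+ ℤ.+ n))))
        where
        lem₁ : ∀ a → 1ℚ + a - 1ℚ ≡ a
        lem₁ = solve-∀ ℚ-ring
      hit -[1+ n ] = ≤-by (δ-nonneg (-[1+ n ] ℤ.+ -[1+ n ]))
        (trans (cong (λ z → δ (-[1+ n ] ℤ.+ -[1+ n ]) + δ z - 1ℚ) (ℤP.+-inverseʳ (ℤ.+ suc n)))
          (lem₁ (δ (-[1+ n ] ℤ.+ -[1+ n ]))))
        where
        lem₁ : ∀ a → a + 1ℚ - 1ℚ ≡ a
        lem₁ = solve-∀ ℚ-ring

    𝔼-interval : ∀ k → 𝔼 W (interval k) ≡ 2ℚ * V k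
    𝔼-interval zero    = 𝔼-const W 0ℚ
    𝔼-interval (suc k) = trans (𝔼-+ W (interval k) _)
      (trans (cong₂ _+_ (𝔼-interval k) (trans (𝔼-+ W (λ y → δ (ℤ.- (ℤ.+ k) ℤ.+ y)) _)
          (cong₂ _+_ (trans (point (ℤ.- (ℤ.+ k))) (cong v (ℤP.∣-i∣≡∣i∣ (ℤ.+ k)))) (point (ℤ.+ k)))))
        (lem (V k) (v k)))
      where
      point : ∀ c → 𝔼 W (λ y → δ (c ℤ.+ y)) ≡ v ℤ.∣ c ∣
      point c = trans (lazy-shift a c δ 0ℤ)
        (trans (iterate-law a (c ℤ.+ 0ℤ)) (cong (λ z → v ℤ.∣ z ∣) (ℤP.+-identityʳ c)))
      lem : ∀ s x → 2ℚ * s + (x + x) ≡ 2ℚ * (s + x)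
      lem = solve-∀ ℚ-ring

    -- Chebyshev's inequality with the variance 2ar of the walk. Once L² ≥ 8ar it yields V(L) ≥ 3/8:
    -- a fixed share of the mass lies within distance L.
    V-chebyshev : ∀ L → ι L * ι L ≤ 2ℚ * (ι L * ι L * V L) + ι a * (2ℚ * r)
    V-chebyshev L = begin
      ι L * ι L
        ≡⟨ 𝔼-const W (ι L * ι L) ⟨
      𝔼 W (λ _ → ι L * ι L)
        ≤⟨ 𝔼-mono W pointwise ⟩
      𝔼 W (λ y → ι L * ι L * interval L y + ι ℤ.∣ y ∣ * ι ℤ.∣ y ∣)
        ≡⟨ trans (𝔼-+ W (λ y → ι L * ι L * interval L y) _)
             (cong₂ _+_ (trans (𝔼-*ˡ W (ι L * ι L) (interval L)) (cong (ι L * ι L *_) (𝔼-interval L)))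
               (second-moment a 0ℤ)) ⟩
      ι L * ι L * (2ℚ * V L) + (0ℚ * 0ℚ + ι a * (2ℚ * r))
        ≡⟨ lem (ι L) (V L) (ι a * (2ℚ * r)) ⟩
      2ℚ * (ι L * ι L * V L) + ι a * (2ℚ * r) ∎
      where
      open ℚP.≤-Reasoning
      lem : ∀ l A s → l * l * (2ℚ * A) + (0ℚ * 0ℚ + s) ≡ 2ℚ * (l * l * A) + s
      lem = solve-∀ ℚ-ring
      lem₁ : ∀ l i y → l * l * i + y * y - l * l ≡ l * l * (i - 1ℚ) + y * y
      lem₁ = solve-∀ ℚ-ring
      pointwise : ∀ y → ι L * ι L ≤ ι L * ι L * interval L y + ι ℤ.∣ y ∣ * ι ℤ.∣ y ∣
      pointwise y with ℤ.∣ y ∣ ℕP.<? L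
      ... | yes p = ≤-by (+-nonneg (*-nonneg (square-nonneg (ι L)) (≤⇒0≤- (1≤interval L y p)))
        (square-nonneg (ι ℤ.∣ y ∣)))
                         (lem₁ (ι L) (interval L y) (ι ℤ.∣ y ∣))
      ... | no ¬p = ≤-trans (*-mono (ι-nonneg L) (ι-nonneg ℤ.∣ y ∣) L≤y L≤y)
          (≤-by (*-nonneg (square-nonneg (ι L)) (interval-nonneg L y))
            (lem₂ (ι L * ι L * interval L y) (ι ℤ.∣ y ∣ * ι ℤ.∣ y ∣)))
        where
        L≤y = ι-mono (ℕP.≮⇒≥ ¬p)
        lem₂ : ∀ s t → s + t - t ≡ s
        lem₂ = solve-∀ ℚ-ring

    𝔼-quadratic : ∀ d L → let μ = ι d * q ; l = ι L ; A = V L ; w = v 0 in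
      𝔼 (iterate (move 1ℤ) d 0ℤ) (λ y → quadratic μ l A w (ι ℤ.∣ y ∣)) ≡
      ι 8 * l * l * μ * μ * w + μ * μ * (ι 4 * l * μ - μ * μ - ι d * r) * A - ι 18 * (ι 16 * l * l) * w * (ι d * r)
    𝔼-quadratic d L = trans (𝔼-cong Z λ y → lem₁ μ l A w (ι ℤ.∣ y ∣))
      (trans (𝔼-+ Z (λ _ → c₀) _) (trans (cong₂ _+_ (𝔼-const Z c₀)
          (trans (𝔼-+ Z (λ y → c₁ * ι ℤ.∣ y ∣) _) (cong₂ _+_
            (trans (𝔼-*ˡ Z c₁ _) (cong (c₁ *_) (up-mean d)))
            (trans (𝔼-*ˡ Z c₂ _) (cong (c₂ *_) (up-second-moment d))))))
        (lem₂ μ l A w (ι d * r))))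
      where
      Z = iterate (move 1ℤ) d 0ℤ
      μ = ι d * q
      l = ι L
      A = V L
      w = v 0
      c₀ = ι 8 * l * l * μ * μ * w - ι 18 * (ι 16 * l * l) * w * (μ * μ)
      c₁ = μ * μ * ι 4 * l * A + ι 36 * (ι 16 * l * l) * w * μ
      c₂ = - (μ * μ * A) - ι 18 * (ι 16 * l * l) * w
      lem₁ : ∀ μ l A w z →
        ι 8 * l * l * μ * μ * w + μ * μ * (ι 4 * l * z - z * z) * A - ι 18 * (ι 16 * l * l) * w *
          ((z - μ) * (z - μ)) ≡
        ι 8 * l * l * μ * μ * w - ι 18 * (ι 16 * l * l) * w * (μ * μ) +
        ((μ * μ * ι 4 * l * A + ι 36 * (ι 16 * l * l) * w * μ) * z + (- (μ * μ * A) - ι 18 * (ι 16 * l * l) * w)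
          * (z * z))
      lem₁ = solve-∀ ℚ-ring
      lem₂ : ∀ μ l A w V →
        ι 8 * l * l * μ * μ * w - ι 18 * (ι 16 * l * l) * w * (μ * μ) +
        ((μ * μ * ι 4 * l * A + ι 36 * (ι 16 * l * l) * w * μ) * μ + (- (μ * μ * A) - ι 18 * (ι 16 * l * l) * w)
          * (μ * μ + V)) ≡
        ι 8 * l * l * μ * μ * w + μ * μ * (ι 4 * l * μ - μ * μ - V) * A - ι 18 * (ι 16 * l * l) * w * V
      lem₂ = solve-∀ ℚ-ring

    -- Drift over spread. `L` dominates the mean μ of the starting point and the spread of the walk;
    -- by unimodality, a start at z ≤ L gains a bias of order V(L)·z/L, and V(L) ≥ 3/8.
    walk-bias : ∀ d L → ι 36 ≤ ι d * q → ι d * q ≤ ι L → ι 8 * (ι a * r) ≤ ι L * ι L →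
      ι 3 * (ι d * q) ≤ ι 64 * ι L * 𝔼 (iterate (move 1ℤ) d 0ℤ) H
    walk-bias d L 36≤μ μ≤l var≤ = ≤-trans (≤-by (*-nonneg (ι-nonneg 2) (*-nonneg μ≥0 3≤8A))
                                    (lem₄ μ A)) (*-cancelˡ-≤ (ι 2 * l) 0<2l (≤-trans step₂ (≤-reflexive (lem₃ l h))))
      where
      μ = ι d * q
      l = ι L
      A = V L
      w = v 0
      Z = iterate (move 1ℤ) d 0ℤ
      h = 𝔼 Z H
      μ≥0 = ≤-trans (ι-nonneg 36) 36≤μ
      0<μ = <-≤-trans (0<ι 35) 36≤μ
      0<l = <-≤-trans 0<μ μ≤l
      0<2l = 0<* (0<ι 1) 0<l
      A≥0 : 0ℚ ≤ A
      A≥0 = ≤-trans (*-nonneg (ι-nonneg L) (v≥0 L)) (partialSum≥ v↓ v≥0 L)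
      main : ι 8 * l * l * μ * μ * w + μ * μ * (ι 4 * l * μ - μ * μ - ι d * r) * A - ι 18 * (ι 16 * l * l) * w *
        (ι d * r)
        ≤ ι 16 * l * l * μ * μ * h
      main = subst₂ _≤_ (𝔼-quadratic d L) (𝔼-*ˡ Z (ι 16 * l * l * μ * μ) H)
        (up-mono d 0 (H-quadratic L μ (≤-trans (ι-mono {2} {36} (ℕ.s≤s (ℕ.s≤s ℕ.z≤n))) 36≤μ)))
      μ-dr : ι d * q - ι d * r ≡ ι d * q * q
      μ-dr = lem (ι d) q
        where
        lem : ∀ d q → d * q - d * (q * (1ℚ - q)) ≡ d * q * q
        lem = solve-∀ ℚ-ring
      dr≤μ : ι d * r ≤ μ
      dr≤μ = ≤-by (*-nonneg μ≥0 0≤q) μ-dr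
      -- 36 = 18·16/8: as dr ≤ μ, the bound μ ≥ 36 lets the first term of the quadratic pay for its
      -- variance term. Because μ ≤ l, the factor 4lμ - μ² - dr of the parabola is still at least
      -- 2lμ.
      step₁ : ι 2 * l * μ * A ≤ ι 16 * l * l * h
      step₁ = *-cancelˡ-≤ (μ * μ) (0<* 0<μ 0<μ) (≤-trans (≤-by
        (+-nonneg (*-nonneg (*-nonneg (*-nonneg (*-nonneg (ι-nonneg 8) (square-nonneg l)) (v≥0 0))
                     (+-nonneg (*-nonneg μ≥0 (≤⇒0≤- 36≤μ)) (*-nonneg (ι-nonneg 36) (≤⇒0≤- dr≤μ)))) 0≤1)
                  (*-nonneg (*-nonneg (*-nonneg μ≥0 μ≥0) A≥0)
                     (+-nonneg (≤⇒0≤- dr≤μ) (*-nonneg μ≥0 (+-nonneg (≤⇒0≤- μ≤l)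
                       (≤⇒0≤- (≤-trans (ι-mono {1} {36} (ℕ.s≤s ℕ.z≤n)) (≤-trans 36≤μ μ≤l))))))))
        (lem μ l A w (ι d * r))) (≤-trans main (≤-reflexive (lem₅ μ l h))))
        where
        lem : ∀ μ l A w V →
          ι 8 * l * l * μ * μ * w + μ * μ * (ι 4 * l * μ - μ * μ - V) * A - ι 18 * (ι 16 * l * l) * w * V
          - μ * μ * (ι 2 * l * μ * A) ≡
          ι 8 * (l * l) * w * (μ * (μ - ι 36) + ι 36 * (μ - V)) * 1ℚ +
          μ * μ * A * (μ - V + μ * (l - μ + (l - ι 1)))
        lem = solve-∀ ℚ-ring
        lem₅ : ∀ μ l h → ι 16 * l * l * μ * μ * h ≡ μ * μ * (ι 16 * l * l * h)
        lem₅ = solve-∀ ℚ-ring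
      step₂ : ι 2 * l * (ι 8 * (μ * A)) ≤ ι 8 * (ι 16 * l * l * h)
      step₂ = ≤-trans (≤-reflexive (lem l μ A)) (*-monoˡ (ι 8) (ι-nonneg 8) step₁)
        where
        lem : ∀ l μ A → ι 2 * l * (ι 8 * (μ * A)) ≡ ι 8 * (ι 2 * l * μ * A)
        lem = solve-∀ ℚ-ring
      lem₃ : ∀ l h → ι 8 * (ι 16 * l * l * h) ≡ ι 2 * l * (ι 64 * l * h)
      lem₃ = solve-∀ ℚ-ring
      3≤8A : 0ℚ ≤ ι 4 * A - ι 3 * ½
      3≤8A = ≤⇒0≤- (*-cancelˡ-≤ (l * l) (0<* 0<l 0<l) (≤-by
        (+-nonneg (*-nonneg (ι-nonneg 2) (≤⇒0≤- (V-chebyshev L))) (*-nonneg 0≤½ (≤⇒0≤- var≤)))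
        (lem l A (ι a) r)))
        where
        lem : ∀ l A a r → l * l * (ι 4 * A) - l * l * (ι 3 * ½) ≡
          ι 2 * (2ℚ * (l * l * A) + a * (2ℚ * r) - l * l) + ½ * (l * l - ι 8 * (a * r))
        lem = solve-∀ ℚ-ring
      lem₄ : ∀ μ A → ι 8 * (μ * A) - ι 3 * μ ≡ ι 2 * (μ * (ι 4 * A - ι 3 * ½))
      lem₄ = solve-∀ ℚ-ring

  dot-bias : ∀ {n} (c : Fin n → Step) d L → ups c ≡ downs c ℕ.+ d →
    ι 36 ≤ ι d * q → ι d * q ≤ ι L → ι 8 * (ι (downs c) * r) ≤ ι L * ι L →
    ι 3 * (ι d * q) ≤ ι 64 * ι L * 𝔼 (iidE bern n) (λ N → sgn₂ (dot c N))
  dot-bias {n} c d L eq h₁ h₂ h₃ = ≤-trans (walk-bias (downs c) d L h₁ h₂ h₃)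
    (≤-reflexive (cong (ι 64 * ι L *_) (sym (begin
      𝔼 (iidE bern n) (λ N → sgn₂ (dot c N))
        ≡⟨ 𝔼-cong (iidE bern n) (λ N → cong sgn₂ (sym (ℤP.+-identityʳ (dot c N)))) ⟩
      𝔼 (iidE bern n) (λ N → sgn₂ (dot c N ℤ.+ 0ℤ))
        ≡⟨ dot-walk c sgn₂ 0ℤ ⟩
      𝔼 (iterate (move 1ℤ) (ups c) 0ℤ) (λ y → 𝔼 (iterate (move -1ℤ) (downs c) y) sgn₂)
        ≡⟨ cong (λ k → 𝔼 (iterate (move 1ℤ) k 0ℤ) (λ y → 𝔼 (iterate (move -1ℤ) (downs c) y) sgn₂)) eq ⟩
      𝔼 (iterate (move 1ℤ) (downs c ℕ.+ d) 0ℤ) (λ y → 𝔼 (iterate (move -1ℤ) (downs c) y) sgn₂)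
        ≡⟨ unbalanced-walk (downs c) d 0ℤ sgn₂ ⟩
      𝔼 (iterate (move 1ℤ) d 0ℤ) (H (downs c)) ∎))))
    where open ≡-Reasoning

-- The sum of the initial spins

ind : {P : Set} → Dec P → ℚ
ind (yes _) = 1ℚ
ind (no _)  = 0ℚ

ind-nonneg : ∀ {P : Set} (d : Dec P) → 0ℚ ≤ ind d
ind-nonneg (yes _) = 0≤1
ind-nonneg (no _)  = ≤-refl

ind≤1 : ∀ {P : Set} (d : Dec P) → ind d ≤ 1ℚ
ind≤1 (yes _) = ≤-refl
ind≤1 (no _)  = 0≤1

signE : Expectation Sign
signE = record
  { 𝔼      = λ f → ½ * f Sign.+ + ½ * f Sign.-
  ; 𝔼-mono = λ h → +-mono-≤ (*-monoˡ ½ 0≤½ (h Sign.+)) (*-monoˡ ½ 0≤½ (h Sign.-))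
  ; 𝔼-+    = λ f g → lem₁ (f Sign.+) (f Sign.-) (g Sign.+) (g Sign.-)
  ; 𝔼-*ˡ   = λ c f → lem₂ c (f Sign.+) (f Sign.-)
  ; 𝔼-1    = refl
  }
  where
  lem₁ : ∀ a b c d → ½ * (a + c) + ½ * (b + d) ≡ ½ * a + ½ * b + (½ * c + ½ * d)
  lem₁ = solve-∀ ℚ-ring
  lem₂ : ∀ c a b → ½ * (c * a) + ½ * (c * b) ≡ c * (½ * a + ½ * b)
  lem₂ = solve-∀ ℚ-ring

toℚ : ℤ → ℚ
toℚ (ℤ.+ n)  = ι n
toℚ -[1+ n ] = - ι (suc n)

toℚ-suc : ∀ y → toℚ (1ℤ ℤ.+ y) ≡ 1ℚ + toℚ y
toℚ-suc (ℤ.+ n)        = refl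
toℚ-suc -[1+ zero ]    = refl
toℚ-suc -[1+ suc n ]   = lem (ι n)
  where
  lem : ∀ n → - (1ℚ + n) ≡ 1ℚ + - (1ℚ + (1ℚ + n))
  lem = solve-∀ ℚ-ring

toℚ-pred : ∀ y → toℚ (-1ℤ ℤ.+ y) ≡ - 1ℚ + toℚ y
toℚ-pred (ℤ.+ zero)  = refl
toℚ-pred (ℤ.+ suc n) = lem (ι n)
  where
  lem : ∀ n → n ≡ - 1ℚ + (1ℚ + n)
  lem = solve-∀ ℚ-ring
toℚ-pred -[1+ n ]    = lem (ι n)
  where
  lem : ∀ n → - (1ℚ + (1ℚ + n)) ≡ - 1ℚ + - (1ℚ + n)
  lem = solve-∀ ℚ-ring

toℚ-square : ∀ y → toℚ y * toℚ y ≡ ι ℤ.∣ y ∣ * ι ℤ.∣ y ∣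
toℚ-square (ℤ.+ n)  = refl
toℚ-square -[1+ n ] = lem (ι (suc n))
  where
  lem : ∀ x → - x * - x ≡ x * x
  lem = solve-∀ ℚ-ring

spinSum : ∀ {n} → Vec Sign n → ℤ
spinSum S = sum λ u → value (lookup S u)

signsE : ∀ n → Expectation (Vec Sign n)
signsE = iidE signE

-- Summation by parts on the cube: given the other spins, each spin contributes half the difference
-- of `f` at its two values. The induction splits off the first spin and applies the hypothesis to
-- the two shifts of `f`.
stein : ∀ n f → 𝔼 (signsE (suc n)) (λ S → toℚ (spinSum S) * f (spinSum S)) ≡
  ι (suc n) * 𝔼 (signsE n) (λ S → ½ * (f (1ℤ ℤ.+ spinSum S) - f (-1ℤ ℤ.+ spinSum S)))
stein zero    f = lem (f 1ℤ) (f -1ℤ)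
  where
  lem : ∀ a b → ½ * ((1ℚ + 0ℚ) * a) + ½ * ((- (1ℚ + 0ℚ)) * b) ≡ (1ℚ + 0ℚ) * (½ * (a - b))
  lem = solve-∀ ℚ-ring
stein (suc n) f = begin
  ½ * E₁ (λ S → toℚ (1ℤ ℤ.+ σ S) * f (1ℤ ℤ.+ σ S)) + ½ * E₁ (λ S → toℚ (-1ℤ ℤ.+ σ S) * f (-1ℤ ℤ.+ σ S))
    ≡⟨ cong₂ (λ a b → ½ * a + ½ * b)
         (trans (𝔼-cong (signsE (suc n)) λ S → trans (cong (_* f (1ℤ ℤ.+ σ S)) (toℚ-suc (σ S)))
           (lem₁ 1ℚ (toℚ (σ S)) _))
                (trans (𝔼-+ (signsE (suc n)) (λ S → 1ℚ * f₊ S) (λ S → toℚ (σ S) * f₊ S))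
                  (cong₂ _+_ (𝔼-*ˡ (signsE (suc n)) 1ℚ f₊) (stein n (λ y → f (1ℤ ℤ.+ y))))))
         (trans (𝔼-cong (signsE (suc n)) λ S → trans (cong (_* f (-1ℤ ℤ.+ σ S)) (toℚ-pred (σ S)))
           (lem₁ (- 1ℚ) (toℚ (σ S)) _))
                (trans (𝔼-+ (signsE (suc n)) (λ S → - 1ℚ * f₋ S) (λ S → toℚ (σ S) * f₋ S))
                  (cong₂ _+_ (𝔼-*ˡ (signsE (suc n)) (- 1ℚ) f₋) (stein n (λ y → f (-1ℤ ℤ.+ y)))))) ⟩
  ½ * (1ℚ * E₁ f₊ + ι (suc n) * E₀ (λ S → ½ * (f (1ℤ ℤ.+ (1ℤ ℤ.+ σ S)) - f (1ℤ ℤ.+ (-1ℤ ℤ.+ σ S))))) +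
  ½ * (- 1ℚ * E₁ f₋ + ι (suc n) * E₀ (λ S → ½ * (f (-1ℤ ℤ.+ (1ℤ ℤ.+ σ S)) - f (-1ℤ ℤ.+ (-1ℤ ℤ.+ σ S)))))
    ≡⟨ lem₂ (E₁ f₊) (E₁ f₋) (ι (suc n)) _ _ ⟩
  ½ * (E₁ f₊ - E₁ f₋) + ι (suc n) * (½ *
    (E₀ (λ S → ½ * (f (1ℤ ℤ.+ (1ℤ ℤ.+ σ S)) - f (1ℤ ℤ.+ (-1ℤ ℤ.+ σ S)))) +
     E₀ (λ S → ½ * (f (-1ℤ ℤ.+ (1ℤ ℤ.+ σ S)) - f (-1ℤ ℤ.+ (-1ℤ ℤ.+ σ S))))))
    ≡⟨ cong₂ (λ a b → a + ι (suc n) * (½ * b))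
         (sym (trans (𝔼-*ˡ (signsE (suc n)) ½ (λ S → f₊ S - f₋ S)) (cong (½ *_) (𝔼-- (signsE (suc n)) f₊ f₋))))
         (trans (sym (𝔼-+ (signsE n) _ _))
           (trans (𝔼-cong (signsE n) λ S → trans
              (cong (λ z → ½ * (f (1ℤ ℤ.+ (1ℤ ℤ.+ σ S)) - f z) +
                           ½ * (f (-1ℤ ℤ.+ (1ℤ ℤ.+ σ S)) - f (-1ℤ ℤ.+ (-1ℤ ℤ.+ σ S)))) (swap (σ S)))
              (lem₃ (f (1ℤ ℤ.+ (1ℤ ℤ.+ σ S))) (f (-1ℤ ℤ.+ (1ℤ ℤ.+ σ S))) (f (1ℤ ℤ.+ (-1ℤ ℤ.+ σ S)))
                (f (-1ℤ ℤ.+ (-1ℤ ℤ.+ σ S)))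
                 (cong f (swap (σ S)))))
             (𝔼-+ (signsE n) _ _))) ⟩
  E₁ (λ S → ½ * (f₊ S - f₋ S)) + ι (suc n) * (½ *
    (E₀ (λ S → ½ * (f (1ℤ ℤ.+ (1ℤ ℤ.+ σ S)) - f (-1ℤ ℤ.+ (1ℤ ℤ.+ σ S)))) +
     E₀ (λ S → ½ * (f (1ℤ ℤ.+ (-1ℤ ℤ.+ σ S)) - f (-1ℤ ℤ.+ (-1ℤ ℤ.+ σ S))))))
    ≡⟨ lem₄ (E₀ _) (E₀ _) (ι (suc n)) ⟩
  ι (suc (suc n)) * E₁ (λ S → ½ * (f₊ S - f₋ S)) ∎
  where
  open ≡-Reasoning
  E₁ = 𝔼 (signsE (suc n))
  E₀ = 𝔼 (signsE n)
  σ : ∀ {m} → Vec Sign m → ℤ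
  σ = spinSum
  f₊ f₋ : ∀ {m} → Vec Sign m → ℚ
  f₊ S = f (1ℤ ℤ.+ σ S)
  f₋ S = f (-1ℤ ℤ.+ σ S)
  swap : ∀ y → 1ℤ ℤ.+ (-1ℤ ℤ.+ y) ≡ -1ℤ ℤ.+ (1ℤ ℤ.+ y)
  swap = ℤSolver.solve-∀
  lem₁ : ∀ c x y → (c + x) * y ≡ c * y + x * y
  lem₁ = solve-∀ ℚ-ring
  lem₂ : ∀ a b k c d → ½ * (1ℚ * a + k * c) + ½ * (- 1ℚ * b + k * d) ≡ ½ * (a - b) + k * (½ * (c + d))
  lem₂ = solve-∀ ℚ-ring
  lem₃ : ∀ a b c d → c ≡ b → ½ * (a - b) + ½ * (b - d) ≡ ½ * (a - b) + ½ * (c - d)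
  lem₃ a b c d refl = refl
  lem₄ : ∀ a b k → ½ * a + ½ * b + k * (½ * (a + b)) ≡ (1ℚ + k) * (½ * a + ½ * b)
  lem₄ = solve-∀ ℚ-ring

spinSum-second-moment : ∀ n → 𝔼 (signsE n) (λ S → toℚ (spinSum S) * toℚ (spinSum S)) ≡ ι n
spinSum-second-moment zero    = refl
spinSum-second-moment (suc n) = trans (stein n toℚ) (trans
  (cong (ι (suc n) *_) (trans (𝔼-cong (signsE n) λ S →
     trans (cong₂ (λ a b → ½ * (a - b)) (toℚ-suc (spinSum S)) (toℚ-pred (spinSum S))) (lem (toℚ (spinSum S))))
   (𝔼-const (signsE n) 1ℚ)))
  (*-identityʳ (ι (suc n))))
  where
  lem : ∀ x → ½ * (1ℚ + x - (- 1ℚ + x)) ≡ 1ℚ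
  lem = solve-∀ ℚ-ring

-- Truncation to the interval from -L to L. One side of Stein's identity uses the bound L, the other
-- that the central difference dominates the indicator of |y| < L.
clamp : ℕ → ℤ → ℚ
clamp L (ℤ.+ n)  = ι (n ℕ.⊓ L)
clamp L -[1+ n ] = - ι (suc n ℕ.⊓ L)

clamp-bound : ∀ L y → toℚ y * clamp L y ≤ ι ℤ.∣ y ∣ * ι L
clamp-bound L (ℤ.+ n)  = *-monoˡ (ι n) (ι-nonneg n) (ι-mono (ℕP.m⊓n≤n n L))
clamp-bound L -[1+ n ] = ≤-trans (≤-reflexive (lem (ι (suc n)) _))
  (*-monoˡ (ι (suc n)) (ι-nonneg (suc n)) (ι-mono (ℕP.m⊓n≤n (suc n) L)))
  where
  lem : ∀ a b → - a * - b ≡ a * b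
  lem = solve-∀ ℚ-ring

clamp-slope : ∀ L y → ind (ℤ.∣ y ∣ ℕP.<? L) ≤ ½ * (clamp L (1ℤ ℤ.+ y) - clamp L (-1ℤ ℤ.+ y))
clamp-slope L y = ≤-by (*-nonneg 0≤½ (≤⇒0≤- (cases y)))
  (lem (ind (ℤ.∣ y ∣ ℕP.<? L)) (clamp L (1ℤ ℤ.+ y)) (clamp L (-1ℤ ℤ.+ y)))
  where
  lem : ∀ i a b → ½ * (a - b) - i ≡ ½ * (a - (b + 2ℚ * i))
  lem = solve-∀ ℚ-ring
  step₂ : ∀ k → ι (k ℕ.⊓ L) + 2ℚ * ind (suc k ℕP.<? L) ≤ ι (suc (suc k) ℕ.⊓ L)
  step₂ k with suc k ℕP.<? L
  ... | yes p rewrite ℕP.m≤n⇒m⊓n≡m (ℕP.≤-trans (ℕP.n≤1+n k) (ℕP.<⇒≤ p)) | ℕP.m≤n⇒m⊓n≡m p = ≤-reflexive (lem₁ (ι k))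
    where
    lem₁ : ∀ k → k + 2ℚ * 1ℚ ≡ 1ℚ + (1ℚ + k)
    lem₁ = solve-∀ ℚ-ring
  ... | no  _ = ≤-trans (≤-reflexive (lem₁ (ι (k ℕ.⊓ L))))
      (ι-mono (ℕP.⊓-monoˡ-≤ L (ℕP.≤-trans (ℕP.n≤1+n k) (ℕP.n≤1+n (suc k)))))
    where
    lem₁ : ∀ x → x + 2ℚ * 0ℚ ≡ x
    lem₁ = solve-∀ ℚ-ring
  cases : ∀ y → clamp L (-1ℤ ℤ.+ y) + 2ℚ * ind (ℤ.∣ y ∣ ℕP.<? L) ≤ clamp L (1ℤ ℤ.+ y)
  cases (ℤ.+ zero) = at-zero L
    where
    at-zero : ∀ L → - ι (1 ℕ.⊓ L) + 2ℚ * ind (0 ℕP.<? L) ≤ ι (1 ℕ.⊓ L)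
    at-zero zero    = ≤-refl
    at-zero (suc _) = ≤-refl
  cases (ℤ.+ suc k) = step₂ k
  cases -[1+ zero ] = ≤-by (≤⇒0≤- (step₂ 0)) (lem₁ (ι (2 ℕ.⊓ L)) (ind (1 ℕP.<? L)))
    where
    lem₁ : ∀ a i → 0ℚ - (- a + 2ℚ * i) ≡ a - (0ℚ + 2ℚ * i)
    lem₁ = solve-∀ ℚ-ring
  cases -[1+ suc k ] = ≤-by (≤⇒0≤- (step₂ (suc k)))
    (lem₁ (ι (suc (suc (suc k)) ℕ.⊓ L)) (ι (suc k ℕ.⊓ L)) (ind (suc (suc k) ℕP.<? L)))
    where
    lem₁ : ∀ a b i → - b - (- a + 2ℚ * i) ≡ a - (b + 2ℚ * i)
    lem₁ = solve-∀ ℚ-ring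

module _ (n L : ℕ) where

  smallSum : ℚ
  smallSum = 𝔼 (signsE n) (λ S → ind (ℤ.∣ spinSum S ∣ ℕP.<? L))

  largeSum : ℚ
  largeSum = 𝔼 (signsE n) (λ S → ind (L ℕP.≤? ℤ.∣ spinSum S ∣))

  -- Littlewood–Offord, from Stein's identity applied to the clamped sum.
  smallSum-bound : ι (suc n) * (smallSum * smallSum) ≤ ι L * ι L
  smallSum-bound = *-cancelˡ-≤ (ι (suc n)) (0<ι n) (begin
    ι (suc n) * (ι (suc n) * (smallSum * smallSum))
      ≡⟨ lem (ι (suc n)) smallSum ⟩
    ι (suc n) * smallSum * (ι (suc n) * smallSum)
      ≤⟨ *-mono nn (*-nonneg m≥0 (ι-nonneg L)) linear linear ⟩
    m * ι L * (m * ι L)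
      ≡⟨ lem₂ m (ι L) ⟩
    m * m * (ι L * ι L)
      -- Cauchy-Schwarz: the square of the first absolute moment is at most the second moment, n +
      -- 1.
      ≤⟨ *-monoʳ (ι L * ι L) (square-nonneg (ι L)) (𝔼²≤𝔼-square (signsE (suc n)) (λ S → ι ℤ.∣ spinSum S ∣)) ⟩
    𝔼 (signsE (suc n)) (λ S → ι ℤ.∣ spinSum S ∣ * ι ℤ.∣ spinSum S ∣) * (ι L * ι L)
      ≡⟨ cong (_* (ι L * ι L)) (trans (𝔼-cong (signsE (suc n)) λ S → sym (toℚ-square (spinSum S)))
        (spinSum-second-moment (suc n))) ⟩
    ι (suc n) * (ι L * ι L) ∎)
    where
    open ℚP.≤-Reasoning
    m = 𝔼 (signsE (suc n)) (λ S → ι ℤ.∣ spinSum S ∣)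
    m≥0 : 0ℚ ≤ m
    m≥0 = 𝔼-nonneg (signsE (suc n)) λ S → ι-nonneg ℤ.∣ spinSum S ∣
    nn : 0ℚ ≤ ι (suc n) * smallSum
    nn = *-nonneg (ι-nonneg (suc n)) (𝔼-nonneg (signsE n) λ S → ind-nonneg (ℤ.∣ spinSum S ∣ ℕP.<? L))
    lem : ∀ k s → k * (k * (s * s)) ≡ k * s * (k * s)
    lem = solve-∀ ℚ-ring
    lem₂ : ∀ m l → m * l * (m * l) ≡ m * m * (l * l)
    lem₂ = solve-∀ ℚ-ring
    linear : ι (suc n) * smallSum ≤ m * ι L
    linear = begin
      ι (suc n) * smallSum
        ≤⟨ *-monoˡ (ι (suc n)) (ι-nonneg (suc n)) (𝔼-mono (signsE n) λ S → clamp-slope L (spinSum S)) ⟩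
      ι (suc n) * 𝔼 (signsE n) (λ S → ½ * (clamp L (1ℤ ℤ.+ spinSum S) - clamp L (-1ℤ ℤ.+ spinSum S)))
        ≡⟨ stein n (clamp L) ⟨
      𝔼 (signsE (suc n)) (λ S → toℚ (spinSum S) * clamp L (spinSum S))
        ≤⟨ 𝔼-mono (signsE (suc n))
          (λ S → ≤-trans (clamp-bound L (spinSum S)) (≤-reflexive (*-comm (ι ℤ.∣ spinSum S ∣) (ι L)))) ⟩
      𝔼 (signsE (suc n)) (λ S → ι L * ι ℤ.∣ spinSum S ∣)
        ≡⟨ trans (𝔼-*ˡ (signsE (suc n)) (ι L) (λ S → ι ℤ.∣ spinSum S ∣)) (*-comm (ι L) m) ⟩
      m * ι L ∎

  largeSum-bound : ι L * ι L * largeSum ≤ ι n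
  largeSum-bound = begin
    ι L * ι L * largeSum
      ≡⟨ 𝔼-*ˡ (signsE n) (ι L * ι L) _ ⟨
    𝔼 (signsE n) (λ S → ι L * ι L * ind (L ℕP.≤? ℤ.∣ spinSum S ∣))
      ≤⟨ 𝔼-mono (signsE n) (λ S → ≤-trans (markov (ℤ.∣ spinSum S ∣)) (≤-reflexive (sym (toℚ-square (spinSum S))))) ⟩
    𝔼 (signsE n) (λ S → toℚ (spinSum S) * toℚ (spinSum S))
      ≡⟨ spinSum-second-moment n ⟩
    ι n ∎
    where
    open ℚP.≤-Reasoning
    markov : ∀ k → ι L * ι L * ind (L ℕP.≤? k) ≤ ι k * ι k
    markov k with L ℕP.≤? k
    ... | yes p = ≤-trans (≤-reflexive (*-identityʳ (ι L * ι L)))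
      (*-mono (ι-nonneg L) (ι-nonneg k) (ι-mono p) (ι-mono p))
    ... | no _  = ≤-trans (≤-reflexive (*-zeroʳ (ι L * ι L))) (square-nonneg (ι k))

-- Exponential moments

𝟙 : Bool → ℕ
𝟙 true  = 1
𝟙 false = 0

nsum : ∀ {n} → (Fin n → ℕ) → ℕ
nsum {zero}  f = 0
nsum {suc n} f = f zero ℕ.+ nsum (λ u → f (suc u))

nsum-cong : ∀ {n} {f g : Fin n → ℕ} → (∀ u → f u ≡ g u) → nsum f ≡ nsum g
nsum-cong {zero}  h = refl
nsum-cong {suc n} h = cong₂ ℕ._+_ (h zero) (nsum-cong λ u → h (suc u))

nsum-mono : ∀ {n} {f g : Fin n → ℕ} → (∀ u → f u ℕ.≤ g u) → nsum f ℕ.≤ nsum g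
nsum-mono {zero}  h = ℕ.z≤n
nsum-mono {suc n} h = ℕP.+-mono-≤ (h zero) (nsum-mono λ u → h (suc u))

nsum-+ : ∀ {n} (f g : Fin n → ℕ) → nsum (λ u → f u ℕ.+ g u) ≡ nsum f ℕ.+ nsum g
nsum-+ {zero}  f g = refl
nsum-+ {suc n} f g = trans (cong (f zero ℕ.+ g zero ℕ.+_) (nsum-+ (λ u → f (suc u)) (λ u → g (suc u))))
  (lem (f zero) (g zero) (nsum λ u → f (suc u)) (nsum λ u → g (suc u)))
  where
  lem : ∀ a b c d → a ℕ.+ b ℕ.+ (c ℕ.+ d) ≡ a ℕ.+ c ℕ.+ (b ℕ.+ d)
  lem = ℕSolver.solve-∀

nsum-*ˡ : ∀ {n} c (f : Fin n → ℕ) → nsum (λ u → c ℕ.* f u) ≡ c ℕ.* nsum f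
nsum-*ˡ {zero}  c f = sym (ℕP.*-zeroʳ c)
nsum-*ˡ {suc n} c f = trans (cong (c ℕ.* f zero ℕ.+_) (nsum-*ˡ c (λ u → f (suc u))))
  (sym (ℕP.*-distribˡ-+ c (f zero) _))

-- Edges between two vertex sets

size : ∀ {n} → Vec Bool n → ℕ
size W = nsum λ u → 𝟙 (lookup W u)

degreeIn : ∀ {n} → Graph n → Vec Bool n → Fin n → ℕ
degreeIn G B v = nsum λ u → 𝟙 (adj G v u) ℕ.* 𝟙 (lookup B u)

-- Ordered pairs are counted, so an edge inside the intersection of `W` and `B` counts twice.
edges : ∀ {n} → Graph n → Vec Bool n → Vec Bool n → ℕ
edges G W B = nsum λ v → 𝟙 (lookup W v) ℕ.* degreeIn G B v

edges-extend : ∀ {n} N (G : Graph n) w W b B → edges (extend N G) (w ∷ W) (b ∷ B) ≡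
  nsum (λ u → 𝟙 (lookup N u) ℕ.* (𝟙 w ℕ.* 𝟙 (lookup B u) ℕ.+ 𝟙 b ℕ.* 𝟙 (lookup W u))) ℕ.+ edges G W B
edges-extend N G w W b B = begin
  𝟙 w ℕ.* nsum (λ u → n u ℕ.* β u) ℕ.+ nsum (λ v → ω v ℕ.* (n v ℕ.* 𝟙 b ℕ.+ degreeIn G B v))
    ≡⟨ cong₂ ℕ._+_ (sym (nsum-*ˡ (𝟙 w) (λ u → n u ℕ.* β u)))
         (trans (nsum-cong λ v → ℕP.*-distribˡ-+ (ω v) (n v ℕ.* 𝟙 b) _)
           (nsum-+ (λ v → ω v ℕ.* (n v ℕ.* 𝟙 b)) (λ v → ω v ℕ.* degreeIn G B v))) ⟩
  nsum (λ u → 𝟙 w ℕ.* (n u ℕ.* β u)) ℕ.+ (nsum (λ v → ω v ℕ.* (n v ℕ.* 𝟙 b)) ℕ.+ edges G W B)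
    ≡⟨ ℕP.+-assoc (nsum λ u → 𝟙 w ℕ.* (n u ℕ.* β u)) _ _ ⟨
  nsum (λ u → 𝟙 w ℕ.* (n u ℕ.* β u)) ℕ.+ nsum (λ v → ω v ℕ.* (n v ℕ.* 𝟙 b)) ℕ.+ edges G W B
    ≡⟨ cong (ℕ._+ edges G W B)
      (trans (sym (nsum-+ (λ u → 𝟙 w ℕ.* (n u ℕ.* β u)) (λ v → ω v ℕ.* (n v ℕ.* 𝟙 b))))
        (nsum-cong λ u → lem (𝟙 w) (n u) (β u) (ω u) (𝟙 b))) ⟩
  nsum (λ u → n u ℕ.* (𝟙 w ℕ.* β u ℕ.+ 𝟙 b ℕ.* ω u)) ℕ.+ edges G W B ∎
  where
  open ≡-Reasoning
  n = λ u → 𝟙 (lookup N u)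
  β = λ u → 𝟙 (lookup B u)
  ω = λ u → 𝟙 (lookup W u)
  lem : ∀ w n β ω b → w ℕ.* (n ℕ.* β) ℕ.+ ω ℕ.* (n ℕ.* b) ≡ n ℕ.* (w ℕ.* β ℕ.+ b ℕ.* ω)
  lem = ℕSolver.solve-∀

𝟙≤1 : ∀ b → 𝟙 b ℕ.≤ 1
𝟙≤1 true  = ℕP.≤-refl
𝟙≤1 false = ℕ.z≤n

∑⊆ : ∀ n → (Vec Bool n → ℚ) → ℚ
∑⊆ zero    f = f []
∑⊆ (suc n) f = ∑⊆ n (λ W → f (true ∷ W)) + ∑⊆ n (λ W → f (false ∷ W))

∑⊆-nonneg : ∀ n {f} → (∀ W → 0ℚ ≤ f W) → 0ℚ ≤ ∑⊆ n f
∑⊆-nonneg zero    h = h []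
∑⊆-nonneg (suc n) h = +-nonneg (∑⊆-nonneg n λ W → h (true ∷ W)) (∑⊆-nonneg n λ W → h (false ∷ W))

∑⊆-member : ∀ {n f} → (∀ W → 0ℚ ≤ f W) → ∀ W → f W ≤ ∑⊆ n f
∑⊆-member h []          = ≤-refl
∑⊆-member {suc n} {f} h (true ∷ W)  = ≤-trans (∑⊆-member (λ W → h (true ∷ W)) W)
  (≤-by (∑⊆-nonneg n λ W → h (false ∷ W)) (x+y-x (∑⊆ n λ W → f (true ∷ W)) (∑⊆ n λ W → f (false ∷ W))))
∑⊆-member {suc n} {f} h (false ∷ W) = ≤-trans (∑⊆-member (λ W → h (false ∷ W)) W)
  (≤-by (∑⊆-nonneg n λ W → h (true ∷ W)) (x+y-y (∑⊆ n λ W → f (true ∷ W)) (∑⊆ n λ W → f (false ∷ W))))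

∑⊆-bound : ∀ n {f c} → (∀ W → f W ≤ c) → ∑⊆ n f ≤ 2ℚ ^ n * c
∑⊆-bound zero    {c = c} h = ≤-trans (h []) (≤-reflexive (sym (*-identityˡ c)))
∑⊆-bound (suc n) {c = c} h = ≤-trans (+-mono-≤ (∑⊆-bound n λ W → h (true ∷ W)) (∑⊆-bound n λ W → h (false ∷ W)))
  (≤-reflexive (lem (2ℚ ^ n) c))
  where
  lem : ∀ p c → p * c + p * c ≡ 2ℚ * p * c
  lem = solve-∀ ℚ-ring

𝔼-∑⊆ : ∀ {A} (μ : Expectation A) n (f : Vec Bool n → A → ℚ) →
  𝔼 μ (λ a → ∑⊆ n λ W → f W a) ≡ ∑⊆ n λ W → 𝔼 μ (f W)
𝔼-∑⊆ μ zero    f = refl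
𝔼-∑⊆ μ (suc n) f = trans (𝔼-+ μ (λ a → ∑⊆ n λ W → f (true ∷ W) a) (λ a → ∑⊆ n λ W → f (false ∷ W) a))
  (cong₂ _+_ (𝔼-∑⊆ μ n (λ W → f (true ∷ W))) (𝔼-∑⊆ μ n (λ W → f (false ∷ W))))

½*2 : ∀ n → ½ ^ n * 2ℚ ^ n ≡ 1ℚ
½*2 n = trans (sym (^-distrib-* ½ 2ℚ n)) (1^ n)

^-≤1 : ∀ {x} n → 0ℚ ≤ x → x ≤ 1ℚ → x ^ n ≤ 1ℚ
^-≤1 {x} n 0≤x x≤1 = subst (x ^ n ≤_) (1^ n) (^-monoˡ n 0≤x x≤1)

½^-antimono : ∀ {m n} → m ℕ.≤ n → ½ ^ n ≤ ½ ^ m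
½^-antimono {m} {n} p = subst₂ _≤_ (trans (sym (^-+ ½ m (n ℕ.∸ m))) (cong (½ ^_) (ℕP.m+[n∸m]≡n p)))
  (*-identityʳ (½ ^ m))
  (*-monoˡ (½ ^ m) (^-nonneg m 0≤½) (^-≤1 (n ℕ.∸ m) 0≤½ (≤-by {t = ½} 0≤½ refl)))

-- (1 − x)ⁿ(1 + x)ⁿ ≤ 1 turns Bernoulli's inequality into upper bounds.
conjugate-power : ∀ {x} n → 0ℚ ≤ x → x ≤ 1ℚ → (1ℚ - x) ^ n * (1ℚ + x) ^ n ≤ 1ℚ
conjugate-power {x} n 0≤x x≤1 = subst (_≤ 1ℚ) (^-distrib-* (1ℚ - x) (1ℚ + x) n)
  (^-≤1 n (*-nonneg (≤⇒0≤- x≤1) (+-nonneg 0≤1 0≤x)) (≤-by (square-nonneg x) (lem x)))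
  where
  lem : ∀ x → 1ℚ - (1ℚ - x) * (1ℚ + x) ≡ x * x
  lem = solve-∀ ℚ-ring

bernoulli-ineq⁻ : ∀ {x} n → 0ℚ ≤ x → x ≤ 1ℚ → 1ℚ - ι n * x ≤ (1ℚ - x) ^ n
bernoulli-ineq⁻ {x} zero    0≤x x≤1 = ≤-reflexive (lem x)
  where
  lem : ∀ x → 1ℚ - 0ℚ * x ≡ 1ℚ
  lem = solve-∀ ℚ-ring
bernoulli-ineq⁻ {x} (suc n) 0≤x x≤1 = ≤-trans
  (≤-by (*-nonneg (ι-nonneg n) (*-nonneg 0≤x 0≤x)) (lem (ι n) x))
  (*-monoˡ (1ℚ - x) (≤⇒0≤- x≤1) (bernoulli-ineq⁻ n 0≤x x≤1))
  where
  lem : ∀ k x → (1ℚ - x) * (1ℚ - k * x) - (1ℚ - (1ℚ + k) * x) ≡ k * (x * x)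
  lem = solve-∀ ℚ-ring

1-x-power≤½ : ∀ {x} n → 0ℚ ≤ x → x ≤ 1ℚ → 1ℚ ≤ ι n * x → (1ℚ - x) ^ n ≤ ½
1-x-power≤½ {x} n 0≤x x≤1 1≤nx = *-cancelˡ-≤ 2ℚ (positive⁻¹ 2ℚ) (begin
  2ℚ * y                      ≤⟨ *-monoʳ y y≥0 (≤-trans (+-monoʳ-≤ 1ℚ 1≤nx) (bernoulli-ineq n 0≤x)) ⟩
  (1ℚ + x) ^ n * y            ≡⟨ *-comm _ y ⟩
  y * (1ℚ + x) ^ n            ≤⟨ conjugate-power n 0≤x x≤1 ⟩
  1ℚ ∎)
  where
  open ℚP.≤-Reasoning
  y = (1ℚ - x) ^ n
  y≥0 = ^-nonneg n (≤⇒0≤- x≤1)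

1+x-power≤2 : ∀ {x} n → 0ℚ ≤ x → x ≤ 1ℚ → ι n * x ≤ ½ → (1ℚ + x) ^ n ≤ 2ℚ
1+x-power≤2 {x} n 0≤x x≤1 nx≤½ = *-cancelˡ-≤ ½ (positive⁻¹ ½) (begin
  ½ * y                       ≤⟨ *-monoʳ y y≥0
    (≤-trans {½} {1ℚ - ι n * x} (≤-by (≤⇒0≤- nx≤½) (lem (ι n * x))) (bernoulli-ineq⁻ n 0≤x x≤1)) ⟩
  (1ℚ - x) ^ n * y            ≤⟨ conjugate-power n 0≤x x≤1 ⟩
  1ℚ ∎)
  where
  open ℚP.≤-Reasoning
  y = (1ℚ + x) ^ n
  y≥0 = ^-nonneg n (+-nonneg 0≤1 0≤x)
  lem : ∀ t → 1ℚ - t - ½ ≡ ½ - t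
  lem = solve-∀ ℚ-ring

module Exponential (q : ℚ) (0≤q : 0ℚ ≤ q) (q≤1 : q ≤ 1ℚ) where

  open Walk q 0≤q q≤1 using (bern)

  -- An edge of multiplicity 2 has exponential moment 1 + (2² - 1)q. Taking this as the charge per
  -- unit of multiplicity covers the multiplicities 0, 1 and 2.
  g : ℚ
  g = 1ℚ + ι 3 * q

  0≤g : 0ℚ ≤ g
  0≤g = +-nonneg 0≤1 (*-nonneg (ι-nonneg 3) 0≤q)

  1≤g : 1ℚ ≤ g
  1≤g = ≤-by (*-nonneg (ι-nonneg 3) 0≤q) (lem q)
    where
    lem : ∀ q → 1ℚ + ι 3 * q - 1ℚ ≡ ι 3 * q
    lem = solve-∀ ℚ-ring

  iid-exp : ∀ n (k : Fin n → ℕ) → (∀ u → k u ℕ.≤ 2) →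
    𝔼 (iidE bern n) (λ N → 2ℚ ^ nsum (λ u → 𝟙 (lookup N u) ℕ.* k u)) ≤ g ^ nsum k
  iid-exp zero    k k≤2 = ≤-refl
  iid-exp (suc n) k k≤2 = begin
    q * 𝔼 νN (λ N → 2ℚ ^ (1 ℕ.* k zero ℕ.+ s N)) + (1ℚ - q) * 𝔼 νN (λ N → 2ℚ ^ s N)
      ≡⟨ cong (λ z → q * z + (1ℚ - q) * 𝔼 νN (λ N → 2ℚ ^ s N))
           (trans (𝔼-cong νN λ N → trans (cong (λ z → 2ℚ ^ (z ℕ.+ s N)) (ℕP.*-identityˡ (k zero)))
             (^-+ 2ℚ (k zero) (s N)))
                  (𝔼-*ˡ νN (2ℚ ^ k zero) (λ N → 2ℚ ^ s N))) ⟩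
    q * (2ℚ ^ k zero * X) + (1ℚ - q) * X
      ≡⟨ lem q (2ℚ ^ k zero) X ⟩
    (1ℚ + q * (2ℚ ^ k zero - 1ℚ)) * X
      ≤⟨ *-mono (factor≥0 (k zero) (k≤2 zero)) (^-nonneg (nsum λ u → k (suc u)) 0≤g)
        (factor (k zero) (k≤2 zero)) (iid-exp n (λ u → k (suc u)) (λ u → k≤2 (suc u))) ⟩
    g ^ k zero * g ^ nsum (λ u → k (suc u))
      ≡⟨ ^-+ g (k zero) _ ⟨
    g ^ nsum k ∎
    where
    open ℚP.≤-Reasoning
    νN = iidE bern n
    s : Vec Bool n → ℕ
    s N = nsum (λ u → 𝟙 (lookup N u) ℕ.* k (suc u))
    X = 𝔼 νN (λ N → 2ℚ ^ s N)
    lem : ∀ q t x → q * (t * x) + (1ℚ - q) * x ≡ (1ℚ + q * (t - 1ℚ)) * x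
    lem = solve-∀ ℚ-ring
    factor≥0 : ∀ k → k ℕ.≤ 2 → 0ℚ ≤ 1ℚ + q * (2ℚ ^ k - 1ℚ)
    factor≥0 k _ = +-nonneg 0≤1 (*-nonneg 0≤q (≤⇒0≤- (1≤^ k (≤-by {t = 1ℚ} 0≤1 refl))))
    factor : ∀ k → k ℕ.≤ 2 → 1ℚ + q * (2ℚ ^ k - 1ℚ) ≤ g ^ k
    factor 0 _ = ≤-reflexive (lem₀ q)
      where
      lem₀ : ∀ q → 1ℚ + q * (1ℚ - 1ℚ) ≡ 1ℚ
      lem₀ = solve-∀ ℚ-ring
    factor 1 _ = ≤-by (*-nonneg 0≤2 0≤q) (lem₁ q)
      where
      lem₁ : ∀ q → (1ℚ + ι 3 * q) * 1ℚ - (1ℚ + q * (2ℚ * 1ℚ - 1ℚ)) ≡ 2ℚ * q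
      lem₁ = solve-∀ ℚ-ring
    factor 2 _ = ≤-by (+-nonneg (*-nonneg (ι-nonneg 3) 0≤q) (*-nonneg (ι-nonneg 9) (*-nonneg 0≤q 0≤q))) (lem₂ q)
      where
      lem₂ : ∀ q → (1ℚ + ι 3 * q) * ((1ℚ + ι 3 * q) * 1ℚ) - (1ℚ + q * (2ℚ * (2ℚ * 1ℚ) - 1ℚ)) ≡ ι 3 * q + ι 9 * (q * q)
      lem₂ = solve-∀ ℚ-ring
    factor (suc (suc (suc k))) (ℕ.s≤s (ℕ.s≤s ()))

  -- Vertices are added one at a time, the new row being independent of the rest. Its multiplicities
  -- sum to w|B| + b|W|, which completes |W||B| to the new product up to the term wb of the absent
  -- loop.
  edges-exp : ∀ {n} (W B : Vec Bool n) → 𝔼 (graphE bern n) (λ G → 2ℚ ^ edges G W B) ≤ g ^ (size W ℕ.* size B)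
  edges-exp []      []      = ≤-refl
  edges-exp {suc n} (w ∷ W) (b ∷ B) = begin
    𝔼 νN (λ N → 𝔼 νG λ G → 2ℚ ^ edges (extend N G) (w ∷ W) (b ∷ B))
      ≡⟨ 𝔼-cong νN (λ N → trans (𝔼-cong νG λ G → trans (cong (2ℚ ^_) (edges-extend N G w W b B)) (^-+ 2ℚ (s N) _))
                                  (trans (𝔼-*ˡ νG (2ℚ ^ s N) _) (*-comm (2ℚ ^ s N) X))) ⟩
    𝔼 νN (λ N → X * 2ℚ ^ s N)
      ≡⟨ 𝔼-*ˡ νN X _ ⟩
    X * 𝔼 νN (λ N → 2ℚ ^ s N)
      ≤⟨ *-mono (𝔼-nonneg νG λ G → ^-nonneg (edges G W B) 0≤2) (^-nonneg (nsum k) 0≤g)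
           (edges-exp W B) (iid-exp n k λ u → ℕP.+-mono-≤ (ℕP.*-mono-≤ (𝟙≤1 w) (𝟙≤1 (lookup B u)))
             (ℕP.*-mono-≤ (𝟙≤1 b) (𝟙≤1 (lookup W u)))) ⟩
    g ^ (size W ℕ.* size B) * g ^ nsum k
      ≡⟨ ^-+ g (size W ℕ.* size B) (nsum k) ⟨
    g ^ (size W ℕ.* size B ℕ.+ nsum k)
      ≤⟨ ^-monoʳ 1≤g (subst (λ z → size W ℕ.* size B ℕ.+ z ℕ.≤ (𝟙 w ℕ.+ size W) ℕ.* (𝟙 b ℕ.+ size B))
        (sym k-sum) (count (𝟙 w) (size W) (𝟙 b) (size B))) ⟩
    g ^ (size (w ∷ W) ℕ.* size (b ∷ B)) ∎
    where
    open ℚP.≤-Reasoning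
    νN = iidE bern n
    νG = graphE bern n
    k = λ u → 𝟙 w ℕ.* 𝟙 (lookup B u) ℕ.+ 𝟙 b ℕ.* 𝟙 (lookup W u)
    s : Vec Bool n → ℕ
    s N = nsum (λ u → 𝟙 (lookup N u) ℕ.* k u)
    X = 𝔼 νG (λ G → 2ℚ ^ edges G W B)
    k-sum : nsum k ≡ 𝟙 w ℕ.* size B ℕ.+ 𝟙 b ℕ.* size W
    k-sum = trans (nsum-+ (λ u → 𝟙 w ℕ.* 𝟙 (lookup B u)) (λ u → 𝟙 b ℕ.* 𝟙 (lookup W u)))
      (cong₂ ℕ._+_ (nsum-*ˡ (𝟙 w) (λ u → 𝟙 (lookup B u))) (nsum-*ˡ (𝟙 b) (λ u → 𝟙 (lookup W u))))
    count : ∀ w W b B → W ℕ.* B ℕ.+ (w ℕ.* B ℕ.+ b ℕ.* W) ℕ.≤ (w ℕ.+ W) ℕ.* (b ℕ.+ B)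
    count w W b B = ℕP.≤-trans (ℕP.m≤m+n _ (w ℕ.* b)) (ℕP.≤-reflexive (lem w W b B))
      where
      lem : ∀ w W b B → W ℕ.* B ℕ.+ (w ℕ.* B ℕ.+ b ℕ.* W) ℕ.+ w ℕ.* b ≡ (w ℕ.+ W) ℕ.* (b ℕ.+ B)
      lem = ℕSolver.solve-∀

  iid-½ : ∀ n → 𝔼 (iidE bern n) (λ N → ½ ^ size N) ≡ (1ℚ - ½ * q) ^ n
  iid-½ zero    = refl
  iid-½ (suc n) = trans (cong (λ z → q * z + (1ℚ - q) * 𝔼 (iidE bern n) (λ N → ½ ^ size N))
    (𝔼-*ˡ (iidE bern n) ½ (λ N → ½ ^ size N)))
    (trans (cong (λ z → q * (½ * z) + (1ℚ - q) * z) (iid-½ n)) (lem q ((1ℚ - ½ * q) ^ n)))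
    where
    lem : ∀ q x → q * (½ * x) + (1ℚ - q) * x ≡ (1ℚ - ½ * q) * x
    lem = solve-∀ ℚ-ring

  size-erase : ∀ {n} (N : Vec Bool n) u → size N ℕ.≤ suc (size (N [ u ]≔ false))
  size-erase (b ∷ N) zero    = ℕP.+-monoˡ-≤ (size N) (𝟙≤1 b)
  size-erase (b ∷ N) (suc u) = ℕP.≤-trans (ℕP.+-monoʳ-≤ (𝟙 b) (size-erase N u)) (ℕP.≤-reflexive (ℕP.+-suc (𝟙 b) _))

  degree : ∀ {n} → Graph n → Fin n → ℕ
  degree G v = size (row G v)

  -- The factor 2 accounts for the erased diagonal bit, which lowers the size by at most 1.
  degree-exp : ∀ {n} (v : Fin n) → 𝔼 (graphE bern n) (λ G → ½ ^ degree G v) ≤ 2ℚ * (1ℚ - ½ * q) ^ n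
  degree-exp {n} v = begin
    𝔼 (graphE bern n) (λ G → ½ ^ size (row G v))
      ≡⟨ row-marginal bern v (λ R → ½ ^ size R) ⟩
    𝔼 (iidE bern n) (λ N → ½ ^ size (N [ v ]≔ false))
      ≤⟨ 𝔼-mono (iidE bern n) (λ N → ≤-trans (≤-reflexive (lem (½ ^ size (N [ v ]≔ false))))
           (*-monoˡ 2ℚ 0≤2 (½^-antimono (size-erase N v)))) ⟩
    𝔼 (iidE bern n) (λ N → 2ℚ * ½ ^ size N)
      ≡⟨ trans (𝔼-*ˡ (iidE bern n) 2ℚ (λ N → ½ ^ size N)) (cong (2ℚ *_) (iid-½ n)) ⟩
    2ℚ * (1ℚ - ½ * q) ^ n ∎
    where
    open ℚP.≤-Reasoning
    lem : ∀ x → x ≡ 2ℚ * (½ * x)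
    lem = solve-∀ ℚ-ring

  module _ (m : ℕ) (mq≤1 : ι m * q ≤ 1ℚ) (1≤[1+m]q : 1ℚ ≤ ι (suc m) * q) where

    ½q≤1 : ½ * q ≤ 1ℚ
    ½q≤1 = ≤-by (+-nonneg (*-nonneg 0≤½ (≤⇒0≤- q≤1)) 0≤½) (lem q)
      where
      lem : ∀ q → 1ℚ - ½ * q ≡ ½ * (1ℚ - q) + ½
      lem = solve-∀ ℚ-ring

    -- With x = q/2, Bernoulli gives 1 + 6x ≤ (1 + x)⁶, and (1 + x)^m ≤ 2 because mx ≤ ½. So every m
    -- vertices of `B` cost a vertex of `W` a factor 2⁶.
    g-power : ∀ j → g ^ (m ℕ.* j) ≤ 2ℚ ^ (6 ℕ.* j)
    g-power j = begin
      g ^ (m ℕ.* j)                    ≡⟨ trans (cong (g ^_) (ℕP.*-comm m j)) (^-* g j m) ⟩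
      (g ^ m) ^ j                      ≤⟨ ^-monoˡ j (^-nonneg m 0≤g) base ⟩
      (2ℚ ^ 6) ^ j                     ≡⟨ trans (sym (^-* 2ℚ j 6)) (cong (2ℚ ^_) (ℕP.*-comm j 6)) ⟩
      2ℚ ^ (6 ℕ.* j) ∎
      where
      open ℚP.≤-Reasoning
      0≤½q = *-nonneg 0≤½ 0≤q
      lem : ∀ q → 1ℚ + ι 6 * (½ * q) ≡ 1ℚ + ι 3 * q
      lem = solve-∀ ℚ-ring
      lem₂ : ∀ m q → ½ - m * (½ * q) ≡ ½ * (1ℚ - m * q)
      lem₂ = solve-∀ ℚ-ring
      base : g ^ m ≤ 2ℚ ^ 6
      base = begin
        g ^ m                              ≤⟨ ^-monoˡ m 0≤g
          (subst (_≤ (1ℚ + ½ * q) ^ 6) (lem q) (bernoulli-ineq 6 0≤½q)) ⟩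
        ((1ℚ + ½ * q) ^ 6) ^ m             ≡⟨ trans (sym (^-* (1ℚ + ½ * q) m 6))
          (trans (cong ((1ℚ + ½ * q) ^_) (ℕP.*-comm m 6)) (^-* (1ℚ + ½ * q) 6 m)) ⟩
        ((1ℚ + ½ * q) ^ m) ^ 6             ≤⟨ ^-monoˡ 6 (^-nonneg m (+-nonneg 0≤1 0≤½q))
                                                (1+x-power≤2 m 0≤½q ½q≤1 (≤-by (*-nonneg 0≤½ (≤⇒0≤- mq≤1))
                                                  (lem₂ (ι m) q))) ⟩
        2ℚ ^ 6 ∎

    -- Over 2(m + 1) factors the rates q/2 add up to at least 1, so each such block contributes at
    -- most ½.
    decay : ∀ t n → t ℕ.* (2 ℕ.* suc m) ℕ.≤ n → (1ℚ - ½ * q) ^ n ≤ ½ ^ t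
    decay t n h = begin
      x ^ n                                        ≡⟨ trans (cong (x ^_) (sym (ℕP.m+[n∸m]≡n h)))
        (^-+ x (t ℕ.* (2 ℕ.* suc m)) (n ℕ.∸ t ℕ.* (2 ℕ.* suc m))) ⟩
      x ^ (t ℕ.* (2 ℕ.* suc m)) * x ^ (n ℕ.∸ t ℕ.* (2 ℕ.* suc m))    ≤⟨ *-monoˡ _
        (^-nonneg (t ℕ.* (2 ℕ.* suc m)) x≥0) (^-≤1 (n ℕ.∸ t ℕ.* (2 ℕ.* suc m)) x≥0 x≤1) ⟩
      x ^ (t ℕ.* (2 ℕ.* suc m)) * 1ℚ               ≡⟨ trans (*-identityʳ _) (^-* x t (2 ℕ.* suc m)) ⟩
      (x ^ (2 ℕ.* suc m)) ^ t                      ≤⟨ ^-monoˡ t (^-nonneg (2 ℕ.* suc m) x≥0)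
        (1-x-power≤½ (2 ℕ.* suc m) (*-nonneg 0≤½ 0≤q) ½q≤1
                                                        (≤-trans 1≤[1+m]q (≤-reflexive
                                                          (sym (trans (cong (_* (½ * q)) (ι-* 2 (suc m)))
                                                            (lem (ι (suc m)) q)))))) ⟩
      ½ ^ t ∎
      where
      open ℚP.≤-Reasoning
      x = 1ℚ - ½ * q
      x≥0 : 0ℚ ≤ x
      x≥0 = ≤⇒0≤- ½q≤1
      x≤1 : x ≤ 1ℚ
      x≤1 = ≤-by (*-nonneg 0≤½ 0≤q) (lem₃ q)
        where
        lem₃ : ∀ q → 1ℚ - (1ℚ - ½ * q) ≡ ½ * q
        lem₃ = solve-∀ ℚ-ring
      lem : ∀ m q → ι 2 * m * (½ * q) ≡ m * q
      lem = solve-∀ ℚ-ring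

    -- At least 1 when the vertices of W have 12j neighbours in B on average, with an expectation
    -- so small that it can be summed over all W and B.
    overload : ∀ {n} → ℕ → Graph n → Vec Bool n → Vec Bool n → ℚ
    overload j G W B = if (size B ℕ.≤ᵇ m ℕ.* j) ∧ (12 ℕ.* j ℕ.≤ᵇ size W)
      then ½ ^ (12 ℕ.* j ℕ.* size W) * 2ℚ ^ edges G W B else 0ℚ

    overload-nonneg : ∀ {n} j (G : Graph n) W B → 0ℚ ≤ overload j G W B
    overload-nonneg j G W B with (size B ℕ.≤ᵇ m ℕ.* j) ∧ (12 ℕ.* j ℕ.≤ᵇ size W)
    ... | true  = *-nonneg (^-nonneg (12 ℕ.* j ℕ.* size W) 0≤½) (^-nonneg (edges G W B) 0≤2)
    ... | false = ≤-refl

    -- Of the exponent 12j|W|, the edges use up 6j|W| by `g-power`; the other half is at least 72j²,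
    -- as |W| ≥ 12j. With n ≤ j² this will beat the 4^n pairs of sets.
    overload-exp : ∀ {n} j (W B : Vec Bool n) →
      𝔼 (graphE bern n) (λ G → overload j G W B) ≤ ½ ^ (6 ℕ.* j ℕ.* (12 ℕ.* j))
    overload-exp {n} j W B with size B ℕ.≤ᵇ m ℕ.* j in eqB | 12 ℕ.* j ℕ.≤ᵇ size W in eqW
    ... | false | _     = ≤-trans (≤-reflexive (𝔼-const (graphE bern n) 0ℚ)) (^-nonneg (6 ℕ.* j ℕ.* (12 ℕ.* j)) 0≤½)
    ... | true  | false = ≤-trans (≤-reflexive (𝔼-const (graphE bern n) 0ℚ)) (^-nonneg (6 ℕ.* j ℕ.* (12 ℕ.* j)) 0≤½)
    ... | true  | true  = begin
      𝔼 (graphE bern n) (λ G → ½ ^ (12 ℕ.* j ℕ.* size W) * 2ℚ ^ edges G W B)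
        ≡⟨ 𝔼-*ˡ (graphE bern n) (½ ^ (12 ℕ.* j ℕ.* size W)) (λ G → 2ℚ ^ edges G W B) ⟩
      ½ ^ (12 ℕ.* j ℕ.* size W) * 𝔼 (graphE bern n) (λ G → 2ℚ ^ edges G W B)
        ≤⟨ *-monoˡ _ (^-nonneg (12 ℕ.* j ℕ.* size W) 0≤½) (≤-trans (edges-exp W B)
             (^-monoʳ 1≤g (ℕP.*-monoʳ-≤ (size W) (ℕP.≤ᵇ⇒≤ (size B) (m ℕ.* j) (subst T (sym eqB) tt))))) ⟩
      ½ ^ (12 ℕ.* j ℕ.* size W) * g ^ (size W ℕ.* (m ℕ.* j))
        ≤⟨ *-monoˡ _ (^-nonneg (12 ℕ.* j ℕ.* size W) 0≤½) (≤-trans (≤-reflexive (^-* g (size W) (m ℕ.* j)))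
             (^-monoˡ (size W) (^-nonneg (m ℕ.* j) 0≤g) (g-power j))) ⟩
      ½ ^ (12 ℕ.* j ℕ.* size W) * (2ℚ ^ (6 ℕ.* j)) ^ size W
        ≡⟨ cong₂ _*_ (trans (cong (½ ^_) (split j (size W)))
          (^-+ ½ (6 ℕ.* j ℕ.* size W) (size W ℕ.* (6 ℕ.* j)))) (sym (^-* 2ℚ (size W) (6 ℕ.* j))) ⟩
      ½ ^ (6 ℕ.* j ℕ.* size W) * ½ ^ (size W ℕ.* (6 ℕ.* j)) * 2ℚ ^ (size W ℕ.* (6 ℕ.* j))
        ≡⟨ trans (*-assoc (½ ^ (6 ℕ.* j ℕ.* size W)) _ _)
          (trans (cong (½ ^ (6 ℕ.* j ℕ.* size W) *_) (½*2 (size W ℕ.* (6 ℕ.* j)))) (*-identityʳ _)) ⟩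
      ½ ^ (6 ℕ.* j ℕ.* size W)
        ≤⟨ ½^-antimono (ℕP.*-monoʳ-≤ (6 ℕ.* j) (ℕP.≤ᵇ⇒≤ (12 ℕ.* j) (size W) (subst T (sym eqW) tt))) ⟩
      ½ ^ (6 ℕ.* j ℕ.* (12 ℕ.* j)) ∎
      where
      open ℚP.≤-Reasoning
      split : ∀ j w → 12 ℕ.* j ℕ.* w ≡ 6 ℕ.* j ℕ.* w ℕ.+ w ℕ.* (6 ℕ.* j)
      split = ℕSolver.solve-∀

    1≤overload : ∀ {n} j (G : Graph n) W B → size B ℕ.≤ m ℕ.* j → 12 ℕ.* j ℕ.≤ size W →
      12 ℕ.* j ℕ.* size W ℕ.≤ edges G W B → 1ℚ ≤ overload j G W B
    1≤overload j G W B hB hW he with size B ℕ.≤ᵇ m ℕ.* j | 12 ℕ.* j ℕ.≤ᵇ size W | ℕP.≤⇒≤ᵇ hB | ℕP.≤⇒≤ᵇ hW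
    ... | true | true | _ | _ = ≤-trans (≤-reflexive (sym (½*2 (12 ℕ.* j ℕ.* size W))))
      (*-monoˡ _ (^-nonneg (12 ℕ.* j ℕ.* size W) 0≤½) (^-monoʳ (≤-by {t = 1ℚ} 0≤1 refl) he))

-- Deterministic majority dynamics

isMinus : Sign → Bool
isMinus Sign.+ = false
isMinus Sign.- = true

sum-cong : ∀ {n} {f g : Fin n → ℤ} → (∀ u → f u ≡ g u) → sum f ≡ sum g
sum-cong {zero}  h = refl
sum-cong {suc n} h = cong₂ ℤ._+_ (h zero) (sum-cong λ u → h (suc u))

sum-remove : ∀ {n} {f g : Fin n → ℤ} v → g v ≡ 0ℤ → (∀ w → w ≢ v → g w ≡ f w) → sum f ≡ f v ℤ.+ sum g
sum-remove {suc n} {f} {g} zero    gv h = cong (λ z → f zero ℤ.+ z)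
  (sym (trans (cong (ℤ._+ sum (λ u → g (suc u))) gv)
    (trans (ℤP.+-identityˡ (sum (λ u → g (suc u)))) (sum-cong λ u → h (suc u) λ ()))))
sum-remove {suc n} {f} {g} (suc v) gv h = begin
  f zero ℤ.+ sum (λ u → f (suc u))
    ≡⟨ cong₂ ℤ._+_ (sym (h zero λ ()))
      (sum-remove {f = λ u → f (suc u)} {λ u → g (suc u)} v gv λ w w≢v → h (suc w) λ e → w≢v (FinP.suc-injective e)) ⟩
  g zero ℤ.+ (f (suc v) ℤ.+ sum (λ u → g (suc u)))
    ≡⟨ lem (g zero) (f (suc v)) _ ⟩
  f (suc v) ℤ.+ (g zero ℤ.+ sum (λ u → g (suc u))) ∎
  where
  open ≡-Reasoning
  lem : ∀ a b c → a ℤ.+ (b ℤ.+ c) ≡ b ℤ.+ (a ℤ.+ c)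
  lem = ℤSolver.solve-∀

nsum-bound : ∀ {n} (f : Fin n → ℕ) → (∀ u → f u ℕ.≤ 1) → nsum f ℕ.≤ n
nsum-bound {zero}  f h = ℕ.z≤n
nsum-bound {suc n} f h = ℕP.+-mono-≤ (h zero) (nsum-bound (λ u → f (suc u)) λ u → h (suc u))

module _ {n} (G : Graph n) (S : State n) where

  minuses : Vec Bool n
  minuses = tabulate λ v → isMinus (S v)

  lookup-minuses : ∀ v → lookup minuses v ≡ isMinus (S v)
  lookup-minuses = VecP.lookup∘tabulate λ v → isMinus (S v)

  vertexDegree : Fin n → ℕ
  vertexDegree v = size (row G v)

  neighbourSum-count : ∀ v → neighbourSum G S v ℤ.+ ℤ.+ (2 ℕ.* degreeIn G minuses v) ≡ ℤ.+ vertexDegree v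
  neighbourSum-count v = trans
    (cong (λ z → neighbourSum G S v ℤ.+ ℤ.+ (2 ℕ.* z))
      (nsum-cong λ u → cong (λ b → 𝟙 (adj G v u) ℕ.* 𝟙 b) (lookup-minuses u)))
    (trans (count (adj G v) S) (cong ℤ.+_ (nsum-cong λ u → cong 𝟙 (sym (VecP.lookup∘tabulate (adj G v) u)))))
    where
    count : ∀ {m} (a : Fin m → Bool) (s : Fin m → Sign) →
      sum (λ u → if a u then value (s u) else 0ℤ) ℤ.+ ℤ.+ (2 ℕ.* nsum (λ u → 𝟙 (a u) ℕ.* 𝟙 (isMinus (s u)))) ≡
        ℤ.+ nsum (λ u → 𝟙 (a u))
    count {zero}  a s = refl
    count {suc m} a s = trans (cong (λ z → x ℤ.+ X ℤ.+ z)
        (trans (cong ℤ.+_ (ℕP.*-distribˡ-+ 2 k K)) (ℤP.pos-+ (2 ℕ.* k) (2 ℕ.* K))))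
      (trans (lem x X (ℤ.+ (2 ℕ.* k)) (ℤ.+ (2 ℕ.* K)))
        (trans (cong₂ ℤ._+_ (point (a zero) (s zero)) (count (λ u → a (suc u)) (λ u → s (suc u))))
          (sym (ℤP.pos-+ (𝟙 (a zero)) _))))
      where
      x = if a zero then value (s zero) else 0ℤ
      X = sum (λ u → if a (suc u) then value (s (suc u)) else 0ℤ)
      k = 𝟙 (a zero) ℕ.* 𝟙 (isMinus (s zero))
      K = nsum (λ u → 𝟙 (a (suc u)) ℕ.* 𝟙 (isMinus (s (suc u))))
      lem : ∀ x X k K → x ℤ.+ X ℤ.+ (k ℤ.+ K) ≡ (x ℤ.+ k) ℤ.+ (X ℤ.+ K)
      lem = ℤSolver.solve-∀
      point : ∀ b t → (if b then value t else 0ℤ) ℤ.+ ℤ.+ (2 ℕ.* (𝟙 b ℕ.* 𝟙 (isMinus t))) ≡ ℤ.+ 𝟙 b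
      point false t      = refl
      point true  Sign.+ = refl
      point true  Sign.- = refl

  -- A tie keeps the old state, which may be minus; hence the weak inequality here and the strict
  -- one in `all-plus`.
  step-minus : ∀ v → step G S v ≡ Sign.- → neighbourSum G S v ℤ.≤ 0ℤ
  step-minus v eq with neighbourSum G S v
  ... | ℤ.+ zero  = ℤP.≤-refl
  ... | -[1+ k ] = ℤ.-≤+
  step-minus v () | ℤ.+ suc k

  step-minus-degree : ∀ v → step G S v ≡ Sign.- → vertexDegree v ℕ.≤ 2 ℕ.* degreeIn G minuses v
  step-minus-degree v eq = ℤP.drop‿+≤+ (subst₂ ℤ._≤_ (neighbourSum-count v) (ℤP.+-identityˡ _)
    (ℤP.+-monoˡ-≤ (ℤ.+ (2 ℕ.* degreeIn G minuses v)) (step-minus v eq)))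

  degreeIn≤size : ∀ v → degreeIn G minuses v ℕ.≤ size minuses
  degreeIn≤size v = nsum-mono λ u → ℕP.≤-trans (ℕP.*-monoˡ-≤ (𝟙 (lookup minuses u)) (𝟙≤1 (adj G v u)))
    (ℕP.≤-reflexive (ℕP.*-identityˡ _))

isMinus-true : ∀ {s} → isMinus s ≡ true → s ≡ Sign.-
isMinus-true {Sign.-} _ = refl

all-plus : ∀ {n} (G : Graph n) S h → size (minuses G S) < h → (∀ v → 2 ℕ.* h ℕ.≤ vertexDegree G S v) → ∀ v →
  step G S v ≡ Sign.+
all-plus G S h small deg v with step G S v in eq
... | Sign.+ = refl
... | Sign.- = ⊥-elim (ℕP.<⇒≱ (ℕP.*-monoʳ-< 2 small)
  (ℕP.≤-trans (deg v) (ℕP.≤-trans (step-minus-degree G S v eq) (ℕP.*-monoʳ-≤ 2 (degreeIn≤size G S v)))))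

-- A vertex that is minus after the step had at least half of its neighbours, hence at least `h`,
-- among the minus vertices before it; these edges are added up.
crowded : ∀ {n} (G : Graph n) S h → (∀ v → 2 ℕ.* h ℕ.≤ vertexDegree G S v) →
  h ℕ.* size (minuses G (step G S)) ℕ.≤ edges G (minuses G (step G S)) (minuses G S)
crowded G S h deg = ℕP.≤-trans (ℕP.≤-reflexive (sym (nsum-*ˡ h (λ v → 𝟙 (lookup (minuses G (step G S)) v)))))
  (nsum-mono λ v → at v _ (lookup-minuses G (step G S) v))
  where
  at : ∀ v b → b ≡ isMinus (step G S v) → h ℕ.* 𝟙 b ℕ.≤ 𝟙 b ℕ.* degreeIn G (minuses G S) v
  at v false _  = ℕP.≤-reflexive (ℕP.*-zeroʳ h)
  at v true  eq = ℕP.≤-trans (ℕP.≤-reflexive (ℕP.*-identityʳ h)) (ℕP.≤-trans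
    (ℕP.*-cancelˡ-≤ 2 (ℕP.≤-trans (deg v) (step-minus-degree G S v (isMinus-true (sym eq)))))
    (ℕP.≤-reflexive (sym (ℕP.*-identityˡ _))))

module Failure (q : ℚ) (0≤q : 0ℚ ≤ q) (q≤1 : q ≤ 1ℚ)
               (m : ℕ) (mq≤1 : ι m * q ≤ 1ℚ) (1≤[1+m]q : 1ℚ ≤ ι (suc m) * q)
               (j : ℕ) where

  open Walk q 0≤q q≤1 using (bern)
  open Exponential q 0≤q q≤1

  wrong₂ : ∀ {n} → Vec Sign n → Graph n → Vec Bool n
  wrong₂ S G = minuses G (majority G (lookup S) 2)

  lowDegrees : ∀ {n} → Graph n → ℚ
  lowDegrees G = ∑ λ v → 2ℚ ^ (24 ℕ.* j) * ½ ^ degree G v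

  overloads : ∀ {n} → Graph n → ℚ
  overloads {n} G = ∑⊆ n λ W → ∑⊆ n λ B → overload m mq≤1 1≤[1+m]q j G W B

  -- A pointwise union bound in which each bad event makes its own term at least 1. With at most mj
  -- wrong vertices after two steps, all degrees at least 24j and no overload, the third step leaves
  -- fewer than 12j wrong vertices and the fourth none.
  failure : ∀ {n} (G : Graph n) S k c → 0ℚ ≤ c → 1ℚ ≤ ι (suc (m ℕ.* j)) * c → spinSum S ≡ ℤ.+ suc k →
    1ℚ ≤ ind (unanimousAfter? 4 (G , S)) + (ι (size (wrong₂ S G)) * c + (lowDegrees G + overloads G))
  failure {n} G S k c 0≤c 1≤bc S>0 = cases (m ℕ.* j ℕP.<? size (wrong₂ S G))
    (FinP.any? λ v → degree G v ℕP.<? 24 ℕ.* j)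
      (12 ℕ.* j ℕP.≤? size W)
    where
    S₂ = majority G (lookup S) 2
    W = minuses G (step G S₂)
    I = ind (unanimousAfter? 4 (G , S))
    X = ι (size (wrong₂ S G)) * c
    Y = lowDegrees G
    Z = overloads G
    I≥0 : 0ℚ ≤ I
    I≥0 = ind-nonneg (unanimousAfter? 4 (G , S))
    X≥0 : 0ℚ ≤ X
    X≥0 = *-nonneg (ι-nonneg (size (wrong₂ S G))) 0≤c
    term≥0 : ∀ v → 0ℚ ≤ 2ℚ ^ (24 ℕ.* j) * ½ ^ degree G v
    term≥0 v = *-nonneg (^-nonneg (24 ℕ.* j) 0≤2) (^-nonneg (degree G v) 0≤½)
    Y≥0 : 0ℚ ≤ Y
    Y≥0 = ∑-nonneg term≥0
    inner≥0 : ∀ W → 0ℚ ≤ ∑⊆ n λ B → overload m mq≤1 1≤[1+m]q j G W B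
    inner≥0 W = ∑⊆-nonneg n λ B → overload-nonneg m mq≤1 1≤[1+m]q j G W B
    Z≥0 : 0ℚ ≤ Z
    Z≥0 = ∑⊆-nonneg n inner≥0
    byX : 1ℚ ≤ X → 1ℚ ≤ I + (X + (Y + Z))
    byX h = ≤-by (+-nonneg I≥0 (+-nonneg (≤⇒0≤- h) (+-nonneg Y≥0 Z≥0))) (lem I X Y Z)
      where
      lem : ∀ i x y z → i + (x + (y + z)) - 1ℚ ≡ i + ((x - 1ℚ) + (y + z))
      lem = solve-∀ ℚ-ring
    byY : 1ℚ ≤ Y → 1ℚ ≤ I + (X + (Y + Z))
    byY h = ≤-by (+-nonneg I≥0 (+-nonneg X≥0 (+-nonneg (≤⇒0≤- h) Z≥0))) (lem I X Y Z)
      where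
      lem : ∀ i x y z → i + (x + (y + z)) - 1ℚ ≡ i + (x + ((y - 1ℚ) + z))
      lem = solve-∀ ℚ-ring
    byZ : 1ℚ ≤ Z → 1ℚ ≤ I + (X + (Y + Z))
    byZ h = ≤-by (+-nonneg I≥0 (+-nonneg X≥0 (+-nonneg Y≥0 (≤⇒0≤- h)))) (lem I X Y Z)
      where
      lem : ∀ i x y z → i + (x + (y + z)) - 1ℚ ≡ i + (x + (y + (z - 1ℚ)))
      lem = solve-∀ ℚ-ring
    byI : UnanimousAfter 4 (G , S) → 1ℚ ≤ I + (X + (Y + Z))
    byI u with unanimousAfter? 4 (G , S)
    ... | yes _ = ≤-by (+-nonneg X≥0 (+-nonneg Y≥0 Z≥0)) (lem X Y Z)
      where
      lem : ∀ x y z → 1ℚ + (x + (y + z)) - 1ℚ ≡ x + (y + z)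
      lem = solve-∀ ℚ-ring
    ... | no ¬u = ⊥-elim (¬u u)
    cases : Dec (m ℕ.* j < size (wrong₂ S G)) → Dec (Σ[ v ∈ Fin n ] degree G v < 24 ℕ.* j) → Dec
      (12 ℕ.* j ℕ.≤ size W) →
      1ℚ ≤ I + (X + (Y + Z))
    cases (yes b<) _ _ = byX (≤-trans 1≤bc (*-monoʳ c 0≤c (ι-mono b<)))
    cases (no _) (yes (v , low)) _ = byY (≤-trans
      (≤-trans (≤-reflexive (sym (trans (*-comm (2ℚ ^ d) (½ ^ d)) (½*2 d))))
        (*-monoʳ (½ ^ d) (^-nonneg d 0≤½) (^-monoʳ (≤-by {t = 1ℚ} 0≤1 refl) (ℕP.<⇒≤ low)))) (∑-member term≥0 v))
      where
      d = degree G v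
    cases (no ¬b) (no deg) (yes big) = byZ (≤-trans
      (1≤overload m mq≤1 1≤[1+m]q j G W (wrong₂ S G) (ℕP.≮⇒≥ ¬b) big (crowded G S₂ (12 ℕ.* j) deg′))
      (≤-trans (∑⊆-member (λ B → overload-nonneg m mq≤1 1≤[1+m]q j G W B) (wrong₂ S G)) (∑⊆-member inner≥0 W)))
      where
      deg′ : ∀ v → 2 ℕ.* (12 ℕ.* j) ℕ.≤ vertexDegree G S₂ v
      deg′ v = subst (ℕ._≤ degree G v) (ℕP.*-assoc 2 12 j) (ℕP.≮⇒≥ λ low → deg (v , low))
    cases (no _) (no deg) (no ¬big) = byI λ v → trans
      (cong just (all-plus G (majority G (lookup S) 3) (12 ℕ.* j) (ℕP.≰⇒> ¬big)
        (λ v → subst (ℕ._≤ degree G v) (ℕP.*-assoc 2 12 j) (ℕP.≮⇒≥ λ low → deg (v , low))) v))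
      (sym (cong sgn S>0))

-- The second step

direction : Sign → Step
direction Sign.+ = up
direction Sign.- = down

-- Ignoring the spins of u and v, which the edge uv and the diagonal decide.
others : ∀ {n} → Vec Sign n → Fin n → Fin n → Fin n → Step
others S u v w with w FinP.≟ u | w FinP.≟ v
... | yes _ | _     = stay
... | no _  | yes _ = stay
... | no _  | no _  = direction (lookup S w)

others-v : ∀ {n} (S : Vec Sign n) u v → others S u v v ≡ stay
others-v S u v with v FinP.≟ u | v FinP.≟ v
... | yes _ | _     = refl
... | no _  | yes _ = refl
... | no _  | no ne = ⊥-elim (ne refl)

others-u : ∀ {n} (S : Vec Sign n) u v → others S u v u ≡ stay
others-u S u v with u FinP.≟ u
... | yes _ = refl
... | no ne = ⊥-elim (ne refl)

shift-direction : ∀ s → shift (direction s) ≡ value s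
shift-direction Sign.+ = refl
shift-direction Sign.- = refl

others-w : ∀ {n} (S : Vec Sign n) u v w → w ≢ u → w ≢ v → shift (others S u v w) ≡ value (lookup S w)
others-w S u v w w≢u w≢v with w FinP.≟ u | w FinP.≟ v
... | yes e | _     = ⊥-elim (w≢u e)
... | no _  | yes e = ⊥-elim (w≢v e)
... | no _  | no _  = shift-direction (lookup S w)

dot-sum : ∀ {n} (c : Fin n → Step) N → dot c N ≡ sum λ w → if lookup N w then shift (c w) else 0ℤ
dot-sum c []      = refl
dot-sum c (b ∷ N) = cong (λ z → (if b then shift (c zero) else 0ℤ) ℤ.+ z) (dot-sum (λ w → c (suc w)) N)

dot-update : ∀ {n} (c : Fin n → Step) v → c v ≡ stay → ∀ b N → dot c (N [ v ]≔ b) ≡ dot c N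
dot-update c zero    eq b (a ∷ N) rewrite eq = cong (ℤ._+ dot (λ w → c (suc w)) N) (trans (const b) (sym (const a)))
  where
  const : ∀ b → (if b then 0ℤ else 0ℤ) ≡ 0ℤ
  const true  = refl
  const false = refl
dot-update c (suc v) eq b (a ∷ N) = cong (λ z → (if a then shift (c zero) else 0ℤ) ℤ.+ z)
  (dot-update (λ w → c (suc w)) v eq b N)

ups-downs : ∀ {n} (c : Fin n → Step) → ℤ.+ ups c ≡ ℤ.+ downs c ℤ.+ sum (λ w → shift (c w))
ups-downs {zero}  c = refl
ups-downs {suc n} c with c zero | ups-downs (λ w → c (suc w))
... | up   | ih = trans (cong (λ z → 1ℤ ℤ.+ z) ih) (lem (ℤ.+ downs λ w → c (suc w)) (sum λ w → shift (c (suc w))))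
  where
  lem : ∀ d s → 1ℤ ℤ.+ (d ℤ.+ s) ≡ d ℤ.+ (1ℤ ℤ.+ s)
  lem = ℤSolver.solve-∀
... | stay | ih = trans ih
  (cong (λ z → ℤ.+ downs (λ w → c (suc w)) ℤ.+ z) (sym (ℤP.+-identityˡ (sum λ w → shift (c (suc w))))))
... | down | ih = trans ih (lem (ℤ.+ downs λ w → c (suc w)) (sum λ w → shift (c (suc w))))
  where
  lem : ∀ d s → d ℤ.+ s ≡ (1ℤ ℤ.+ d) ℤ.+ (-1ℤ ℤ.+ s)
  lem = ℤSolver.solve-∀

downs≤ : ∀ {n} (c : Fin n → Step) → downs c ℕ.≤ n
downs≤ {zero}  c = ℕ.z≤n
downs≤ {suc n} c with c zero
... | up   = ℕP.m≤n⇒m≤1+n (downs≤ λ w → c (suc w))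
... | stay = ℕP.m≤n⇒m≤1+n (downs≤ λ w → c (suc w))
... | down = ℕ.s≤s (downs≤ λ w → c (suc w))

others-sum : ∀ {n} (S : Vec Sign n) u v → u ≢ v →
  spinSum S ≡ value (lookup S v) ℤ.+ (value (lookup S u) ℤ.+ sum (λ w → shift (others S u v w)))
others-sum {n} S u v u≢v = trans (sum-remove v h-v h-w)
  (cong (λ z → value (lookup S v) ℤ.+ z) (trans (sum-remove u (cong shift (others-u S u v)) h′)
    (cong (ℤ._+ sum (λ w → shift (others S u v w))) (h-w u u≢v))))
  where
  h : Fin n → ℤ
  h w with w FinP.≟ v
  ... | yes _ = 0ℤ
  ... | no _  = value (lookup S w)
  h-v : h v ≡ 0ℤ
  h-v with v FinP.≟ v
  ... | yes _ = refl
  ... | no ne = ⊥-elim (ne refl)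
  h-w : ∀ w → w ≢ v → h w ≡ value (lookup S w)
  h-w w ne with w FinP.≟ v
  ... | yes e = ⊥-elim (ne e)
  ... | no _  = refl
  h′ : ∀ w → w ≢ u → shift (others S u v w) ≡ h w
  h′ w ne = by-cases (w FinP.≟ v)
    where
    by-cases : Dec (w ≡ v) → shift (others S u v w) ≡ h w
    by-cases (no w≢v)   = trans (others-w S u v w ne w≢v) (sym (h-w w w≢v))
    by-cases (yes refl) = trans (cong shift (others-v S u v)) (sym h-v)

-- The two ignored spins change the sum k + 2 by -2, 0 or 2; the offset 2 keeps the excess of ups a
-- natural number.
imbalance : ∀ {n} (S : Vec Sign n) u v → u ≢ v → ∀ k → spinSum S ≡ ℤ.+ suc (suc k) →
  Σ[ d ∈ ℕ ] (ups (others S u v) ≡ downs (others S u v) ℕ.+ d × k ℕ.≤ d × d ℕ.≤ suc (suc (suc (suc k))))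
imbalance S u v u≢v k eq with lookup S v | lookup S u | others-sum S u v u≢v
... | s | t | total = finish s t (trans (sym eq) total)
  where
  X = sum (λ w → shift (others S u v w))
  done : ∀ d → X ≡ ℤ.+ d → ups (others S u v) ≡ downs (others S u v) ℕ.+ d
  done d eqX = ℤP.+-injective (trans (ups-downs (others S u v)) (cong (λ z → ℤ.+ downs (others S u v) ℤ.+ z) eqX))
  solveX : ∀ a b → X ≡ ℤ.- a ℤ.+ (ℤ.- b ℤ.+ (a ℤ.+ (b ℤ.+ X)))
  solveX a b = lem a b X
    where
    lem : ∀ a b X → X ≡ ℤ.- a ℤ.+ (ℤ.- b ℤ.+ (a ℤ.+ (b ℤ.+ X)))
    lem = ℤSolver.solve-∀
  finish : ∀ s t → ℤ.+ suc (suc k) ≡ value s ℤ.+ (value t ℤ.+ X) →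
    Σ[ d ∈ ℕ ] (ups (others S u v) ≡ downs (others S u v) ℕ.+ d × k ℕ.≤ d × d ℕ.≤ suc (suc (suc (suc k))))
  finish Sign.+ Sign.+ e = k , done k (trans (solveX 1ℤ 1ℤ) (cong (λ z → -1ℤ ℤ.+ (-1ℤ ℤ.+ z)) (sym e)))
    , ℕP.≤-refl , ℕP.m≤n+m k 4
  finish Sign.+ Sign.- e = suc (suc k) , done _ (trans (solveX 1ℤ -1ℤ) (cong (λ z → -1ℤ ℤ.+ (1ℤ ℤ.+ z)) (sym e)))
    , ℕP.m≤n+m k 2 , ℕP.m≤n+m (suc (suc k)) 2
  finish Sign.- Sign.+ e = suc (suc k) , done _ (trans (solveX -1ℤ 1ℤ) (cong (λ z → 1ℤ ℤ.+ (-1ℤ ℤ.+ z)) (sym e)))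
    , ℕP.m≤n+m k 2 , ℕP.m≤n+m (suc (suc k)) 2
  finish Sign.- Sign.- e = suc (suc (suc (suc k))) , done _
    (trans (solveX -1ℤ -1ℤ) (cong (λ z → 1ℤ ℤ.+ (1ℤ ℤ.+ z)) (sym e)))
    , ℕP.m≤n+m k 4 , ℕP.≤-refl

toℚ-+ : ∀ x y → toℚ (x ℤ.+ y) ≡ toℚ x + toℚ y
toℚ-+ (ℤ.+ zero)    y = trans (cong toℚ (ℤP.+-identityˡ y)) (sym (+-identityˡ (toℚ y)))
toℚ-+ (ℤ.+ suc n)   y = trans (cong toℚ (ℤP.+-assoc 1ℤ (ℤ.+ n) y))
  (trans (toℚ-suc (ℤ.+ n ℤ.+ y)) (trans (cong (1ℚ +_) (toℚ-+ (ℤ.+ n) y)) (sym (+-assoc 1ℚ (ι n) (toℚ y)))))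
toℚ-+ -[1+ zero ]   y = toℚ-pred y
toℚ-+ -[1+ suc n ]  y = trans (cong toℚ (ℤP.+-assoc -1ℤ -[1+ n ] y))
  (trans (toℚ-pred (-[1+ n ] ℤ.+ y)) (trans (cong (- 1ℚ +_) (toℚ-+ -[1+ n ] y)) (lem (ι n) (toℚ y))))
  where
  lem : ∀ n y → - 1ℚ + (- (1ℚ + n) + y) ≡ - (1ℚ + (1ℚ + n)) + y
  lem = solve-∀ ℚ-ring

toℚ-sum : ∀ {n} (f : Fin n → ℤ) → toℚ (sum f) ≡ ∑ λ u → toℚ (f u)
toℚ-sum {zero}  f = refl
toℚ-sum {suc n} f = trans (toℚ-+ (f zero) _) (cong (toℚ (f zero) +_) (toℚ-sum λ u → f (suc u)))

toℚ-nonpos : ∀ {y} → y ℤ.≤ 0ℤ → toℚ y ≤ 0ℚ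
toℚ-nonpos {ℤ.+ zero}  (ℤ.+≤+ _) = ≤-refl
toℚ-nonpos { -[1+ n ]} _         = neg-antimono-≤ (ι-nonneg (suc n))

ι-nsum : ∀ {n} (f : Fin n → ℕ) → ι (nsum f) ≡ ∑ λ u → ι (f u)
ι-nsum {zero}  f = refl
ι-nsum {suc n} f = trans (ι-+ (f zero) _) (cong (ι (f zero) +_) (ι-nsum λ u → f (suc u)))

∑-except : ∀ {n} {f : Fin n → ℚ} {c} v → 0ℚ ≤ f v → (∀ u → u ≢ v → c ≤ f u) → ι n * c - c ≤ ∑ f
∑-except {suc n} {f} {c} zero    h₀ h = ≤-by
  (+-nonneg h₀ (≤⇒0≤- (≤-trans (≤-reflexive (sym (∑-const n c))) (∑-mono λ u → h (suc u) λ ()))))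
  (lem (ι n) c (f zero) (∑ λ u → f (suc u)))
  where
  lem : ∀ n c a s → a + s - ((1ℚ + n) * c - c) ≡ a + (s - n * c)
  lem = solve-∀ ℚ-ring
∑-except {suc n} {f} {c} (suc v) h₀ h = ≤-by (+-nonneg (≤⇒0≤- (h zero λ ()))
    (≤⇒0≤- (∑-except {f = λ u → f (suc u)} v h₀ λ u ne → h (suc u) λ e → ne (FinP.suc-injective e))))
  (lem (ι n) c (f zero) (∑ λ u → f (suc u)))
  where
  lem : ∀ n c a s → a + s - ((1ℚ + n) * c - c) ≡ a - c + (s - (n * c - c))
  lem = solve-∀ ℚ-ring

bit-independent : ∀ q (0≤q : 0ℚ ≤ q) (q≤1 : q ≤ 1ℚ) {n} (v : Fin n) F → (∀ b N → F (N [ v ]≔ b) ≡ F N) →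
  𝔼 (iidE (bernoulliE q 0≤q q≤1) n) (λ N → ι (𝟙 (lookup N v)) * F N) ≡ q * 𝔼 (iidE (bernoulliE q 0≤q q≤1) n) F
bit-independent q 0≤q q≤1 {suc n} zero F inv = trans
  (cong₂ (λ a b → q * a + (1ℚ - q) * b) (𝔼-*ˡ ν (ι 1) (λ N → F (true ∷ N))) (𝔼-*ˡ ν (ι 0) (λ N → F (false ∷ N))))
  (trans (cong (λ z → q * (ι 1 * X) + (1ℚ - q) * (ι 0 * z)) same)
    (trans (lem q X) (cong (λ z → q * (q * X + (1ℚ - q) * z)) (sym same))))
  where
  ν = iidE (bernoulliE q 0≤q q≤1) n
  X = 𝔼 ν (λ N → F (true ∷ N))
  same : 𝔼 ν (λ N → F (false ∷ N)) ≡ X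
  same = 𝔼-cong ν λ N → inv false (true ∷ N)
  lem : ∀ q x → q * (ι 1 * x) + (1ℚ - q) * (ι 0 * x) ≡ q * (q * x + (1ℚ - q) * x)
  lem = solve-∀ ℚ-ring
bit-independent q 0≤q q≤1 {suc n} (suc v) F inv = trans
  (cong₂ (λ a b → q * a + (1ℚ - q) * b) (ih true) (ih false)) (lem q (X true) (X false))
  where
  ν = iidE (bernoulliE q 0≤q q≤1) n
  X = λ b → 𝔼 ν (λ N → F (b ∷ N))
  ih : ∀ b → 𝔼 ν (λ N → ι (𝟙 (lookup N v)) * F (b ∷ N)) ≡ q * X b
  ih b = bit-independent q 0≤q q≤1 v (λ N → F (b ∷ N)) λ a N → inv a (b ∷ N)
  lem : ∀ q x y → q * (q * x) + (1ℚ - q) * (q * y) ≡ q * (q * x + (1ℚ - q) * y)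
  lem = solve-∀ ℚ-ring

majorityOf : Sign → ℤ → ℚ
majorityOf s y = toℚ (value (fromMaybe s (sgn y)))

-1≤majority : ∀ s y → - 1ℚ ≤ majorityOf s y
-1≤majority s y with fromMaybe s (sgn y)
... | Sign.+ = ≤-by {t = 2ℚ} 0≤2 refl
... | Sign.- = ≤-refl

-- One more spin `t` leaves a sum of at least 2 positive; below 2 the bound is the trivial -1,
-- whatever a tie does.
sgn₂≤majority : ∀ s t y → sgn₂ y ≤ majorityOf s (value t ℤ.+ y)
sgn₂≤majority s Sign.+ (ℤ.+ suc (suc k)) = ≤-refl
sgn₂≤majority s Sign.- (ℤ.+ suc (suc k)) = ≤-refl
sgn₂≤majority s t (ℤ.+ zero)             = -1≤majority s (value t ℤ.+ ℤ.+ 0)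
sgn₂≤majority s t (ℤ.+ suc zero)         = -1≤majority s (value t ℤ.+ ℤ.+ 1)
sgn₂≤majority s t -[1+ k ]               = -1≤majority s (value t ℤ.+ -[1+ k ])

module SecondStep (q : ℚ) (0≤q : 0ℚ ≤ q) (q≤1 : q ≤ 1ℚ) {n} (S : Vec Sign n) where

  open Walk q 0≤q q≤1 using (bern)

  νG : Expectation (Graph n)
  νG = graphE bern n

  S₁ : Graph n → State n
  S₁ G = step G (lookup S)

  contribution : Fin n → Fin n → Graph n → ℚ
  contribution v u G = toℚ (if adj G v u then value (S₁ G u) else 0ℤ)

  contribution-row : Fin n → Fin n → Vec Bool n → ℚ
  contribution-row v u R = ι (𝟙 (lookup R v)) *
    majorityOf (lookup S u) (sum λ w → if lookup R w then value (lookup S w) else 0ℤ)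

  contribution-row-correct : ∀ v u G → contribution v u G ≡ contribution-row v u (row G u)
  contribution-row-correct v u G = trans (cases (adj G v u) (adj-sym G v u))
    (cong (λ z → ι (𝟙 (lookup (row G u) v)) * majorityOf (lookup S u) z)
      (sum-cong λ w → cong (λ b → if b then value (lookup S w) else 0ℤ) (sym (VecP.lookup∘tabulate (adj G u) w))))
    where
    cases : ∀ b → b ≡ adj G u v → toℚ (if b then value (S₁ G u) else 0ℤ) ≡
      ι (𝟙 (lookup (row G u) v)) * majorityOf (lookup S u) (neighbourSum G (lookup S) u)
    cases b eq rewrite VecP.lookup∘tabulate (adj G u) v | sym eq with b
    ... | true  = sym (*-identityˡ _)
    ... | false = sym (*-zeroˡ (majorityOf (lookup S u) (neighbourSum G (lookup S) u)))

  -- The edge bit between v and u lies in row `u` as well, and the state of u after one step depends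
  -- on that row alone. Grouping the field at v by contributors u is what makes `Var-rows`
  -- applicable.
  contribution-local : ∀ v u → RowLocal u (contribution v u)
  contribution-local v u G H eq = trans (contribution-row-correct v u G)
    (trans (cong (contribution-row v u) (VecP.tabulate-cong eq)) (sym (contribution-row-correct v u H)))

  contribution-square : ∀ v u G → contribution v u G * contribution v u G ≡ ι (𝟙 (lookup (row G u) v)) * 1ℚ
  contribution-square v u G rewrite VecP.lookup∘tabulate (adj G u) v | adj-sym G u v with adj G v u
  ... | false = refl
  ... | true  = spin (S₁ G u)
    where
    spin : ∀ s → toℚ (value s) * toℚ (value s) ≡ ι 1 * 1ℚ
    spin Sign.+ = refl
    spin Sign.- = refl

  contribution-variance : ∀ v u → Var νG (contribution v u) ≤ q
  contribution-variance v u = begin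
    Var νG (contribution v u)
      ≤⟨ Var≤𝔼-square νG (contribution v u) ⟩
    𝔼 νG (λ G → contribution v u G * contribution v u G)
      ≡⟨ 𝔼-cong νG (contribution-square v u) ⟩
    𝔼 νG (λ G → ι (𝟙 (lookup (row G u) v)) * 1ℚ)
      ≡⟨ row-marginal bern u (λ R → ι (𝟙 (lookup R v)) * 1ℚ) ⟩
    𝔼 (iidE bern n) (λ N → ι (𝟙 (lookup (N [ u ]≔ false) v)) * 1ℚ)
      ≤⟨ 𝔼-mono (iidE bern n) (λ N → *-monoʳ 1ℚ 0≤1 (ι-mono (erase N))) ⟩
    𝔼 (iidE bern n) (λ N → ι (𝟙 (lookup N v)) * 1ℚ)
      ≡⟨ bit-independent q 0≤q q≤1 v (λ _ → 1ℚ) (λ _ _ → refl) ⟩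
    q * 𝔼 (iidE bern n) (λ _ → 1ℚ)
      ≡⟨ trans (cong (q *_) (𝔼-1 (iidE bern n))) (*-identityʳ q) ⟩
    q ∎
    where
    open ℚP.≤-Reasoning
    erase : ∀ N → 𝟙 (lookup (N [ u ]≔ false) v) ℕ.≤ 𝟙 (lookup N v)
    erase N with v FinP.≟ u
    ... | yes refl rewrite VecP.lookup∘updateAt v {λ _ → false} N = ℕ.z≤n
    ... | no v≢u   rewrite VecP.lookup∘updateAt′ v u {λ _ → false} v≢u N = ℕP.≤-refl

  contribution-self : ∀ v → 0ℚ ≤ 𝔼 νG (contribution v v)
  contribution-self v = ≤-reflexive (sym (trans
    (𝔼-cong νG λ G → cong (λ b → toℚ (if b then value (S₁ G v) else 0ℤ)) (adj-irrefl G v)) (𝔼-const νG 0ℚ)))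

  -- Given the edge, the sum at u is the spin of v plus `dot`, and `sgn₂` is insensitive to that
  -- spin. What is left is independent of the edge bit, whose probability `q` factors out.
  contribution-mean : ∀ v u → u ≢ v → q * 𝔼 (iidE bern n) (λ N → sgn₂ (dot (others S u v) N)) ≤ 𝔼 νG
    (contribution v u)
  contribution-mean v u u≢v = begin
    q * 𝔼 (iidE bern n) (λ N → sgn₂ (dot c N))
      ≡⟨ bit-independent q 0≤q q≤1 v (λ N → sgn₂ (dot c N))
        (λ b N → cong sgn₂ (dot-update c v (others-v S u v) b N)) ⟨
    𝔼 (iidE bern n) (λ N → ι (𝟙 (lookup N v)) * sgn₂ (dot c N))
      ≤⟨ 𝔼-mono (iidE bern n) (λ N → pointwise N (lookup N v) refl) ⟩
    𝔼 (iidE bern n) (λ N → contribution-row v u (N [ u ]≔ false))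
      ≡⟨ row-marginal bern u (contribution-row v u) ⟨
    𝔼 νG (λ G → contribution-row v u (row G u))
      ≡⟨ 𝔼-cong νG (λ G → sym (contribution-row-correct v u G)) ⟩
    𝔼 νG (contribution v u) ∎
    where
    open ℚP.≤-Reasoning
    c = others S u v
    rowSum : Vec Bool n → ℤ
    rowSum R = sum λ w → if lookup R w then value (lookup S w) else 0ℤ
    keep-v : ∀ N → lookup (N [ u ]≔ false) v ≡ lookup N v
    keep-v N = VecP.lookup∘updateAt′ v u {λ _ → false} (λ e → u≢v (sym e)) N
    if-zero : ∀ b → (if b then 0ℤ else 0ℤ) ≡ 0ℤ
    if-zero true  = refl
    if-zero false = refl
    decompose : ∀ N → lookup N v ≡ true → rowSum (N [ u ]≔ false) ≡ value (lookup S v) ℤ.+ dot c N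
    decompose N eq = trans (sum-remove v
        (trans (cong (λ z → if lookup N v then shift z else 0ℤ) (others-v S u v)) (if-zero (lookup N v))) rest)
      (cong₂ ℤ._+_ (cong (λ b → if b then value (lookup S v) else 0ℤ) (trans (keep-v N) eq)) (sym (dot-sum c N)))
      where
      rest : ∀ w → w ≢ v → (if lookup N w then shift (c w) else 0ℤ) ≡
        (if lookup (N [ u ]≔ false) w then value (lookup S w) else 0ℤ)
      rest w w≢v = by-cases (w FinP.≟ u)
        where
        by-cases : Dec (w ≡ u) → (if lookup N w then shift (c w) else 0ℤ) ≡
          (if lookup (N [ u ]≔ false) w then value (lookup S w) else 0ℤ)
        by-cases (yes refl) = trans (cong (λ z → if lookup N w then shift z else 0ℤ) (others-u S u v))
          (trans (if-zero (lookup N w))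
          (sym (cong (λ b → if b then value (lookup S w) else 0ℤ) (VecP.lookup∘updateAt w {λ _ → false} N))))
        by-cases (no w≢u)   = cong₂ (λ b z → if b then z else 0ℤ)
          (sym (VecP.lookup∘updateAt′ w u {λ _ → false} w≢u N)) (others-w S u v w w≢u w≢v)
    pointwise : ∀ N b → lookup N v ≡ b → ι (𝟙 (lookup N v)) * sgn₂ (dot c N) ≤ contribution-row v u (N [ u ]≔ false)
    pointwise N false eq = ≤-reflexive
      (trans (cong (λ b → ι (𝟙 b) * sgn₂ (dot c N)) eq) (trans (*-zeroˡ (sgn₂ (dot c N)))
      (sym (trans (cong (λ b → ι (𝟙 b) * majorityOf (lookup S u) (rowSum (N [ u ]≔ false)))
        (trans (keep-v N) eq)) (*-zeroˡ (majorityOf (lookup S u) (rowSum (N [ u ]≔ false))))))))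
    pointwise N true  eq = ≤-trans (≤-reflexive (trans (cong (λ b → ι (𝟙 b) * sgn₂ (dot c N)) eq) (*-identityˡ _)))
      (≤-trans (sgn₂≤majority (lookup S u) (lookup S v) (dot c N))
        (≤-reflexive (sym (trans (cong₂ (λ b y → ι (𝟙 b) * majorityOf (lookup S u) y) (trans (keep-v N) eq)
          (decompose N eq)) (*-identityˡ _)))))

  module _ (μ₀ : ℚ) (0≤μ₀ : 0ℚ ≤ μ₀)
    (bias : ∀ u v → u ≢ v → μ₀ ≤ 𝔼 (iidE bern n) (λ N → sgn₂ (dot (others S u v) N))) where

    -- A lower bound for the mean of the field, made of n - 1 contributions since the diagonal one
    -- vanishes.
    M : ℚ
    M = ι n * (q * μ₀) - q * μ₀

    field₁ : Fin n → Graph n → ℚ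
    field₁ v G = ∑ λ u → contribution v u G

    field₁-mean : ∀ v → M ≤ 𝔼 νG (field₁ v)
    field₁-mean v = ≤-trans (∑-except v (contribution-self v) λ u u≢v →
        ≤-trans (*-monoˡ q 0≤q (bias u v u≢v)) (contribution-mean v u u≢v))
      (≤-reflexive (sym (𝔼-∑ νG (contribution v))))

    field₁-variance : ∀ v → Var νG (field₁ v) ≤ 2ℚ * (ι n * q)
    field₁-variance v = ≤-trans (Var-rows bern n (contribution v) (contribution-local v))
      (*-monoˡ 2ℚ 0≤2 (≤-trans (∑-mono (contribution-variance v)) (≤-reflexive (∑-const n q))))

    -- Chebyshev in pointwise form: a vertex that is minus after two steps has field at most 0, so
    -- its field deviates by at least `M` from the mean. Summed over all vertices, this leaves n
    -- variances on the right.
    wrong₂-expectation : 0ℚ ≤ M →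
      𝔼 νG (λ G → ι (size (minuses G (majority G (lookup S) 2)))) * (M * M) ≤ ι n * (2ℚ * (ι n * q))
    wrong₂-expectation 0≤M = begin
      𝔼 νG (λ G → ι (size (W G))) * (M * M)
        ≡⟨ trans (*-comm _ (M * M)) (sym (𝔼-*ˡ νG (M * M) (λ G → ι (size (W G))))) ⟩
      𝔼 νG (λ G → M * M * ι (size (W G)))
        ≤⟨ 𝔼-mono νG (λ G → ≤-trans
          (≤-reflexive (trans (cong (M * M *_) (ι-nsum (λ v → 𝟙 (lookup (W G) v))))
            (∑-*ˡ (M * M) (λ v → ι (𝟙 (lookup (W G) v))))))
             (∑-mono λ v → ≤-trans (≤-reflexive
               (cong (λ b → M * M * ι (𝟙 b)) (lookup-minuses G (majority G (lookup S) 2) v)))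
                                      (chebyshev G v (step G (S₁ G) v) refl))) ⟩
      𝔼 νG (λ G → ∑ λ v → (field₁ v G - 𝔼 νG (field₁ v)) * (field₁ v G - 𝔼 νG (field₁ v)))
        ≡⟨ 𝔼-∑ νG (λ v G → (field₁ v G - 𝔼 νG (field₁ v)) * (field₁ v G - 𝔼 νG (field₁ v))) ⟩
      ∑ (λ v → 𝔼 νG (λ G → (field₁ v G - 𝔼 νG (field₁ v)) * (field₁ v G - 𝔼 νG (field₁ v))))
        ≤⟨ ∑-mono (λ v → ≤-trans (≤-reflexive (sym (Var-center νG (field₁ v)))) (field₁-variance v)) ⟩
      ∑ {n} (λ _ → 2ℚ * (ι n * q))
        ≡⟨ ∑-const n (2ℚ * (ι n * q)) ⟩
      ι n * (2ℚ * (ι n * q)) ∎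
      where
      open ℚP.≤-Reasoning
      W : Graph n → Vec Bool n
      W G = minuses G (majority G (lookup S) 2)
      ∑-*ˡ : ∀ {k} c (f : Fin k → ℚ) → c * ∑ f ≡ ∑ λ u → c * f u
      ∑-*ˡ {zero}  c f = *-zeroʳ c
      ∑-*ˡ {suc k} c f = trans (*-distribˡ-+ c (f zero) _) (cong (c * f zero +_) (∑-*ˡ c λ u → f (suc u)))
      lem : ∀ m y e → (y - e) * (y - e) - m * m * (1ℚ + 0ℚ) ≡ (e - m + (0ℚ - y)) * (e - m + (0ℚ - y)) +
        (e - m + (0ℚ - y)) * m * 2ℚ
      lem = solve-∀ ℚ-ring
      chebyshev : ∀ G v s → step G (S₁ G) v ≡ s → M * M * ι (𝟙 (isMinus s)) ≤
        (field₁ v G - 𝔼 νG (field₁ v)) * (field₁ v G - 𝔼 νG (field₁ v))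
      chebyshev G v Sign.+ eq = ≤-trans (≤-reflexive (*-zeroʳ (M * M))) (square-nonneg (field₁ v G - 𝔼 νG (field₁ v)))
      chebyshev G v Sign.- eq = ≤-by (+-nonneg (square-nonneg z) (*-nonneg (*-nonneg z≥0 0≤M) 0≤2))
        (lem M (field₁ v G) (𝔼 νG (field₁ v)))
        where
        z = 𝔼 νG (field₁ v) - M + (0ℚ - field₁ v G)
        y≤0 : field₁ v G ≤ 0ℚ
        y≤0 = subst (_≤ 0ℚ) (toℚ-sum (λ u → if adj G v u then value (S₁ G u) else 0ℤ))
          (toℚ-nonpos (step-minus G (S₁ G) v eq))
        z≥0 : 0ℚ ≤ z
        z≥0 = +-nonneg (≤⇒0≤- (field₁-mean v)) (≤⇒0≤- y≤0)

-- Failure probabilities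

ι-reflect : ∀ {m n} → ι m ≤ ι n → m ℕ.≤ n
ι-reflect {m} {n} h with m ℕP.≤? n
... | yes p = p
... | no ¬p = ⊥-elim (<-irrefl refl (<-≤-trans (<-≤-trans
    (subst (ℚ._< 1ℚ + ι n) (+-identityˡ (ι n)) (+-monoˡ-< (ι n) (positive⁻¹ 1ℚ)))
    (ι-mono (ℕP.≰⇒> ¬p))) h))

inverse : ∀ x → 0ℚ ℚ.< x → Σ[ i ∈ ℚ ] (0ℚ ≤ i × x * i ≡ 1ℚ)
inverse x 0<x = ℚ.1/_ x {{x≢0}} , <⇒≤ (positive⁻¹ (ℚ.1/_ x {{x≢0}}) {{ℚP.1/pos⇒pos x {{x>0}}}}) , ℚP.*-inverseʳ
  x {{x≢0}}
  where
  x>0 = ℚ.positive 0<x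
  x≢0 = ℚP.pos⇒nonZero x {{x>0}}

isqrt : ∀ n → Σ[ s ∈ ℕ ] (s ℕ.* s ℕ.≤ n × n < suc s ℕ.* suc s)
isqrt zero    = 0 , ℕ.z≤n , ℕ.s≤s ℕ.z≤n
isqrt (suc n) with isqrt n
... | s , lo , hi with suc s ℕ.* suc s ℕP.≤? suc n
...   | yes p = suc s , p , ℕP.≤-<-trans hi (ℕP.*-mono-< (ℕP.n<1+n (suc s)) (ℕP.n<1+n (suc s)))
...   | no ¬p = s , ℕP.m≤n⇒m≤1+n lo , ℕP.≰⇒> ¬p

-- A downward search for ⌊1/q⌋, the integer that stands in for 1/q in all set sizes.
floor-1/ : ∀ q b → 1ℚ ℚ.< ι (suc b) * q → Σ[ m ∈ ℕ ] (ι m * q ≤ 1ℚ × 1ℚ ℚ.< ι (suc m) * q)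
floor-1/ q zero    h = 0 , ≤-trans (≤-reflexive (*-zeroˡ q)) 0≤1 , h
floor-1/ q (suc b) h with ι (suc b) * q ℚP.≤? 1ℚ
... | yes p = suc b , p , h
... | no ¬p = floor-1/ q b (≰⇒> ¬p)

ι≤2^ : ∀ j → ι j ≤ 2ℚ ^ j
ι≤2^ zero    = 0≤1
ι≤2^ (suc j) = ≤-trans (+-mono-≤ (1≤^ j (≤-by {t = 1ℚ} 0≤1 refl)) (ι≤2^ j)) (≤-reflexive (lem (2ℚ ^ j)))
  where
  lem : ∀ x → x + x ≡ 2ℚ * x
  lem = solve-∀ ℚ-ring

ι*½^≤1 : ∀ j → ι j * ½ ^ j ≤ 1ℚ
ι*½^≤1 j = ≤-trans (*-monoʳ (½ ^ j) (^-nonneg j 0≤½) (ι≤2^ j)) (≤-reflexive (trans (*-comm (2ℚ ^ j) (½ ^ j)) (½*2 j)))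

module Bounds (q : ℚ) (0<q : 0ℚ ℚ.< q) (q≤1 : q ≤ 1ℚ)
              (m : ℕ) (mq≤1 : ι m * q ≤ 1ℚ) (1≤[1+m]q : 1ℚ ≤ ι (suc m) * q)
              (j n : ℕ) where

  0≤q : 0ℚ ≤ q
  0≤q = <⇒≤ 0<q

  open Walk q 0≤q q≤1 using (bern; r; 0≤r)
  open Exponential q 0≤q q≤1
  open Failure q 0≤q q≤1 m mq≤1 1≤[1+m]q j

  νG : Expectation (Graph n)
  νG = graphE bern n

  -- The decay ½^(27j) against the weight 2^(24j) leaves ½^(3j). As j½^j ≤ 1, this pays for at most
  -- j² vertices and for the factor j in front.
  lowDegrees-bound : 27 ℕ.* j ℕ.* (2 ℕ.* suc m) ℕ.≤ n → n ℕ.≤ j ℕ.* j → ι j * 𝔼 νG lowDegrees ≤ 2ℚ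
  lowDegrees-bound h₁ h₂ = begin
    ι j * 𝔼 νG lowDegrees
      ≤⟨ *-monoˡ (ι j) (ι-nonneg j) (begin
           𝔼 νG lowDegrees
             ≡⟨ trans (𝔼-∑ νG (λ v G → 2ℚ ^ (24 ℕ.* j) * ½ ^ degree G v))
               (∑-cong λ v → 𝔼-*ˡ νG (2ℚ ^ (24 ℕ.* j)) (λ G → ½ ^ degree G v)) ⟩
           ∑ (λ v → 2ℚ ^ (24 ℕ.* j) * 𝔼 νG (λ G → ½ ^ degree G v))
             ≤⟨ ∑-mono {n} (λ v → *-monoˡ _ (^-nonneg (24 ℕ.* j) 0≤2)
               (≤-trans (degree-exp v) (*-monoˡ 2ℚ 0≤2 (decay m mq≤1 1≤[1+m]q (27 ℕ.* j) n h₁)))) ⟩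
           ∑ {n} (λ _ → 2ℚ ^ (24 ℕ.* j) * (2ℚ * ½ ^ (27 ℕ.* j)))
             ≡⟨ ∑-const n (2ℚ ^ (24 ℕ.* j) * (2ℚ * ½ ^ (27 ℕ.* j))) ⟩
           ι n * (2ℚ ^ (24 ℕ.* j) * (2ℚ * ½ ^ (27 ℕ.* j)))
             ≡⟨ cong (ι n *_) power ⟩
           ι n * (2ℚ * x³)
             ≤⟨ *-monoʳ (2ℚ * x³) (*-nonneg 0≤2 (^-nonneg 3 x≥0)) (ι-mono h₂) ⟩
           ι (j ℕ.* j) * (2ℚ * x³) ∎) ⟩
    ι j * (ι (j ℕ.* j) * (2ℚ * x³))
      ≡⟨ trans (cong (λ z → ι j * (z * (2ℚ * x³))) (ι-* j j)) (lem (ι j) (½ ^ j)) ⟩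
    2ℚ * (ι j * ½ ^ j) ^ 3
      ≤⟨ *-monoˡ 2ℚ 0≤2 (^-≤1 3 (*-nonneg (ι-nonneg j) x≥0) (ι*½^≤1 j)) ⟩
    2ℚ * 1ℚ ≡⟨ *-identityʳ 2ℚ ⟩
    2ℚ ∎
    where
    open ℚP.≤-Reasoning
    x≥0 = ^-nonneg j 0≤½
    x³ = (½ ^ j) ^ 3
    lem : ∀ j x → j * (j * j * (2ℚ * (x * (x * (x * 1ℚ))))) ≡ 2ℚ * (j * x * (j * x * (j * x * 1ℚ)))
    lem = solve-∀ ℚ-ring
    lem₂ : ∀ t u v → t * (2ℚ * (u * v)) ≡ (u * t) * (2ℚ * v)
    lem₂ = solve-∀ ℚ-ring
    power : 2ℚ ^ (24 ℕ.* j) * (2ℚ * ½ ^ (27 ℕ.* j)) ≡ 2ℚ * x³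
    power = trans (cong (λ z → 2ℚ ^ (24 ℕ.* j) * (2ℚ * z))
      (trans (cong (½ ^_) (ℕP.*-distribʳ-+ j 24 3)) (^-+ ½ (24 ℕ.* j) (3 ℕ.* j))))
      (trans (lem₂ (2ℚ ^ (24 ℕ.* j)) (½ ^ (24 ℕ.* j)) (½ ^ (3 ℕ.* j)))
        (trans (cong₂ (λ a b → a * (2ℚ * b)) (½*2 (24 ℕ.* j)) (^-* ½ 3 j)) (*-identityˡ _)))

  overloads-bound : 1 ℕ.≤ j → n ℕ.≤ j ℕ.* j → ι j * 𝔼 νG overloads ≤ 1ℚ
  overloads-bound h₁ h₂ = begin
    ι j * 𝔼 νG overloads
      ≤⟨ *-monoˡ (ι j) (ι-nonneg j) (begin
           𝔼 νG overloads
             ≡⟨ trans (𝔼-∑⊆ νG n (λ W G → ∑⊆ n λ B → overload m mq≤1 1≤[1+m]q j G W B)) refl ⟩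
           ∑⊆ n (λ W → 𝔼 νG λ G → ∑⊆ n λ B → overload m mq≤1 1≤[1+m]q j G W B)
             ≤⟨ ∑⊆-bound n (λ W → ≤-trans (≤-reflexive (𝔼-∑⊆ νG n (λ B G → overload m mq≤1 1≤[1+m]q j G W B)))
                  (∑⊆-bound n λ B → overload-exp m mq≤1 1≤[1+m]q j W B)) ⟩
           2ℚ ^ n * (2ℚ ^ n * ½ ^ (6 ℕ.* j ℕ.* (12 ℕ.* j)))
             ≤⟨ shrink ⟩
           ½ ^ j ∎) ⟩
    ι j * ½ ^ j
      ≤⟨ ι*½^≤1 j ⟩
    1ℚ ∎
    where
    open ℚP.≤-Reasoning
    e : ℕ
    e = 6 ℕ.* j ℕ.* (12 ℕ.* j)
    -- The exponent is 72j², of which j and the 2n for pairs of sets take at most 3j².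
    exponent : j ℕ.+ (n ℕ.+ n) ℕ.≤ e
    exponent = ℕP.≤-trans (ℕP.+-mono-≤
      (ℕP.≤-trans (ℕP.≤-reflexive (sym (ℕP.*-identityʳ j))) (ℕP.*-monoʳ-≤ j h₁)) (ℕP.+-mono-≤ h₂ h₂))
      (ℕP.≤-trans (ℕP.m≤m+n _ (69 ℕ.* (j ℕ.* j))) (ℕP.≤-reflexive (lem j)))
      where
      lem : ∀ j → j ℕ.* j ℕ.+ (j ℕ.* j ℕ.+ j ℕ.* j) ℕ.+ 69 ℕ.* (j ℕ.* j) ≡ 6 ℕ.* j ℕ.* (12 ℕ.* j)
      lem = ℕSolver.solve-∀
    lem₂ : ∀ t x y → t * (t * (x * (y * y))) ≡ x * ((y * t) * (y * t))
    lem₂ = solve-∀ ℚ-ring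
    shrink : 2ℚ ^ n * (2ℚ ^ n * ½ ^ e) ≤ ½ ^ j
    shrink = begin
      2ℚ ^ n * (2ℚ ^ n * ½ ^ e)
        ≤⟨ *-monoˡ _ (^-nonneg n 0≤2) (*-monoˡ _ (^-nonneg n 0≤2) (½^-antimono exponent)) ⟩
      2ℚ ^ n * (2ℚ ^ n * ½ ^ (j ℕ.+ (n ℕ.+ n)))
        ≡⟨ cong (λ z → 2ℚ ^ n * (2ℚ ^ n * z)) (trans (^-+ ½ j (n ℕ.+ n)) (cong (½ ^ j *_) (^-+ ½ n n))) ⟩
      2ℚ ^ n * (2ℚ ^ n * (½ ^ j * (½ ^ n * ½ ^ n)))
        ≡⟨ lem₂ (2ℚ ^ n) (½ ^ j) (½ ^ n) ⟩
      ½ ^ j * ((½ ^ n * 2ℚ ^ n) * (½ ^ n * 2ℚ ^ n))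
        ≡⟨ trans (cong (λ z → ½ ^ j * (z * z)) (½*2 n))
          (trans (cong (½ ^ j *_) (*-identityʳ 1ℚ)) (*-identityʳ (½ ^ j))) ⟩
      ½ ^ j ∎

  module _ (S : Vec Sign n) (k L : ℕ) (S>0 : spinSum S ≡ ℤ.+ suc (suc k))
           (36≤kq : ι 36 ≤ ι k * q) (kq≤L : ι (4 ℕ.+ k) * q ≤ ι L) (8nq≤L² : ι 8 * (ι n * q) ≤ ι L * ι L)
             (2≤n : 2 ℕ.≤ n) where

    E₂ : ℚ
    E₂ = 𝔼 νG (λ G → ι (size (wrong₂ S G)))

    E₂≥0 : 0ℚ ≤ E₂
    E₂≥0 = 𝔼-nonneg νG λ G → ι-nonneg (size (wrong₂ S G))

    t x : ℚ
    t = ι 3 * (ι k * q)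
    x = ι 64 * ι L

    -- Fractions are cleared; the bias is t/x, called μ₀ below. For n ≥ 2 one has 2M₀ ≥ nqμ₀, so
    -- E₂M₀² ≤ 2n²q turns into E₂qμ₀² ≤ 8.
    wrong₂-bound : E₂ * q * (t * t) ≤ ι 8 * (x * x)
    wrong₂-bound = go (inverse x 0<x)
      where
      0<L : 0ℚ ℚ.< ι L
      0<L = <-≤-trans (0<ι 35) (≤-trans 36≤kq (≤-trans (*-monoʳ q 0≤q (ι-mono (ℕP.m≤n+m k 4))) kq≤L))
      0<x = 0<* (0<ι 63) 0<L
      t≥0 : 0ℚ ≤ t
      t≥0 = *-nonneg (ι-nonneg 3) (*-nonneg (ι-nonneg k) 0≤q)
      0<n : 0ℚ ℚ.< ι n
      0<n = <-≤-trans (0<ι 1) (ι-mono 2≤n)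
      go : Σ[ i ∈ ℚ ] (0ℚ ≤ i × x * i ≡ 1ℚ) → E₂ * q * (t * t) ≤ ι 8 * (x * x)
      go (i , 0≤i , xi≡1) = begin
        E₂ * q * (t * t)
          ≡⟨ trans (sym (*-identityʳ _))
            (trans (cong (λ z → E₂ * q * (t * t) * (z * z)) (sym xi≡1)) (lem₁ E₂ q t x i)) ⟩
        (x * x) * (E₂ * q * (μ₀ * μ₀))
          ≤⟨ *-monoˡ (x * x) (square-nonneg x) cancelled ⟩
        (x * x) * ι 8
          ≡⟨ *-comm (x * x) (ι 8) ⟩
        ι 8 * (x * x) ∎
        where
        open ℚP.≤-Reasoning
        μ₀ = t * i
        μ₀≥0 : 0ℚ ≤ μ₀
        μ₀≥0 = *-nonneg t≥0 0≤i
        bias : ∀ u v → u ≢ v → μ₀ ≤ 𝔼 (iidE bern n) (λ N → sgn₂ (dot (others S u v) N))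
        bias u v u≢v = from (imbalance S u v u≢v k S>0)
          where
          Y = 𝔼 (iidE bern n) (λ N → sgn₂ (dot (others S u v) N))
          lem₂ : ∀ x y i → x * y * i ≡ x * i * y
          lem₂ = solve-∀ ℚ-ring
          from : Σ[ d ∈ ℕ ] (ups (others S u v) ≡ downs (others S u v) ℕ.+ d × k ℕ.≤ d × d ℕ.≤ suc
            (suc (suc (suc k)))) → μ₀ ≤ Y
          from (d , eq , k≤d , d≤k+4) = begin
            t * i
              ≤⟨ *-monoʳ i 0≤i (≤-trans (*-monoˡ (ι 3) (ι-nonneg 3) (*-monoʳ q 0≤q (ι-mono k≤d)))
                   (dot-bias (others S u v) d L eq (≤-trans 36≤kq (*-monoʳ q 0≤q (ι-mono k≤d)))
                     (≤-trans (*-monoʳ q 0≤q (ι-mono d≤k+4)) kq≤L)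
                     (≤-trans (*-monoˡ (ι 8) (ι-nonneg 8)
                       (*-mono (ι-nonneg (downs (others S u v))) 0≤q (ι-mono (downs≤ (others S u v))) r≤q))
                         8nq≤L²))) ⟩
            x * Y * i
              ≡⟨ trans (lem₂ x Y i) (trans (cong (_* Y) xi≡1) (*-identityˡ Y)) ⟩
            Y ∎
            where
            open Bias q 0≤q q≤1 using (dot-bias)
            r≤q : r ≤ q
            r≤q = ≤-by (*-nonneg 0≤q 0≤q) (lem q)
              where
              lem : ∀ q → q - q * (1ℚ - q) ≡ q * q
              lem = solve-∀ ℚ-ring
        M₀ : ℚ
        M₀ = ι n * (q * μ₀) - q * μ₀
        2M≥ : ι n * (q * μ₀) ≤ 2ℚ * M₀
        2M≥ = ≤-by (*-nonneg (≤⇒0≤- (ι-mono 2≤n)) (*-nonneg 0≤q μ₀≥0)) (lem (ι n) (q * μ₀))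
          where
          lem : ∀ n z → 2ℚ * (n * z - z) - n * z ≡ (n - ι 2) * z
          lem = solve-∀ ℚ-ring
        nqμ≥0 = *-nonneg (ι-nonneg n) (*-nonneg 0≤q μ₀≥0)
        M₀≥0 : 0ℚ ≤ M₀
        M₀≥0 = *-cancelˡ-≤ 2ℚ (positive⁻¹ 2ℚ) (≤-trans (≤-reflexive (*-zeroʳ 2ℚ)) (≤-trans nqμ≥0 2M≥))
        expectation : E₂ * (M₀ * M₀) ≤ ι n * (2ℚ * (ι n * q))
        expectation = SecondStep.wrong₂-expectation q 0≤q q≤1 S μ₀ μ₀≥0 bias M₀≥0
        cancelled : E₂ * q * (μ₀ * μ₀) ≤ ι 8
        cancelled = *-cancelˡ-≤ (ι n * ι n * q) (0<* (0<* 0<n 0<n) 0<q) (begin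
          ι n * ι n * q * (E₂ * q * (μ₀ * μ₀))
            ≡⟨ lem₃ (ι n) q E₂ μ₀ ⟩
          E₂ * (ι n * (q * μ₀) * (ι n * (q * μ₀)))
            ≤⟨ *-monoˡ E₂ E₂≥0 (*-mono nqμ≥0 (*-nonneg 0≤2 M₀≥0) 2M≥ 2M≥) ⟩
          E₂ * (2ℚ * M₀ * (2ℚ * M₀))
            ≡⟨ lem₄ E₂ M₀ ⟩
          2ℚ * 2ℚ * (E₂ * (M₀ * M₀))
            ≤⟨ *-monoˡ (2ℚ * 2ℚ) (*-nonneg 0≤2 0≤2) expectation ⟩
          2ℚ * 2ℚ * (ι n * (2ℚ * (ι n * q)))
            ≡⟨ lem₅ (ι n) q ⟩
          ι n * ι n * q * ι 8 ∎)
          where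
          lem₃ : ∀ n q e μ → n * n * q * (e * q * (μ * μ)) ≡ e * (n * (q * μ) * (n * (q * μ)))
          lem₃ = solve-∀ ℚ-ring
          lem₄ : ∀ e m → e * (2ℚ * m * (2ℚ * m)) ≡ 2ℚ * 2ℚ * (e * (m * m))
          lem₄ = solve-∀ ℚ-ring
          lem₅ : ∀ n q → 2ℚ * 2ℚ * (n * (2ℚ * (n * q))) ≡ n * n * q * ι 8
          lem₅ = solve-∀ ℚ-ring
        lem₁ : ∀ e q t x i → e * q * (t * t) * ((x * i) * (x * i)) ≡ (x * x) * (e * q * ((t * i) * (t * i)))
        lem₁ = solve-∀ ℚ-ring

-- Choice of the constants

opposite : Sign → Sign
opposite = Sign.opposite

value-opposite : ∀ s → value (opposite s) ≡ ℤ.- value s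
value-opposite Sign.+ = refl
value-opposite Sign.- = refl

sum-neg : ∀ {n} (f : Fin n → ℤ) → sum (λ u → ℤ.- f u) ≡ ℤ.- sum f
sum-neg {zero}  f = refl
sum-neg {suc n} f = trans (cong (λ z → ℤ.- f zero ℤ.+ z) (sum-neg λ u → f (suc u)))
  (sym (ℤP.neg-distrib-+ (f zero) _))

module _ {n} (G : Graph n) where

  step-opposite : ∀ {S S′ : State n} → (∀ v → S′ v ≡ opposite (S v)) → ∀ v → step G S′ v ≡ opposite (step G S v)
  step-opposite {S} {S′} h v = trans (cong₂ (λ s y → fromMaybe s (sgn y)) (h v) sums) (cases (neighbourSum G S v))
    where
    sums : neighbourSum G S′ v ≡ ℤ.- neighbourSum G S v
    sums = trans (sum-cong λ u → trans (cong (λ s → if adj G v u then value s else 0ℤ) (h u))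
      (flip (adj G v u) (S u)))
      (sum-neg λ u → if adj G v u then value (S u) else 0ℤ)
      where
      flip : ∀ b s → (if b then value (opposite s) else 0ℤ) ≡ ℤ.- (if b then value s else 0ℤ)
      flip true  s = value-opposite s
      flip false s = refl
    cases : ∀ y → fromMaybe (opposite (S v)) (sgn (ℤ.- y)) ≡ opposite (fromMaybe (S v) (sgn y))
    cases (ℤ.+ zero)  = refl
    cases (ℤ.+ suc _) = refl
    cases -[1+ _ ]    = refl

  majority-opposite : ∀ {S S′ : State n} → (∀ v → S′ v ≡ opposite (S v)) → ∀ t v → majority G S′ t v ≡ opposite
    (majority G S t v)
  majority-opposite h zero    = h
  majority-opposite h (suc t) = step-opposite (majority-opposite h t)

flipSpins : ∀ {n} → Vec Sign n → Vec Sign n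
flipSpins = Vec.map opposite

spinSum-flip : ∀ {n} (S : Vec Sign n) → spinSum (flipSpins S) ≡ ℤ.- spinSum S
spinSum-flip S = trans (sum-cong λ u → trans (cong value (VecP.lookup-map u opposite S))
  (value-opposite (lookup S u))) (sum-neg λ u → value (lookup S u))

opposite-involutive : ∀ s → opposite (opposite s) ≡ s
opposite-involutive Sign.+ = refl
opposite-involutive Sign.- = refl

-- Majority dynamics commutes with flipping all spins, ties included; this reduces negative initial
-- sums to positive ones.
unanimous-flip : ∀ {n} t (G : Graph n) S → UnanimousAfter t (G , flipSpins S) → UnanimousAfter t (G , S)
unanimous-flip t G S h v = trans
  (cong just (sym (trans (cong opposite (majority-opposite G (λ v → VecP.lookup-map v opposite S) t v))
    (opposite-involutive _))))
  (transfer (spinSum S) (trans (h v) (cong sgn (spinSum-flip S))))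
  where
  transfer : ∀ {s} y → just s ≡ sgn (ℤ.- y) → just (opposite s) ≡ sgn y
  transfer (ℤ.+ suc _) refl = refl
  transfer -[1+ _ ]    refl = refl

ind-mono : ∀ {P Q : Set} (d : Dec P) (e : Dec Q) → (P → Q) → ind d ≤ ind e
ind-mono (yes p) (yes q) f = ≤-refl
ind-mono (yes p) (no ¬q) f = ⊥-elim (¬q (f p))
ind-mono (no _)  e       f = ind-nonneg e

signs-swap : ∀ {A} (μ : Expectation A) n (f : A → Vec Sign n → ℚ) →
  𝔼 μ (λ a → 𝔼 (signsE n) (f a)) ≡ 𝔼 (signsE n) λ S → 𝔼 μ λ a → f a S
signs-swap μ zero    f = refl
signs-swap μ (suc n) f = trans (𝔼-+ μ (λ a → ½ * X Sign.+ a) (λ a → ½ * X Sign.- a))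
  (cong₂ _+_ (half Sign.+) (half Sign.-))
  where
  X : Sign → _ → ℚ
  X s a = 𝔼 (signsE n) λ S → f a (s ∷ S)
  half : ∀ s → 𝔼 μ (λ a → ½ * X s a) ≡ ½ * 𝔼 (signsE n) λ S → 𝔼 μ λ a → f a (s ∷ S)
  half s = trans (𝔼-*ˡ μ ½ (X s)) (cong (½ *_) (signs-swap μ n λ a S → f a (s ∷ S)))

-- Abstract, so that no unary numeral as large as 2³³ is ever computed.
abstract
  scale : (a b c d : ℕ) → ℕ
  scale a b c d = a ℕ.* (b ℕ.* b) ℕ.* (c ℕ.* c) ℕ.* (d ℕ.* d)

  ι-scale : ∀ a b c d → ι (scale a b c d) ≡ ι a * (ι b * ι b) * (ι c * ι c) * (ι d * ι d)
  ι-scale a b c d = trans (ι-* (a ℕ.* (b ℕ.* b) ℕ.* (c ℕ.* c)) (d ℕ.* d))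
    (cong₂ _*_ (trans (ι-* (a ℕ.* (b ℕ.* b)) (c ℕ.* c))
        (cong₂ _*_ (trans (ι-* a (b ℕ.* b)) (cong (ι a *_) (ι-* b b))) (ι-* c c)))
      (ι-* d d))

-- The losses collected: 8 from `wrong₂-bound`, 64² from `walk-bias`, 32² from `l²≤1024a²νq` and 16²
-- from `ν≤256a²κ²`.
Π : ℕ
Π = scale 8 64 32 16

ι-Π : ι Π ≡ ι 8 * (ι 64 * ι 64) * (ι 32 * ι 32) * (ι 16 * ι 16)
ι-Π = ι-scale 8 64 32 16

0<Π : 0ℚ ℚ.< ι Π
0<Π = subst (0ℚ ℚ.<_) (sym ι-Π)
  (0<* (0<* (0<* (0<ι 7) (0<* (0<ι 63) (0<ι 63))) (0<* (0<ι 31) (0<ι 31))) (0<* (0<ι 15) (0<ι 15)))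

N²·N²·N : ℕ → ℕ
N²·N²·N N = N ℕ.* N ℕ.* (N ℕ.* N) ℕ.* N

abstract
  -- A sum in place of a maximum: each summand is a separate demand on nq².
  combine : (a b c N : ℕ) → ℕ
  combine a b c N = a ℕ.* a ℕ.+ (b ℕ.* b ℕ.* (N ℕ.* N) ℕ.+ c ℕ.* N²·N²·N N)

  combine≥₁ : ∀ a b c N → a ℕ.* a ℕ.≤ combine a b c N
  combine≥₁ a b c N = ℕP.m≤m+n (a ℕ.* a) _

  combine≥₂ : ∀ a b c N → b ℕ.* b ℕ.* (N ℕ.* N) ℕ.≤ combine a b c N
  combine≥₂ a b c N = ℕP.≤-trans (ℕP.m≤m+n _ (c ℕ.* N²·N²·N N)) (ℕP.m≤n+m _ (a ℕ.* a))

  combine≥₃ : ∀ a b c N → c ℕ.* N²·N²·N N ℕ.≤ combine a b c N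
  combine≥₃ a b c N = ℕP.≤-trans (ℕP.m≤n+m _ (b ℕ.* b ℕ.* (N ℕ.* N))) (ℕP.m≤n+m _ (a ℕ.* a))

-- A lower bound for nq² that suffices to make each failure probability at most a constant over N.
threshold : ℕ → ℕ
threshold N = combine 216 576 (192 ℕ.* Π) N

-- Estimates for a typical initial state

module Estimate (N : ℕ) (1≤N : 1 ℕ.≤ N) (q : ℚ) (0<q : 0ℚ ℚ.< q) (q≤1 : q ≤ 1ℚ)
                (m : ℕ) (mq≤1 : ι m * q ≤ 1ℚ) (1≤[1+m]q : 1ℚ ≤ ι (suc m) * q) (1≤m : 1 ℕ.≤ m)
                (j n s ℓ : ℕ)
                (108jm≤n : 108 ℕ.* (j ℕ.* m) ℕ.≤ n) (n≤216jm : n ℕ.≤ 216 ℕ.* (j ℕ.* m))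
                (n≤j² : n ℕ.≤ j ℕ.* j) (24N≤j : 24 ℕ.* N ℕ.≤ j)
                (s²≤n : s ℕ.* s ℕ.≤ n) (n≤[1+s]² : n ℕ.≤ suc s ℕ.* suc s) (1≤s : 1 ℕ.≤ s)
                (s<4N[1+ℓ] : suc s ℕ.≤ 4 ℕ.* N ℕ.* suc ℓ) (4≤ℓ : 4 ℕ.≤ ℓ)
                (Λ≤q²n : ι (threshold N) ≤ q * q * ι n) where

  open Bounds q 0<q q≤1 m mq≤1 1≤[1+m]q j n
  open Failure q 0≤q q≤1 m mq≤1 1≤[1+m]q j

  a ν : ℚ
  a = ι N
  ν = ι n

  1≤a : 1ℚ ≤ a
  1≤a = ι-mono {1} 1≤N

  0<a : 0ℚ ℚ.< a
  0<a = <-≤-trans (positive⁻¹ 1ℚ) 1≤a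

  -- The walk is measured at the scale `L` = ⌊√X⌋ + 1. `X` is at least 64N²nq, which dominates the
  -- squared drift, at most (8Nsq)², and 8nq; it is also at most a multiple of N²nq, so that the
  -- bias keeps the order √q.
  X : ℕ
  X = 64 ℕ.* (N ℕ.* N) ℕ.* (216 ℕ.* j)

  ι-X : ι X ≡ ι 64 * (a * a) * (ι 216 * ι j)
  ι-X = trans (ι-* (64 ℕ.* (N ℕ.* N)) (216 ℕ.* j))
    (cong₂ _*_ (trans (ι-* 64 (N ℕ.* N)) (cong (ι 64 *_) (ι-* N N))) (ι-* 216 j))

  1≤j : 1 ℕ.≤ j
  1≤j = ℕP.≤-trans 1≤N (ℕP.≤-trans (ℕP.m≤n*m N 24) 24N≤j)

  1≤X : 1 ℕ.≤ X
  1≤X = ℕP.*-mono-≤ {1} {64 ℕ.* (N ℕ.* N)} {1} {216 ℕ.* j}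
    (ℕP.*-mono-≤ {1} {64} {1} {N ℕ.* N} (ℕ.s≤s ℕ.z≤n) (ℕP.*-mono-≤ 1≤N 1≤N))
      (ℕP.*-mono-≤ {1} {216} {1} {j} (ℕ.s≤s ℕ.z≤n) 1≤j)

  r : ℕ
  r = proj₁ (isqrt X)

  r²≤X : r ℕ.* r ℕ.≤ X
  r²≤X = proj₁ (proj₂ (isqrt X))

  L : ℕ
  L = suc r

  X<L² : X < L ℕ.* L
  X<L² = proj₂ (proj₂ (isqrt X))

  1≤r : 1 ℕ.≤ r
  1≤r with r | X<L²
  ... | zero  | X<1 = ⊥-elim (ℕP.<⇒≱ X<1 1≤X)
  ... | suc _ | _   = ℕ.s≤s ℕ.z≤n

  l : ℚ
  l = ι L

  νq≤216j : ν * q ≤ ι 216 * ι j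
  νq≤216j = begin
    ν * q                             ≤⟨ *-monoʳ q 0≤q (ι-mono n≤216jm) ⟩
    ι (216 ℕ.* (j ℕ.* m)) * q         ≡⟨ trans
      (cong (_* q) (trans (ι-* 216 (j ℕ.* m)) (cong (ι 216 *_) (ι-* j m)))) (lem (ι j) (ι m) q) ⟩
    ι 216 * ι j * (ι m * q)           ≤⟨ *-monoˡ (ι 216 * ι j) (*-nonneg (ι-nonneg 216) (ι-nonneg j)) mq≤1 ⟩
    ι 216 * ι j * 1ℚ                  ≡⟨ *-identityʳ (ι 216 * ι j) ⟩
    ι 216 * ι j ∎
    where
    open ℚP.≤-Reasoning
    lem : ∀ j m q → ι 216 * (j * m) * q ≡ ι 216 * j * (m * q)
    lem = solve-∀ ℚ-ring

  216j≤4νq : ι 216 * ι j ≤ ι 4 * (ν * q)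
  216j≤4νq = begin
    ι 216 * ι j                       ≡⟨ *-identityʳ (ι 216 * ι j) ⟨
    ι 216 * ι j * 1ℚ                  ≤⟨ *-monoˡ (ι 216 * ι j) (*-nonneg (ι-nonneg 216) (ι-nonneg j)) 1≤2mq ⟩
    ι 216 * ι j * (2ℚ * (ι m * q))    ≡⟨ lem (ι j) (ι m) q ⟩
    ι 4 * (ι 108 * (ι j * ι m) * q)   ≡⟨ cong (λ z → ι 4 * (z * q))
      (sym (trans (ι-* 108 (j ℕ.* m)) (cong (ι 108 *_) (ι-* j m)))) ⟩
    ι 4 * (ι (108 ℕ.* (j ℕ.* m)) * q) ≤⟨ *-monoˡ (ι 4) (ι-nonneg 4) (*-monoʳ q 0≤q (ι-mono 108jm≤n)) ⟩
    ι 4 * (ν * q) ∎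
    where
    open ℚP.≤-Reasoning
    lem : ∀ j m q → ι 216 * j * (2ℚ * (m * q)) ≡ ι 4 * (ι 108 * (j * m) * q)
    lem = solve-∀ ℚ-ring
    lem₂ : ∀ m q → 2ℚ * (m * q) - (1ℚ + m) * q ≡ (m - 1ℚ) * q
    lem₂ = solve-∀ ℚ-ring
    1≤2mq : 1ℚ ≤ 2ℚ * (ι m * q)
    1≤2mq = ≤-trans 1≤[1+m]q (≤-by (*-nonneg (≤⇒0≤- (ι-mono {1} 1≤m)) 0≤q) (lem₂ (ι m) q))

  a²≥0 : 0ℚ ≤ a * a
  a²≥0 = square-nonneg a

  64a²νq≤l² : ι 64 * (a * a) * (ν * q) ≤ l * l
  64a²νq≤l² = begin
    ι 64 * (a * a) * (ν * q)         ≤⟨ *-monoˡ (ι 64 * (a * a)) (*-nonneg (ι-nonneg 64) a²≥0) νq≤216j ⟩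
    ι 64 * (a * a) * (ι 216 * ι j)   ≡⟨ ι-X ⟨
    ι X                              ≤⟨ ι-mono (ℕP.<⇒≤ X<L²) ⟩
    ι (L ℕ.* L)                      ≡⟨ ι-* L L ⟩
    l * l ∎
    where open ℚP.≤-Reasoning

  l²≤1024a²νq : l * l ≤ ι 32 * ι 32 * (a * a) * (ν * q)
  l²≤1024a²νq = begin
    l * l
      ≤⟨ ≤-by (+-nonneg (*-nonneg (ι-nonneg 2) (*-nonneg (ι-nonneg r) (≤⇒0≤- 1≤ιr)))
        (+-nonneg (*-nonneg (≤⇒0≤- 1≤ιr) (ι-nonneg r)) (≤⇒0≤- 1≤ιr))) (lem (ι r)) ⟩
    ι 4 * (ι r * ι r)
      ≤⟨ *-monoˡ (ι 4) (ι-nonneg 4) (subst (_≤ ι X) (ι-* r r) (ι-mono r²≤X)) ⟩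
    ι 4 * ι X
      ≡⟨ cong (ι 4 *_) ι-X ⟩
    ι 4 * (ι 64 * (a * a) * (ι 216 * ι j))
      ≤⟨ *-monoˡ (ι 4) (ι-nonneg 4) (*-monoˡ (ι 64 * (a * a)) (*-nonneg (ι-nonneg 64) a²≥0) 216j≤4νq) ⟩
    ι 4 * (ι 64 * (a * a) * (ι 4 * (ν * q)))
      ≡⟨ lem₂ (a * a) (ν * q) ⟩
    ι 32 * ι 32 * (a * a) * (ν * q) ∎
    where
    open ℚP.≤-Reasoning
    1≤ιr : 1ℚ ≤ ι r
    1≤ιr = ι-mono {1} 1≤r
    lem : ∀ r → ι 4 * (r * r) - (1ℚ + r) * (1ℚ + r) ≡ ι 2 * (r * (r - 1ℚ)) + ((r - 1ℚ) * r + (r - 1ℚ))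
    lem = solve-∀ ℚ-ring
    lem₂ : ∀ a n → ι 4 * (ι 64 * a * (ι 4 * n)) ≡ ι 32 * ι 32 * a * n
    lem₂ = solve-∀ ℚ-ring

  -- 576 = 16·36: together with n ≤ (16Nk)² this forces kq ≥ 36.
  threshold₂ : ι 576 * ι 576 * (a * a) ≤ q * q * ν
  threshold₂ = ≤-trans (≤-trans (≤-reflexive (sym (lem 576 N))) (ι-mono (combine≥₂ 216 576 (192 ℕ.* Π) N))) Λ≤q²n
    where
    lem : ∀ b N → ι (b ℕ.* b ℕ.* (N ℕ.* N)) ≡ ι b * ι b * (ι N * ι N)
    lem b N = trans (ι-* (b ℕ.* b) (N ℕ.* N)) (cong₂ _*_ (ι-* b b) (ι-* N N))

  -- 192 = 216·8/9, with 216 from n ≤ 216jm, 8 from the share 1/(8N) of the failure probability and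
  -- 9 from the square of the 3 in `walk-bias`.
  threshold₃ : ι 192 * ι Π * (a * a * (a * a) * a) ≤ q * q * ν
  threshold₃ = ≤-trans (≤-trans (≤-reflexive (sym (lem 192 Π N))) (ι-mono (combine≥₃ 216 576 (192 ℕ.* Π) N))) Λ≤q²n
    where
    lem : ∀ c P N → ι (c ℕ.* P ℕ.* N²·N²·N N) ≡ ι c * ι P * (ι N * ι N * (ι N * ι N) * ι N)
    lem c P N = trans (ι-* (c ℕ.* P) (N²·N²·N N)) (cong₂ _*_ (ι-* c P)
      (trans (ι-* (N ℕ.* N ℕ.* (N ℕ.* N)) N)
        (cong (_* ι N) (trans (ι-* (N ℕ.* N) (N ℕ.* N)) (cong₂ _*_ (ι-* N N) (ι-* N N))))))

  module _ (S : Vec Sign n) (k : ℕ) (S>0 : spinSum S ≡ ℤ.+ suc (suc k))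
           (ℓ≤S : ℓ ℕ.≤ suc (suc k)) (S<K : suc (suc k) < 2 ℕ.* N ℕ.* suc s) where

    κ : ℚ
    κ = ι k

    2≤k : 2 ℕ.≤ k
    2≤k = ℕP.≤-pred (ℕP.≤-pred (ℕP.≤-trans 4≤ℓ ℓ≤S))

    1+s≤16Nk : suc s ℕ.≤ 16 ℕ.* (N ℕ.* k)
    1+s≤16Nk = ℕP.≤-trans s<4N[1+ℓ]
      (ℕP.≤-trans (ℕP.*-monoʳ-≤ (4 ℕ.* N) (ℕP.≤-trans (ℕ.s≤s ℓ≤S) 3+k≤4k)) (ℕP.≤-reflexive (lem N k)))
      where
      lem : ∀ N k → 4 ℕ.* N ℕ.* (4 ℕ.* k) ≡ 16 ℕ.* (N ℕ.* k)
      lem = ℕSolver.solve-∀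
      3+k≤4k : 3 ℕ.+ k ℕ.≤ 4 ℕ.* k
      3+k≤4k = ℕP.≤-trans (ℕP.+-monoˡ-≤ k {3} {3 ℕ.* k} (ℕP.*-monoʳ-≤ 3 (ℕP.≤-trans (ℕ.s≤s ℕ.z≤n) 2≤k)))
        (ℕP.≤-reflexive (ℕP.+-comm (3 ℕ.* k) k))

    ν≤256a²κ² : ν ≤ ι 16 * ι 16 * (a * a) * (κ * κ)
    ν≤256a²κ² = ≤-trans (ι-mono (ℕP.≤-trans n≤[1+s]² (ℕP.*-mono-≤ 1+s≤16Nk 1+s≤16Nk)))
      (≤-reflexive (trans (ι-* (16 ℕ.* (N ℕ.* k)) (16 ℕ.* (N ℕ.* k)))
        (trans (cong (λ z → z * z) (trans (ι-* 16 (N ℕ.* k)) (cong (ι 16 *_) (ι-* N k)))) (lem a κ))))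
      where
      lem : ∀ a k → ι 16 * (a * k) * (ι 16 * (a * k)) ≡ ι 16 * ι 16 * (a * a) * (k * k)
      lem = solve-∀ ℚ-ring

    4+k≤8Ns : 4 ℕ.+ k ℕ.≤ 8 ℕ.* (N ℕ.* s)
    4+k≤8Ns = ℕP.≤-trans (ℕ.s≤s S<K)
      (ℕP.≤-trans (ℕP.+-monoˡ-≤ (2 ℕ.* N ℕ.* suc s)
        (ℕP.*-mono-≤ {1} {2 ℕ.* N} {1} {suc s} (ℕP.≤-trans 1≤N (ℕP.m≤n*m N 2)) (ℕ.s≤s ℕ.z≤n)))
      (ℕP.≤-trans (ℕP.≤-reflexive (lem N s))
        (ℕP.≤-trans (ℕP.+-monoʳ-≤ (4 ℕ.* (N ℕ.* s))
          (ℕP.*-monoʳ-≤ 4 (ℕP.≤-trans (ℕP.≤-reflexive (sym (ℕP.*-identityʳ N))) (ℕP.*-monoʳ-≤ N 1≤s))))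
            (ℕP.≤-reflexive (lem₂ (N ℕ.* s))))))
      where
      lem : ∀ N s → 2 ℕ.* N ℕ.* suc s ℕ.+ 2 ℕ.* N ℕ.* suc s ≡ 4 ℕ.* (N ℕ.* s) ℕ.+ 4 ℕ.* N
      lem = ℕSolver.solve-∀
      lem₂ : ∀ x → 4 ℕ.* x ℕ.+ 4 ℕ.* x ≡ 8 ℕ.* x
      lem₂ = ℕSolver.solve-∀

    36≤κq : ι 36 ≤ κ * q
    36≤κq = square-cancel-≤ (*-nonneg (ι-nonneg k) 0≤q)
      (*-cancelˡ-≤ (ι 16 * ι 16 * (a * a)) (0<* (0<* (0<ι 15) (0<ι 15)) (0<* 0<a 0<a)) (begin
      ι 16 * ι 16 * (a * a) * (ι 36 * ι 36)
        ≡⟨ lem a ⟩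
      ι 576 * ι 576 * (a * a)
        ≤⟨ threshold₂ ⟩
      q * q * ν
        ≤⟨ *-monoˡ (q * q) (square-nonneg q) ν≤256a²κ² ⟩
      q * q * (ι 16 * ι 16 * (a * a) * (κ * κ))
        ≡⟨ lem₂ q a κ ⟩
      ι 16 * ι 16 * (a * a) * (κ * q * (κ * q)) ∎))
      where
      open ℚP.≤-Reasoning
      lem : ∀ a → ι 16 * ι 16 * (a * a) * (ι 36 * ι 36) ≡ ι 576 * ι 576 * (a * a)
      lem = solve-∀ ℚ-ring
      lem₂ : ∀ q a k → q * q * (ι 16 * ι 16 * (a * a) * (k * k)) ≡ ι 16 * ι 16 * (a * a) * (k * q * (k * q))
      lem₂ = solve-∀ ℚ-ring

    [4+k]q≤l : ι (4 ℕ.+ k) * q ≤ l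
    [4+k]q≤l = square-cancel-≤ (ι-nonneg L) (begin
      ι (4 ℕ.+ k) * q * (ι (4 ℕ.+ k) * q)
        ≤⟨ *-mono (*-nonneg (ι-nonneg (4 ℕ.+ k)) 0≤q) (*-nonneg (ι-nonneg (8 ℕ.* (N ℕ.* s))) 0≤q)
          (*-monoʳ q 0≤q (ι-mono 4+k≤8Ns)) (*-monoʳ q 0≤q (ι-mono 4+k≤8Ns)) ⟩
      ι (8 ℕ.* (N ℕ.* s)) * q * (ι (8 ℕ.* (N ℕ.* s)) * q)
        ≡⟨ trans (cong (λ z → z * q * (z * q)) (trans (ι-* 8 (N ℕ.* s)) (cong (ι 8 *_) (ι-* N s)))) (lem a (ι s) q) ⟩
      ι 64 * (a * a) * (ι s * ι s * (q * q))
        ≤⟨ *-monoˡ (ι 64 * (a * a)) (*-nonneg (ι-nonneg 64) a²≥0)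
          (*-mono (square-nonneg (ι s)) 0≤q (subst (_≤ ν) (ι-* s s) (ι-mono s²≤n)) q²≤q) ⟩
      ι 64 * (a * a) * (ν * q)
        ≤⟨ 64a²νq≤l² ⟩
      l * l ∎)
      where
      open ℚP.≤-Reasoning
      q²≤q : q * q ≤ q
      q²≤q = ≤-trans (*-monoˡ q 0≤q q≤1) (≤-reflexive (*-identityʳ q))
      lem : ∀ a s q → ι 8 * (a * s) * q * (ι 8 * (a * s) * q) ≡ ι 64 * (a * a) * (s * s * (q * q))
      lem = solve-∀ ℚ-ring

    8νq≤l² : ι 8 * (ν * q) ≤ l * l
    8νq≤l² = ≤-trans (≤-by (*-nonneg (*-nonneg (ι-nonneg n) 0≤q)
        (+-nonneg (*-nonneg (ι-nonneg 64) (≤⇒0≤- (*-mono 0≤1 (ι-nonneg N) 1≤a 1≤a))) (ι-nonneg 56))) (lem a (ν * q)))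
      64a²νq≤l²
      where
      lem : ∀ a x → ι 64 * (a * a) * x - ι 8 * x ≡ x * (ι 64 * (a * a - 1ℚ * 1ℚ) + ι 56)
      lem = solve-∀ ℚ-ring

    2≤n : 2 ℕ.≤ n
    2≤n = ℕP.≤-trans (ℕP.≤-trans (ℕP.≤-trans (ℕP.m≤n*m 2 12) (ℕP.*-monoʳ-≤ 24 1≤N)) 24N≤j)
      (ℕP.≤-trans (ℕP.≤-trans (ℕP.≤-trans (ℕP.≤-reflexive (sym (ℕP.*-identityʳ j))) (ℕP.*-monoʳ-≤ j 1≤m))
        (ℕP.m≤n*m (j ℕ.* m) 108)) 108jm≤n)

    e : ℚ
    e = E₂ S k L S>0 36≤κq [4+k]q≤l 8νq≤l² 2≤n

    e≥0 : 0ℚ ≤ e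
    e≥0 = E₂≥0 S k L S>0 36≤κq [4+k]q≤l 8νq≤l² 2≤n

    0<κ : 0ℚ ℚ.< κ
    0<κ = <-≤-trans (0<ι 1) (ι-mono 2≤k)

    -- L² is at most a multiple of N²nq, and n at most one of N²k². So k²q cancels, and the expected
    -- number of wrong vertices is O(N⁴/q²) with no n in it.
    9eq²≤Πa⁴ : ι 9 * (e * (q * q)) ≤ ι Π * (a * a * (a * a))
    9eq²≤Πa⁴ = *-cancelˡ-≤ (κ * κ * q) (0<* (0<* 0<κ 0<κ) 0<q) (begin
      κ * κ * q * (ι 9 * (e * (q * q)))
        ≡⟨ lem₁ κ q e ⟩
      e * q * (ι 3 * (κ * q) * (ι 3 * (κ * q)))
        ≤⟨ wrong₂-bound S k L S>0 36≤κq [4+k]q≤l 8νq≤l² 2≤n ⟩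
      ι 8 * (ι 64 * l * (ι 64 * l))
        ≡⟨ lem₂ l ⟩
      ι 8 * (ι 64 * ι 64) * (l * l)
        ≤⟨ *-monoˡ (ι 8 * (ι 64 * ι 64)) (*-nonneg (ι-nonneg 8) (*-nonneg (ι-nonneg 64) (ι-nonneg 64)))
          (≤-trans l²≤1024a²νq
             (*-monoˡ (ι 32 * ι 32 * (a * a)) (*-nonneg (*-nonneg (ι-nonneg 32) (ι-nonneg 32)) a²≥0)
               (*-monoʳ q 0≤q ν≤256a²κ²))) ⟩
      ι 8 * (ι 64 * ι 64) * (ι 32 * ι 32 * (a * a) * (ι 16 * ι 16 * (a * a) * (κ * κ) * q))
        ≡⟨ lem₃ (ι 8 * (ι 64 * ι 64)) (ι 32 * ι 32) (ι 16 * ι 16) (a * a) κ q ⟩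
      κ * κ * q * (ι 8 * (ι 64 * ι 64) * (ι 32 * ι 32) * (ι 16 * ι 16) * (a * a * (a * a)))
        ≡⟨ cong (λ z → κ * κ * q * (z * (a * a * (a * a)))) ι-Π ⟨
      κ * κ * q * (ι Π * (a * a * (a * a))) ∎)
      where
      open ℚP.≤-Reasoning
      lem₁ : ∀ k q e → k * k * q * (ι 9 * (e * (q * q))) ≡ e * q * (ι 3 * (k * q) * (ι 3 * (k * q)))
      lem₁ = solve-∀ ℚ-ring
      lem₂ : ∀ l → ι 8 * (ι 64 * l * (ι 64 * l)) ≡ ι 8 * (ι 64 * ι 64) * (l * l)
      lem₂ = solve-∀ ℚ-ring
      lem₃ : ∀ u v w a k q → u * (v * a * (w * a * (k * k) * q)) ≡ k * k * q * (u * v * w * (a * a))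
      lem₃ = solve-∀ ℚ-ring

    module _ (c : ℚ) (0≤c : 0ℚ ≤ c) (bc≡1 : ι (suc (m ℕ.* j)) * c ≡ 1ℚ) where

      -- Markov's inequality for more than mj wrong vertices: c = 1/(mj + 1) is at most 216/n, so a
      -- count of O(N⁴/q²) is harmless once nq² is a large multiple of N⁵.
      ec-bound : ι 8 * (a * (e * c)) ≤ 1ℚ
      ec-bound = *-cancelˡ-≤ (ι 216 * (ι Π * a⁴)) (0<* (0<ι 215) (0<* 0<Π (0<* (0<* 0<a 0<a) (0<* 0<a 0<a)))) (begin
        ι 216 * (ι Π * a⁴) * (ι 8 * (a * (e * c)))
          ≡⟨ lem₁ (ι Π) a⁴ a (e * c) ⟩
        ι 9 * (e * c) * (ι 192 * ι Π * (a⁴ * a))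
          ≤⟨ *-monoˡ (ι 9 * (e * c)) (*-nonneg (ι-nonneg 9) (*-nonneg e≥0 0≤c)) threshold₃ ⟩
        ι 9 * (e * c) * (q * q * ν)
          ≤⟨ *-monoˡ (ι 9 * (e * c)) (*-nonneg (ι-nonneg 9) (*-nonneg e≥0 0≤c))
            (*-monoˡ (q * q) (square-nonneg q) ν≤) ⟩
        ι 9 * (e * c) * (q * q * (ι 216 * b))
          ≡⟨ trans (lem₂ e c q b) (cong (λ z → ι 216 * (ι 9 * (e * (q * q))) * z) bc≡1) ⟩
        ι 216 * (ι 9 * (e * (q * q))) * 1ℚ
          ≡⟨ *-identityʳ (ι 216 * (ι 9 * (e * (q * q)))) ⟩
        ι 216 * (ι 9 * (e * (q * q)))
          ≤⟨ *-monoˡ (ι 216) (ι-nonneg 216) 9eq²≤Πa⁴ ⟩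
        ι 216 * (ι Π * a⁴)
          ≡⟨ *-identityʳ (ι 216 * (ι Π * a⁴)) ⟨
        ι 216 * (ι Π * a⁴) * 1ℚ ∎)
        where
        open ℚP.≤-Reasoning
        a⁴ = a * a * (a * a)
        b = ι (suc (m ℕ.* j))
        ν≤ : ν ≤ ι 216 * b
        ν≤ = ≤-trans (ι-mono (ℕP.≤-trans n≤216jm
          (ℕP.*-monoʳ-≤ 216 (ℕP.≤-trans (ℕP.≤-reflexive (ℕP.*-comm j m)) (ℕP.n≤1+n (m ℕ.* j))))))
            (≤-reflexive (ι-* 216 (suc (m ℕ.* j))))
        lem₁ : ∀ p b a z → ι 216 * (p * b) * (ι 8 * (a * z)) ≡ ι 9 * z * (ι 192 * p * (b * a))
        lem₁ = solve-∀ ℚ-ring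
        lem₂ : ∀ e c q b → ι 9 * (e * c) * (q * q * (ι 216 * b)) ≡ ι 216 * (ι 9 * (e * (q * q))) * (b * c)
        lem₂ = solve-∀ ℚ-ring

      -- The budget is 1/(8N) for too many wrong vertices after two steps and 3/(24N) for low
      -- degrees and overloads together.
      good-positive : ι 4 * (a * (1ℚ - 𝔼 νG λ G → ind (unanimousAfter? 4 (G , S)))) ≤ 1ℚ
      good-positive = ≤-by (+-nonneg (*-nonneg (*-nonneg (ι-nonneg 4) (ι-nonneg N)) (≤⇒0≤- failures))
            (+-nonneg (*-nonneg 0≤½ (≤⇒0≤- ec-bound)) (*-nonneg (*-nonneg 0≤½ inv3≥0) (≤⇒0≤- exceptional))))
          (lem a I (e * c) Y Z)
        where
        open ℚP.≤-Reasoning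
        inv3 = ℤ.+ 1 ℚ./ 3
        inv3≥0 : 0ℚ ≤ inv3
        inv3≥0 = nonNegative⁻¹ inv3
        I = 𝔼 νG λ G → ind (unanimousAfter? 4 (G , S))
        Y = 𝔼 νG lowDegrees
        Z = 𝔼 νG overloads
        failures : 1ℚ ≤ I + (e * c + (Y + Z))
        failures = begin
          1ℚ ≡⟨ 𝔼-1 νG ⟨
          𝔼 νG (λ _ → 1ℚ)
            ≤⟨ 𝔼-mono νG (λ G → failure G S (suc k) c 0≤c (≤-reflexive (sym bc≡1)) S>0) ⟩
          𝔼 νG (λ G → ind (unanimousAfter? 4 (G , S)) + (ι (size (wrong₂ S G)) * c + (lowDegrees G + overloads G)))
            ≡⟨ trans (𝔼-+ νG (λ G → ind (unanimousAfter? 4 (G , S)))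
              (λ G → ι (size (wrong₂ S G)) * c + (lowDegrees G + overloads G)))
                 (cong (I +_) (trans (𝔼-+ νG (λ G → ι (size (wrong₂ S G)) * c) (λ G → lowDegrees G + overloads G))
                   (cong₂ _+_ (trans (trans (𝔼-cong νG λ G → *-comm (ι (size (wrong₂ S G))) c)
                     (𝔼-*ˡ νG c λ G → ι (size (wrong₂ S G)))) (*-comm c e))
                              (𝔼-+ νG lowDegrees overloads)))) ⟩
          I + (e * c + (Y + Z)) ∎
        Y≥0 : 0ℚ ≤ Y
        Y≥0 = 𝔼-nonneg νG λ G → ∑-nonneg λ v → *-nonneg (^-nonneg (24 ℕ.* j) 0≤2)
          (^-nonneg (Exponential.degree q 0≤q q≤1 G v) 0≤½)
        Z≥0 : 0ℚ ≤ Z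
        Z≥0 = 𝔼-nonneg νG λ G → ∑⊆-nonneg n λ W → ∑⊆-nonneg n λ B → Exponential.overload-nonneg q 0≤q q≤1 m mq≤1
          1≤[1+m]q j G W B
        -- 108 = 27·4, since 2(m + 1) ≤ 4m.
        spacing : 27 ℕ.* j ℕ.* (2 ℕ.* suc m) ℕ.≤ n
        spacing = ℕP.≤-trans (ℕP.*-monoʳ-≤ (27 ℕ.* j)
          (ℕP.*-monoʳ-≤ 2 (ℕP.≤-trans (ℕP.+-monoˡ-≤ m 1≤m) (ℕP.≤-reflexive (lem₂ m)))))
          (ℕP.≤-trans (ℕP.≤-reflexive (lem₃ j m)) 108jm≤n)
          where
          lem₂ : ∀ m → m ℕ.+ m ≡ 2 ℕ.* m
          lem₂ = ℕSolver.solve-∀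
          lem₃ : ∀ j m → 27 ℕ.* j ℕ.* (2 ℕ.* (2 ℕ.* m)) ≡ 108 ℕ.* (j ℕ.* m)
          lem₃ = ℕSolver.solve-∀
        exceptional : ι 24 * a * (Y + Z) ≤ ι 3
        exceptional = begin
          ι 24 * a * (Y + Z)
            ≤⟨ *-monoʳ (Y + Z) (+-nonneg Y≥0 Z≥0) (subst (_≤ ι j) (ι-* 24 N) (ι-mono 24N≤j)) ⟩
          ι j * (Y + Z)
            ≡⟨ *-distribˡ-+ (ι j) Y Z ⟩
          ι j * Y + ι j * Z
            ≤⟨ +-mono-≤ (lowDegrees-bound spacing n≤j²) (overloads-bound 1≤j n≤j²) ⟩
          2ℚ + 1ℚ
            ≡⟨⟩
          ι 3 ∎
        lem : ∀ a i x y z → 1ℚ - ι 4 * (a * (1ℚ - i)) ≡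
          ι 4 * a * (i + (x + (y + z)) - 1ℚ) +
            (½ * (1ℚ - ι 8 * (a * x)) + ½ * (ℤ.+ 1 ℚ./ 3) * (ι 3 - ι 24 * a * (y + z)))
        lem = solve-∀ ℚ-ring

divide : ∀ n d → 1 ℕ.≤ d → Σ[ k ∈ ℕ ] (k ℕ.* d ℕ.≤ n × n < suc k ℕ.* d)
divide n d@(suc _) _ = n ℕ./ d , ℕD.m/n*n≤m n d ,
  subst (_< suc (n ℕ./ d) ℕ.* d) (sym (ℕD.m≡m%n+[m/n]*n n d)) (ℕP.+-monoˡ-< (n ℕ./ d ℕ.* d) (ℕD.m%n<n n d))

square-cancel-<ℕ : ∀ {x y} → x ℕ.* x < y ℕ.* y → x < y
square-cancel-<ℕ {x} {y} h with x ℕP.<? y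
... | yes p = p
... | no ¬p = ⊥-elim (ℕP.<⇒≱ h (ℕP.*-mono-≤ (ℕP.≮⇒≥ ¬p) (ℕP.≮⇒≥ ¬p)))

-- The theorem for a rational edge probability

module RationalTheorem (N : ℕ) (1≤N : 1 ℕ.≤ N) (n : ℕ) (n₀<n : 24 ℕ.* N ℕ.* (24 ℕ.* N) < n)
                       (q : ℚ) (0≤q : 0ℚ ≤ q) (q≤1 : q ≤ 1ℚ) (Λ≤q²n : ι (threshold N) ≤ q * q * ι n) where

  1≤n : 1 ℕ.≤ n
  1≤n = ℕP.≤-trans (ℕ.s≤s ℕ.z≤n) n₀<n

  0<n : 0ℚ ℚ.< ι n
  0<n = <-≤-trans (0<ι 0) (ι-mono {1} 1≤n)

  1≤q²n : 1ℚ ≤ q * q * ι n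
  1≤q²n = ≤-trans (ι-mono {1} (ℕP.≤-trans (ℕ.s≤s ℕ.z≤n) (combine≥₁ 216 576 (192 ℕ.* Π) N))) Λ≤q²n

  0<q : 0ℚ ℚ.< q
  0<q with q ℚP.≤? 0ℚ
  ... | no ¬p = ≰⇒> ¬p
  ... | yes p = ⊥-elim (<-irrefl refl (<-≤-trans (positive⁻¹ 1ℚ) (≤-trans 1≤q²n
    (≤-reflexive (trans (cong (λ z → z * z * ι n) (≤-antisym p 0≤q)) (*-zeroˡ (ι n)))))))

  1<[1+n]q : 1ℚ ℚ.< ι (suc n) * q
  1<[1+n]q = ≤-<-trans (≤-trans 1≤q²n (≤-by (*-nonneg (*-nonneg 0≤q (ι-nonneg n)) (≤⇒0≤- q≤1)) (lem q (ι n))))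
    (subst₂ ℚ._<_ (+-identityˡ (ι n * q)) (lem₂ q (ι n)) (+-monoˡ-< (ι n * q) 0<q))
    where
    lem : ∀ q n → n * q - q * q * n ≡ q * n * (1ℚ - q)
    lem = solve-∀ ℚ-ring
    lem₂ : ∀ q n → q + n * q ≡ (1ℚ + n) * q
    lem₂ = solve-∀ ℚ-ring

  m : ℕ
  m = proj₁ (floor-1/ q n 1<[1+n]q)

  mq≤1 : ι m * q ≤ 1ℚ
  mq≤1 = proj₁ (proj₂ (floor-1/ q n 1<[1+n]q))

  1<[1+m]q : 1ℚ ℚ.< ι (suc m) * q
  1<[1+m]q = proj₂ (proj₂ (floor-1/ q n 1<[1+n]q))

  1≤m : 1 ℕ.≤ m
  1≤m = positive m 1<[1+m]q
    where
    positive : ∀ m → 1ℚ ℚ.< ι (suc m) * q → 1 ℕ.≤ m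
    positive (suc _) _ = ℕ.s≤s ℕ.z≤n
    positive zero    h = ⊥-elim (<-irrefl refl (<-≤-trans h (≤-trans (≤-reflexive (*-identityˡ q)) q≤1)))

  -- As mq ≤ 1, a lower bound for nq² is also one for n/m².
  square-threshold : ∀ a → a ℕ.* a ℕ.≤ threshold N → a ℕ.* a ℕ.* (m ℕ.* m) ℕ.≤ n
  square-threshold a h = ι-reflect (begin
    ι (a ℕ.* a ℕ.* (m ℕ.* m))     ≡⟨ trans (ι-* (a ℕ.* a) (m ℕ.* m)) (cong (ι (a ℕ.* a) *_) (ι-* m m)) ⟩
    ι (a ℕ.* a) * (ι m * ι m)     ≤⟨ *-monoʳ (ι m * ι m) (square-nonneg (ι m)) (≤-trans (ι-mono h) Λ≤q²n) ⟩
    q * q * ι n * (ι m * ι m)     ≡⟨ lem q (ι n) (ι m) ⟩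
    ι m * q * (ι m * q) * ι n     ≤⟨ *-monoʳ (ι n) (ι-nonneg n) (*-mono mq≥0 0≤1 mq≤1 mq≤1) ⟩
    1ℚ * 1ℚ * ι n                 ≡⟨ trans (cong (_* ι n) (*-identityʳ 1ℚ)) (*-identityˡ (ι n)) ⟩
    ι n ∎)
    where
    open ℚP.≤-Reasoning
    mq≥0 = *-nonneg (ι-nonneg m) 0≤q
    lem : ∀ q n m → q * q * n * (m * m) ≡ m * q * (m * q) * n
    lem = solve-∀ ℚ-ring

  216²m²≤n : 216 ℕ.* 216 ℕ.* (m ℕ.* m) ℕ.≤ n
  216²m²≤n = square-threshold 216 (combine≥₁ 216 576 (192 ℕ.* Π) N)

  quotient : Σ[ j ∈ ℕ ] (j ℕ.* (108 ℕ.* m) ℕ.≤ n × n < suc j ℕ.* (108 ℕ.* m))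
  quotient = divide n (108 ℕ.* m) (ℕP.≤-trans 1≤m (ℕP.m≤n*m m 108))

  j : ℕ
  j = proj₁ quotient

  m≤m² : m ℕ.≤ m ℕ.* m
  m≤m² = ℕP.≤-trans (ℕP.≤-reflexive (sym (ℕP.*-identityʳ m))) (ℕP.*-monoʳ-≤ m 1≤m)

  1≤j : 1 ℕ.≤ j
  1≤j = positive j (proj₂ (proj₂ quotient))
    where
    positive : ∀ j → n < suc j ℕ.* (108 ℕ.* m) → 1 ℕ.≤ j
    positive (suc _) _ = ℕ.s≤s ℕ.z≤n
    positive zero    h = ⊥-elim (ℕP.<⇒≱ h (ℕP.≤-trans (ℕP.≤-reflexive (ℕP.*-identityˡ (108 ℕ.* m)))
      (ℕP.≤-trans (ℕP.*-mono-≤ {108} {216 ℕ.* 216} (ℕP.≤-trans (ℕP.m≤m*n 108 2) (ℕP.m≤m*n 216 216)) m≤m²) 216²m²≤n)))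

  108jm≤n : 108 ℕ.* (j ℕ.* m) ℕ.≤ n
  108jm≤n = ℕP.≤-trans (ℕP.≤-reflexive (lem j m)) (proj₁ (proj₂ quotient))
    where
    lem : ∀ j m → 108 ℕ.* (j ℕ.* m) ≡ j ℕ.* (108 ℕ.* m)
    lem = ℕSolver.solve-∀

  n≤216jm : n ℕ.≤ 216 ℕ.* (j ℕ.* m)
  n≤216jm = ℕP.≤-trans (ℕP.<⇒≤ (proj₂ (proj₂ quotient)))
    (ℕP.≤-trans (ℕP.*-monoˡ-≤ (108 ℕ.* m) (ℕP.+-monoˡ-≤ j 1≤j)) (ℕP.≤-reflexive (lem j m)))
    where
    lem : ∀ j m → (j ℕ.+ j) ℕ.* (108 ℕ.* m) ≡ 216 ℕ.* (j ℕ.* m)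
    lem = ℕSolver.solve-∀

  -- n² ≤ (216jm)² and 216²m² ≤ n. This is how j, of order nq, is seen to reach √n, so that powers
  -- of ½ with exponent of order j survive a union over vertices and those of order j² one over
  -- sets.
  n≤j² : n ℕ.≤ j ℕ.* j
  n≤j² = ℕP.*-cancelˡ-≤ n {{ℕ.>-nonZero 1≤n}} (ℕP.≤-trans (ℕP.*-mono-≤ n≤216jm n≤216jm)
    (ℕP.≤-trans (ℕP.≤-reflexive (lem 216 j m)) (ℕP.*-monoˡ-≤ (j ℕ.* j) 216²m²≤n)))
    where
    lem : ∀ c j m → c ℕ.* (j ℕ.* m) ℕ.* (c ℕ.* (j ℕ.* m)) ≡ c ℕ.* c ℕ.* (m ℕ.* m) ℕ.* (j ℕ.* j)
    lem = ℕSolver.solve-∀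

  24N≤j : 24 ℕ.* N ℕ.≤ j
  24N≤j = ℕP.<⇒≤ (square-cancel-<ℕ (ℕP.<-≤-trans n₀<n n≤j²))

  s : ℕ
  s = proj₁ (isqrt n)

  s²≤n : s ℕ.* s ℕ.≤ n
  s²≤n = proj₁ (proj₂ (isqrt n))

  n<[1+s]² : n < suc s ℕ.* suc s
  n<[1+s]² = proj₂ (proj₂ (isqrt n))

  24N≤s : 24 ℕ.* N ℕ.≤ s
  24N≤s = ℕP.≤-pred (square-cancel-<ℕ (ℕP.<-trans n₀<n n<[1+s]²))

  1≤s : 1 ℕ.≤ s
  1≤s = ℕP.≤-trans 1≤N (ℕP.≤-trans (ℕP.m≤n*m N 24) 24N≤s)

  -- As ℓ ≤ √n/(4N), sums below it have probability at most 1/(4N); the other inequality keeps the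
  -- remaining sums of order √n/N, which the drift requires.
  lower : Σ[ ℓ ∈ ℕ ] (ℓ ℕ.* (4 ℕ.* N) ℕ.≤ s × s < suc ℓ ℕ.* (4 ℕ.* N))
  lower = divide s (4 ℕ.* N) (ℕP.≤-trans 1≤N (ℕP.m≤n*m N 4))

  ℓ : ℕ
  ℓ = proj₁ lower

  s<4N[1+ℓ] : suc s ℕ.≤ 4 ℕ.* N ℕ.* suc ℓ
  s<4N[1+ℓ] = ℕP.≤-trans (proj₂ (proj₂ lower)) (ℕP.≤-reflexive (ℕP.*-comm (suc ℓ) (4 ℕ.* N)))

  4≤ℓ : 4 ℕ.≤ ℓ
  4≤ℓ = ℕP.≤-pred (ℕP.*-cancelʳ-< (4 ℕ.* N) 4 (suc ℓ) (ℕP.≤-<-trans (ℕP.≤-trans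
    (ℕP.≤-trans (ℕP.≤-reflexive (sym (ℕP.*-assoc 4 4 N))) (ℕP.*-monoˡ-≤ N {16} {24} (ℕP.m≤m+n 16 8))) 24N≤s)
      (proj₂ (proj₂ lower))))

  -- Chosen so that Chebyshev gives sums of absolute value at least `K` a probability of at most
  -- 1/(4N²).
  K : ℕ
  K = 2 ℕ.* N ℕ.* suc s

  open Walk q 0≤q q≤1 using (bern)

  νG : Expectation (Graph n)
  νG = graphE bern n

  a : ℚ
  a = ι N

  1≤a : 1ℚ ≤ a
  1≤a = ι-mono {1} 1≤N

  success : Vec Sign n → ℚ
  success S = 𝔼 νG λ G → ind (unanimousAfter? 4 (G , S))

  success≥0 : ∀ S → 0ℚ ≤ success S
  success≥0 S = 𝔼-nonneg νG λ G → ind-nonneg (unanimousAfter? 4 (G , S))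

  good-positive : ∀ S k → spinSum S ≡ ℤ.+ suc (suc k) → ℓ ℕ.≤ suc (suc k) → suc (suc k) < K →
    ι 4 * (a * (1ℚ - success S)) ≤ 1ℚ
  good-positive S k S>0 ℓ≤ <K = from (inverse (ι (suc (m ℕ.* j))) (0<ι (m ℕ.* j)))
    where
    from : Σ[ c ∈ ℚ ] (0ℚ ≤ c × ι (suc (m ℕ.* j)) * c ≡ 1ℚ) → ι 4 * (a * (1ℚ - success S)) ≤ 1ℚ
    from (c , 0≤c , bc≡1) = Estimate.good-positive N 1≤N q 0<q q≤1 m mq≤1 (<⇒≤ 1<[1+m]q) 1≤m j n s ℓ
      108jm≤n n≤216jm n≤j² 24N≤j s²≤n (ℕP.<⇒≤ n<[1+s]²) 1≤s s<4N[1+ℓ] 4≤ℓ Λ≤q²n S k S>0 ℓ≤ <K c 0≤c bc≡1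

  good : ∀ S → ℓ ℕ.≤ ℤ.∣ spinSum S ∣ → ℤ.∣ spinSum S ∣ < K → ι 4 * (a * (1ℚ - success S)) ≤ 1ℚ
  good S ℓ≤ <K = cases (spinSum S) refl ℓ≤ <K
    where
    too-small : ∀ {k} → k ℕ.≤ 1 → ℓ ℕ.≤ k → ι 4 * (a * (1ℚ - success S)) ≤ 1ℚ
    too-small k≤1 ℓ≤k = ⊥-elim (ℕP.<⇒≱ (ℕ.s≤s (ℕ.s≤s ℕ.z≤n)) (ℕP.≤-trans 4≤ℓ (ℕP.≤-trans ℓ≤k k≤1)))
    cases : ∀ y → spinSum S ≡ y → ℓ ℕ.≤ ℤ.∣ y ∣ → ℤ.∣ y ∣ < K → ι 4 * (a * (1ℚ - success S)) ≤ 1ℚ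
    cases (ℤ.+ zero)        eq h₁ h₂ = too-small ℕ.z≤n h₁
    cases (ℤ.+ suc zero)    eq h₁ h₂ = too-small ℕP.≤-refl h₁
    cases (ℤ.+ suc (suc k)) eq h₁ h₂ = good-positive S k eq h₁ h₂
    cases -[1+ zero ]       eq h₁ h₂ = too-small ℕP.≤-refl h₁
    cases -[1+ suc k ]      eq h₁ h₂ = ≤-trans
      (*-monoˡ (ι 4) (ι-nonneg 4) (*-monoˡ a (ι-nonneg N) (+-monoʳ-≤ 1ℚ (neg-antimono-≤
        (𝔼-mono νG λ G → ind-mono (unanimousAfter? 4 (G , flipSpins S)) (unanimousAfter? 4 (G , S))
          (unanimous-flip 4 G S))))))
      (good-positive (flipSpins S) k (trans (spinSum-flip S) (cong ℤ.-_ eq)) h₁ h₂)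

  I₁ I₂ : Vec Sign n → ℚ
  I₁ S = ind (ℤ.∣ spinSum S ∣ ℕP.<? ℓ)
  I₂ S = ind (K ℕP.≤? ℤ.∣ spinSum S ∣)

  pointwise : ∀ S → ι 4 * (a * (1ℚ - success S)) ≤ 1ℚ + (ι 4 * a * I₁ S + ι 4 * a * I₂ S)
  pointwise S with ℤ.∣ spinSum S ∣ ℕP.<? ℓ | K ℕP.≤? ℤ.∣ spinSum S ∣
  ... | no ¬p | no ¬r = ≤-trans (good S (ℕP.≮⇒≥ ¬p) (ℕP.≰⇒> ¬r)) (≤-reflexive (lem a))
    where
    lem : ∀ a → 1ℚ ≡ 1ℚ + (ι 4 * a * 0ℚ + ι 4 * a * 0ℚ)
    lem = solve-∀ ℚ-ring
  ... | yes p | d = ≤-by (+-nonneg 0≤1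
    (*-nonneg (*-nonneg (ι-nonneg 4) (ι-nonneg N)) (+-nonneg (success≥0 S) (ind-nonneg d))))
      (lem a (success S) (ind d))
    where
    lem : ∀ a x i → 1ℚ + (ι 4 * a * 1ℚ + ι 4 * a * i) - ι 4 * (a * (1ℚ - x)) ≡ 1ℚ + ι 4 * a * (x + i)
    lem = solve-∀ ℚ-ring
  ... | no _ | yes r = ≤-by (+-nonneg 0≤1 (*-nonneg (*-nonneg (ι-nonneg 4) (ι-nonneg N)) (success≥0 S)))
    (lem a (success S))
    where
    lem : ∀ a x → 1ℚ + (ι 4 * a * 0ℚ + ι 4 * a * 1ℚ) - ι 4 * (a * (1ℚ - x)) ≡ 1ℚ + ι 4 * a * x
    lem = solve-∀ ℚ-ring

  small≤ : ι 4 * a * smallSum n ℓ ≤ 1ℚ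
  small≤ = square-cancel-≤ 0≤1 (*-cancelˡ-≤ (ι (suc n)) (0<ι n) (begin
    ι (suc n) * (ι 4 * a * p * (ι 4 * a * p))
      ≡⟨ lem (ι (suc n)) a p ⟩
    ι 4 * a * (ι 4 * a) * (ι (suc n) * (p * p))
      ≤⟨ *-monoˡ (ι 4 * a * (ι 4 * a)) (square-nonneg (ι 4 * a)) (smallSum-bound n ℓ) ⟩
    ι 4 * a * (ι 4 * a) * (ι ℓ * ι ℓ)
      ≡⟨ lem₂ a (ι ℓ) ⟩
    ι ℓ * (ι 4 * a) * (ι ℓ * (ι 4 * a))
      ≡⟨ cong (λ z → z * z) (trans (ι-* ℓ (4 ℕ.* N)) (cong (ι ℓ *_) (ι-* 4 N))) ⟨
    ι (ℓ ℕ.* (4 ℕ.* N)) * ι (ℓ ℕ.* (4 ℕ.* N))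
      ≤⟨ *-mono (ι-nonneg (ℓ ℕ.* (4 ℕ.* N))) (ι-nonneg s) (ι-mono (proj₁ (proj₂ lower)))
        (ι-mono (proj₁ (proj₂ lower))) ⟩
    ι s * ι s
      ≡⟨ ι-* s s ⟨
    ι (s ℕ.* s)
      ≤⟨ ι-mono (ℕP.≤-trans s²≤n (ℕP.n≤1+n n)) ⟩
    ι (suc n)
      ≡⟨ trans (cong (ι (suc n) *_) (*-identityʳ 1ℚ)) (*-identityʳ (ι (suc n))) ⟨
    ι (suc n) * (1ℚ * 1ℚ) ∎))
    where
    open ℚP.≤-Reasoning
    p = smallSum n ℓ
    lem : ∀ k a p → k * (ι 4 * a * p * (ι 4 * a * p)) ≡ ι 4 * a * (ι 4 * a) * (k * (p * p))
    lem = solve-∀ ℚ-ring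
    lem₂ : ∀ a l → ι 4 * a * (ι 4 * a) * (l * l) ≡ l * (ι 4 * a) * (l * (ι 4 * a))
    lem₂ = solve-∀ ℚ-ring

  large≤ : ι 4 * a * largeSum n K ≤ 1ℚ
  large≤ = ≤-trans (≤-by (*-nonneg (*-nonneg (*-nonneg (ι-nonneg 4) (ι-nonneg N)) p≥0) (≤⇒0≤- 1≤a)) (lem a p))
    (*-cancelˡ-≤ (ι n) 0<n (begin
      ι n * (ι 4 * (a * a) * p)
        ≤⟨ *-monoʳ (ι 4 * (a * a) * p) (*-nonneg (*-nonneg (ι-nonneg 4) (square-nonneg a)) p≥0)
          (ι-mono (ℕP.<⇒≤ n<[1+s]²)) ⟩
      ι (suc s ℕ.* suc s) * (ι 4 * (a * a) * p)
        ≡⟨ trans (cong (_* (ι 4 * (a * a) * p)) (ι-* (suc s) (suc s))) (lem₂ (ι (suc s)) a p) ⟩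
      ι 2 * a * ι (suc s) * (ι 2 * a * ι (suc s)) * p
        ≡⟨ cong (λ z → z * z * p) (trans (ι-* (2 ℕ.* N) (suc s)) (cong (_* ι (suc s)) (ι-* 2 N))) ⟨
      ι K * ι K * p
        ≤⟨ largeSum-bound n K ⟩
      ι n
        ≡⟨ *-identityʳ (ι n) ⟨
      ι n * 1ℚ ∎))
    where
    open ℚP.≤-Reasoning
    p = largeSum n K
    p≥0 : 0ℚ ≤ p
    p≥0 = 𝔼-nonneg (signsE n) λ S → ind-nonneg (K ℕP.≤? ℤ.∣ spinSum S ∣)
    lem : ∀ a p → ι 4 * (a * a) * p - ι 4 * a * p ≡ ι 4 * a * p * (a - 1ℚ)
    lem = solve-∀ ℚ-ring
    lem₂ : ∀ s a p → s * s * (ι 4 * (a * a) * p) ≡ ι 2 * a * s * (ι 2 * a * s) * p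
    lem₂ = solve-∀ ℚ-ring

  -- Typical, too small and too large initial sums each take a share of 1/(4N); a fourth share is
  -- slack.
  unanimity : a * (1ℚ - 𝔼 (νG ⊛ signsE n) (λ GS → ind (unanimousAfter? 4 GS))) ≤ 1ℚ
  unanimity = *-cancelˡ-≤ (ι 4) (0<ι 3) (begin
    ι 4 * (a * (1ℚ - 𝔼 (νG ⊛ signsE n) (λ GS → ind (unanimousAfter? 4 GS))))
      ≡⟨ cong (λ z → ι 4 * (a * (1ℚ - z))) (signs-swap νG n (λ G S → ind (unanimousAfter? 4 (G , S)))) ⟩
    ι 4 * (a * (1ℚ - E success))
      ≡⟨ sym (trans (𝔼-*ˡ (signsE n) (ι 4) (λ S → a * (1ℚ - success S))) (cong (ι 4 *_)
           (trans (𝔼-*ˡ (signsE n) a (λ S → 1ℚ - success S)) (cong (a *_)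
             (trans (𝔼-- (signsE n) (λ _ → 1ℚ) success) (cong (_- E success) (𝔼-1 (signsE n)))))))) ⟩
    E (λ S → ι 4 * (a * (1ℚ - success S)))
      ≤⟨ 𝔼-mono (signsE n) pointwise ⟩
    E (λ S → 1ℚ + (ι 4 * a * I₁ S + ι 4 * a * I₂ S))
      ≡⟨ trans (𝔼-+ (signsE n) (λ _ → 1ℚ) (λ S → ι 4 * a * I₁ S + ι 4 * a * I₂ S)) (cong₂ _+_ (𝔼-1 (signsE n))
           (trans (𝔼-+ (signsE n) (λ S → ι 4 * a * I₁ S) (λ S → ι 4 * a * I₂ S))
             (cong₂ _+_ (𝔼-*ˡ (signsE n) (ι 4 * a) I₁) (𝔼-*ˡ (signsE n) (ι 4 * a) I₂)))) ⟩
    1ℚ + (ι 4 * a * smallSum n ℓ + ι 4 * a * largeSum n K)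
      ≤⟨ +-monoʳ-≤ 1ℚ (+-mono-≤ small≤ large≤) ⟩
    1ℚ + (1ℚ + 1ℚ)
      ≤⟨ ≤-by {t = 1ℚ} 0≤1 refl ⟩
    ι 4 * 1ℚ ∎)
    where
    open ℚP.≤-Reasoning
    E = 𝔼 (signsE n)

-- Real edge probabilities

record Near (c x y : ℚ) : Set where
  constructor near
  field
    below : x ≤ y + c
    above : y ≤ x + c

open Near

near-trans : ∀ {c d x y z} → Near c x y → Near d y z → Near (c + d) x z
near-trans {c} {d} {x} {y} {z} (near p q) (near p′ q′) = near
  (≤-by (+-nonneg (≤⇒0≤- p) (≤⇒0≤- p′)) (lem c d x y z))
  (≤-by (+-nonneg (≤⇒0≤- q) (≤⇒0≤- q′)) (lem₂ c d x y z))
  where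
  lem : ∀ c d x y z → z + (c + d) - x ≡ y + c - x + (z + d - y)
  lem = solve-∀ ℚ-ring
  lem₂ : ∀ c d x y z → x + (c + d) - z ≡ x + c - y + (y + d - z)
  lem₂ = solve-∀ ℚ-ring

near-weaken : ∀ {c d x y} → c ≤ d → Near c x y → Near d x y
near-weaken {x = x} {y} c≤d (near p q) = near (≤-trans p (+-monoʳ-≤ y c≤d)) (≤-trans q (+-monoʳ-≤ x c≤d))

near-≡ : ∀ {c x y} → 0ℚ ≤ c → x ≡ y → Near c x y
near-≡ {c} {x} 0≤c refl = near le le
  where
  lem : ∀ x c → x + c - x ≡ c
  lem = solve-∀ ℚ-ring
  le : x ≤ x + c
  le = ≤-by 0≤c (lem x c)

near-* : ∀ {a b x y} → Near a x 0ℚ → Near b y 0ℚ → x * y ≤ a * b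
near-* {a} {b} {x} {y} (near p q) (near p′ q′) = ≤-by
  (*-nonneg 0≤½ (+-nonneg (*-nonneg (≤⇒0≤- p) (≤⇒0≤- q′)) (*-nonneg (≤⇒0≤- q) (≤⇒0≤- p′)))) (lem a b x y)
  where
  lem : ∀ a b x y → a * b - x * y ≡ ½ * ((0ℚ + a - x) * (y + b - 0ℚ) + (x + a - 0ℚ) * (0ℚ + b - y))
  lem = solve-∀ ℚ-ring

near-difference : ∀ {c x y} → Near c x y → Near c (x - y) 0ℚ
near-difference {c} {x} {y} (near p q) = near (≤-by (≤⇒0≤- p) (lem c x y)) (≤-by (≤⇒0≤- q) (lem₂ c x y))
  where
  lem : ∀ c x y → 0ℚ + c - (x - y) ≡ y + c - x
  lem = solve-∀ ℚ-ring
  lem₂ : ∀ c x y → x - y + c - 0ℚ ≡ x + c - y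
  lem₂ = solve-∀ ℚ-ring

near-sym : ∀ {c x y} → Near c x y → Near c y x
near-sym (near p q) = near q p

-- The k-th rational approximation of an expectation. Its weights may be negative, so it is not an
-- `Expectation`.
mean : ∀ {A} → Dist A → ℕ → (A → ℚ) → ℚ
mean []            k f = 0ℚ
mean ((a , x) ∷ d) k f = seq x k * f a + mean d k f

mean-map : ∀ {A B} (φ : A → B) d k f → mean (mapDist φ d) k f ≡ mean d k (λ a → f (φ a))
mean-map φ []            k f = refl
mean-map φ ((a , x) ∷ d) k f = cong (seq x k * f (φ a) +_) (mean-map φ d k f)

mean-++ : ∀ {A} (d e : Dist A) k f → mean (d List.++ e) k f ≡ mean d k f + mean e k f
mean-++ []            e k f = sym (+-identityˡ (mean e k f))
mean-++ ((a , x) ∷ d) e k f = trans (cong (seq x k * f a +_) (mean-++ d e k f)) (sym (+-assoc (seq x k * f a) _ _))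

mean-⊗ : ∀ {A B} (d : Dist A) (e : Dist B) k f → mean (d ⊗ e) k f ≡ mean d k λ a → mean e k λ b → f (a , b)
mean-⊗ []            e k f = refl
mean-⊗ ((a , x) ∷ d) e k f = trans (mean-++ (List.map (λ (b , y) → (a , b) , x *ℝ y) e) (d ⊗ e) k f)
  (cong₂ _+_ (scaled e) (mean-⊗ d e k f))
  where
  lem : ∀ x y z m → x * y * z + x * m ≡ x * (y * z + m)
  lem = solve-∀ ℚ-ring
  scaled : ∀ e → mean (List.map (λ (b , y) → (a , b) , x *ℝ y) e) k f ≡ seq x k * mean e k (λ b → f (a , b))
  scaled []            = sym (*-zeroʳ (seq x k))
  scaled ((b , y) ∷ e) = trans (cong (seq x k * seq y k * f (a , b) +_) (scaled e))
    (lem (seq x k) (seq y k) (f (a , b)) (mean e k λ b → f (a , b)))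

total : ∀ {A : Set} → Dist A → ℝ
total = List.foldr (λ (_ , x) s → x +ℝ s) 0ℝ

filter-∷ : ∀ {A : Set} {P : Pred A 0ℓ} (P? : Decidable P) x xs →
  List.filter P? (x ∷ xs) ≡ (if does (P? x) then x ∷ List.filter P? xs else List.filter P? xs)
filter-∷ P? x xs with does (P? x)
... | true  = refl
... | false = refl

ℙ-mean : ∀ {A} (d : Dist A) {E : Pred A 0ℓ} (E? : Decidable E) k → seq (ℙ d E?) k ≡ mean d k (λ a → ind (E? a))
ℙ-mean []            E? k = refl
ℙ-mean {A} ((a , x) ∷ d) {E} E? k = trans (cong (λ l → seq (total l) k) (filter-∷ (E? ∘ proj₁) (a , x) d))
  (cases (E? a))
  where
  rest : Dist A
  rest = List.filter (E? ∘ proj₁) d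
  cases : (e : Dec (E a)) → seq (total (if does e then (a , x) ∷ rest else rest)) k ≡ seq x k * ind e + mean d k
    (λ a → ind (E? a))
  cases (yes _) = cong₂ _+_ (sym (*-identityʳ (seq x k))) (ℙ-mean d E? k)
  cases (no _)  = trans (ℙ-mean d E? k) (trans (sym (+-identityˡ (mean d k (λ a → ind (E? a)))))
    (cong (_+ mean d k (λ a → ind (E? a))) (sym (*-zeroʳ (seq x k)))))

-- Closeness is uniform over test functions, because a product applies it to inner functions that
-- vary with the outer point. `lip` limits how much the outer sum can amplify an inner error.
record Approx {A : Set} (d : Dist A) (μ : ℕ → Expectation A) : Set where
  field
    B     : ℚ
    B≥0   : 0ℚ ≤ B
    lip   : ∃[ K ] (∀ {k} → K ℕ.≤ k → ∀ f g c → (∀ a → Near c (f a) (g a)) → Near (B * c) (mean d k f) (mean d k g))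
    close : ∀ δ → 0ℚ ℚ.< δ → ∃[ K ]
      (∀ {k} → K ℕ.≤ k → ∀ f → (∀ a → Near 1ℚ (f a) 0ℚ) → Near δ (mean d k f) (𝔼 (μ k) f))

open Approx

𝔼-near : ∀ {A} (μ : Expectation A) {f} → (∀ a → Near 1ℚ (f a) 0ℚ) → Near 1ℚ (𝔼 μ f) 0ℚ
𝔼-near μ {f} h = near (subst (𝔼 μ f ≤_) (𝔼-const μ (0ℚ + 1ℚ)) (𝔼-mono μ λ a → below (h a)))
  (subst₂ _≤_ (𝔼-const μ 0ℚ) (trans (𝔼-+ μ f (λ _ → 1ℚ)) (cong (𝔼 μ f +_) (𝔼-1 μ))) (𝔼-mono μ λ a → above (h a)))

approx-pure : ∀ {A} (a : A) → Approx (pure a) (λ _ → dirac a)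
approx-pure a = record
  { B     = 1ℚ
  ; B≥0   = 0≤1
  ; lip   = 0 , λ _ f g c h → near (≤-by (≤⇒0≤- (below (h a))) (lem (f a) (g a) c))
    (≤-by (≤⇒0≤- (above (h a))) (lem (g a) (f a) c))
  ; close = λ δ 0<δ → 0 , λ _ f h → near-≡ (<⇒≤ 0<δ) (lem₂ (f a))
  }
  where
  lem : ∀ x y c → 1ℚ * y + 0ℚ + 1ℚ * c - (1ℚ * x + 0ℚ) ≡ y + c - x
  lem = solve-∀ ℚ-ring
  lem₂ : ∀ x → 1ℚ * x + 0ℚ ≡ x
  lem₂ = solve-∀ ℚ-ring

approx-map : ∀ {A B} (φ : A → B) {d μ} → Approx d μ → Approx (mapDist φ d) (λ k → image φ (μ k))
approx-map φ {d} {μ} ap = record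
  { B     = B ap
  ; B≥0   = B≥0 ap
  ; lip   = proj₁ (lip ap) , λ {k} K≤k f g c h → subst₂ (Near (B ap * c)) (sym (mean-map φ d k f))
    (sym (mean-map φ d k g))
      (proj₂ (lip ap) K≤k (λ a → f (φ a)) (λ a → g (φ a)) c λ a → h (φ a))
  ; close = λ δ 0<δ → proj₁ (close ap δ 0<δ) , λ {k} K≤k f h → subst (λ x → Near δ x (𝔼 (μ k) λ a → f (φ a)))
    (sym (mean-map φ d k f))
      (proj₂ (close ap δ 0<δ) K≤k (λ a → f (φ a)) λ a → h (φ a))
  }

half-positive : ∀ {δ} → 0ℚ ℚ.< δ → 0ℚ ℚ.< ½ * δ
half-positive = 0<* (positive⁻¹ ½)

approx-⊗ : ∀ {A C} {d : Dist A} {e : Dist C} {μ ν} → Approx d μ → Approx e ν → Approx (d ⊗ e) (λ k → μ k ⊛ ν k)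
approx-⊗ {d = d} {e} {μ} {ν} ap bp = record
  { B     = B ap * B bp
  ; B≥0   = *-nonneg (B≥0 ap) (B≥0 bp)
  ; lip   = proj₁ (lip ap) ℕ.⊔ proj₁ (lip bp) , λ {k} K≤k f g c h →
      subst₂ (Near (B ap * B bp * c)) (sym (mean-⊗ d e k f)) (sym (mean-⊗ d e k g))
        (subst (λ z → Near z (M k f) (M k g)) (sym (*-assoc (B ap) (B bp) c))
          (proj₂ (lip ap) (ℕP.m⊔n≤o⇒m≤o (proj₁ (lip ap)) _ K≤k) (λ a → mean e k λ b → f (a , b))
            (λ a → mean e k λ b → g (a , b)) (B bp * c)
            λ a → proj₂ (lip bp) (ℕP.m⊔n≤o⇒n≤o (proj₁ (lip ap)) _ K≤k) (λ b → f (a , b)) (λ b → g (a , b)) c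
              λ b → h (a , b)))
  ; close = λ δ 0<δ → closeness δ 0<δ (inverse (1ℚ + B ap) (<-≤-trans (positive⁻¹ 1ℚ) (≤-by (B≥0 ap) (lem₁ (B ap)))))
  }
  where
  lem₁ : ∀ b → 1ℚ + b - 1ℚ ≡ b
  lem₁ = solve-∀ ℚ-ring
  M : ℕ → _ → ℚ
  M k f = mean d k λ a → mean e k λ b → f (a , b)
  closeness : ∀ δ → 0ℚ ℚ.< δ → Σ[ i ∈ ℚ ] (0ℚ ≤ i × (1ℚ + B ap) * i ≡ 1ℚ) →
    ∃[ K ] (∀ {k} → K ℕ.≤ k → ∀ f → (∀ a → Near 1ℚ (f a) 0ℚ) → Near δ (mean (d ⊗ e) k f) (𝔼 (μ k ⊛ ν k) f))
  closeness δ 0<δ (i , 0≤i , Bi≡1) = K₁ ℕ.⊔ (K₂ ℕ.⊔ K₃) , λ {k} K≤k f h →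
      let K₂₃≤k = ℕP.m⊔n≤o⇒n≤o K₁ (K₂ ℕ.⊔ K₃) K≤k in
      subst (λ x → Near δ x (𝔼 (μ k ⊛ ν k) f)) (sym (mean-⊗ d e k f))
        (near-weaken Bc+½δ≤δ (near-trans
          (proj₂ (lip ap) (ℕP.m⊔n≤o⇒m≤o K₁ (K₂ ℕ.⊔ K₃) K≤k) (λ a → mean e k λ b → f (a , b))
            (λ a → 𝔼 (ν k) λ b → f (a , b)) c
            λ a → proj₂ (close bp c 0<c) (ℕP.m⊔n≤o⇒m≤o K₂ K₃ K₂₃≤k) (λ b → f (a , b)) λ b → h (a , b))
          (proj₂ (close ap (½ * δ) 0<½δ) (ℕP.m⊔n≤o⇒n≤o K₂ K₃ K₂₃≤k) (λ a → 𝔼 (ν k) λ b → f (a , b)) λ a → 𝔼-near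
            (ν k) λ b → h (a , b))))
    where
    0<½δ = half-positive 0<δ
    -- The outer sum amplifies an inner error by at most `B ap`; division by `1ℚ + B ap` keeps this
    -- below half of `δ`, also if `B ap` is 0.
    c = i * (½ * δ)
    0<i : 0ℚ ℚ.< i
    0<i with i ℚP.≤? 0ℚ
    ... | no ¬p = ≰⇒> ¬p
    ... | yes p = ⊥-elim (ℚP.<⇒≢ (positive⁻¹ 1ℚ)
      (trans (sym (*-zeroʳ (1ℚ + B ap))) (trans (cong ((1ℚ + B ap) *_) (≤-antisym 0≤i p)) Bi≡1)))
    0<c : 0ℚ ℚ.< c
    0<c = 0<* 0<i 0<½δ
    K₁ = proj₁ (lip ap)
    K₂ = proj₁ (close bp c 0<c)
    K₃ = proj₁ (close ap (½ * δ) 0<½δ)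
    lem₂ : ∀ b i δ → δ - (b * (i * (½ * δ)) + ½ * δ) ≡ ½ * δ * (1ℚ - (1ℚ + b) * i) + i * (½ * δ)
    lem₂ = solve-∀ ℚ-ring
    Bc+½δ≤δ : B ap * c + ½ * δ ≤ δ
    Bc+½δ≤δ = ≤-by (+-nonneg (*-nonneg (<⇒≤ 0<½δ) (≤⇒0≤- (≤-reflexive Bi≡1))) (<⇒≤ 0<c)) (lem₂ (B ap) i δ)

approx-iid : ∀ {A} {d : Dist A} {μ} → Approx d μ → ∀ n → Approx (iid d n) (λ k → iidE (μ k) n)
approx-iid ap zero    = approx-pure []
approx-iid ap (suc n) = approx-map (uncurry _∷_) (approx-⊗ ap (approx-iid ap n))

approx-uniformSign : Approx uniformSign (λ _ → signE)
approx-uniformSign = record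
  { B     = 1ℚ
  ; B≥0   = 0≤1
  ; lip   = 0 , λ _ f g c h → near (bound f g c (λ a → below (h a))) (bound g f c (λ a → above (h a)))
  ; close = λ δ 0<δ → 0 , λ _ f h → near-≡ (<⇒≤ 0<δ) (cong (½ * f Sign.+ +_) (+-identityʳ (½ * f Sign.-)))
  }
  where
  lem : ∀ x y x′ y′ c → ½ * x′ + (½ * y′ + 0ℚ) + 1ℚ * c - (½ * x + (½ * y + 0ℚ)) ≡ ½ * (x′ + c - x) + ½ * (y′ + c - y)
  lem = solve-∀ ℚ-ring
  bound : ∀ f g c → (∀ a → f a ≤ g a + c) → ½ * f Sign.+ + (½ * f Sign.- + 0ℚ) ≤ ½ * g Sign.+ +
    (½ * g Sign.- + 0ℚ) + 1ℚ * c
  bound f g c h = ≤-by (+-nonneg (*-nonneg 0≤½ (≤⇒0≤- (h Sign.+))) (*-nonneg 0≤½ (≤⇒0≤- (h Sign.-))))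
    (lem (f Sign.+) (f Sign.-) (g Sign.+) (g Sign.-) c)

clip : ℚ → ℚ
clip x = 0ℚ ⊔ (x ⊓ 1ℚ)

0≤clip : ∀ x → 0ℚ ≤ clip x
0≤clip x = ℚP.p≤p⊔q 0ℚ (x ⊓ 1ℚ)

clip≤1 : ∀ x → clip x ≤ 1ℚ
clip≤1 x = ⊔-lub 0≤1 (ℚP.p⊓q≤q x 1ℚ)

≤clip : ∀ {x y} → y ≤ x → y ≤ 1ℚ → y ≤ clip x
≤clip {x} p q = ≤-trans (ℚP.⊓-glb p q) (ℚP.p≤q⊔p 0ℚ (x ⊓ 1ℚ))

clip-near : ∀ {δ x} → 0ℚ ≤ δ → 0ℚ ≤ x + δ → x ≤ 1ℚ + δ → Near δ x (clip x)
clip-near {δ} {x} 0≤δ p q = near upper (⊔-lub p (≤-trans (ℚP.p⊓q≤p x 1ℚ) (≤-by 0≤δ (lem x δ))))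
  where
  lem : ∀ x δ → x + δ - x ≡ δ
  lem = solve-∀ ℚ-ring
  upper : x ≤ clip x + δ
  upper with ≤-total x 1ℚ
  ... | inj₁ x≤1 = ≤-trans (≤clip ≤-refl x≤1) (≤-by 0≤δ (lem (clip x) δ))
  ... | inj₂ 1≤x = ≤-trans q (+-monoˡ-≤ δ (≤clip 1≤x ≤-refl))

module _ (p : ℝ) (0≤p : 0ℝ ≤ℝ p) (p≤1 : p ≤ℝ 1ℝ) where

  -- The rationals approximating p may lie outside [0, 1].
  edgeLaw : ℕ → Expectation Bool
  edgeLaw k = bernoulliE (clip (seq p k)) (0≤clip (seq p k)) (clip≤1 (seq p k))

  clip-tends : ∀ δ → 0ℚ ℚ.< δ → ∃[ K ] (∀ {k} → K ℕ.≤ k → Near δ (seq p k) (clip (seq p k)))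
  clip-tends δ 0<δ with 0≤p δ 0<δ | p≤1 δ 0<δ
  ... | K₁ , h₁ | K₂ , h₂ = K₁ ℕ.⊔ K₂ , λ K≤k →
    clip-near (<⇒≤ 0<δ) (h₁ (ℕP.m⊔n≤o⇒m≤o K₁ K₂ K≤k)) (h₂ (ℕP.m⊔n≤o⇒n≤o K₁ K₂ K≤k))

  approx-bernoulli : Approx (bernoulli p) edgeLaw
  approx-bernoulli = record
    -- Eventually the approximation lies within 1 of its clipped value, so p and 1 - p are at most 2
    -- in absolute value; 4 = 2 + 2.
    { B     = ι 4
    ; B≥0   = ι-nonneg 4
    ; lip   = proj₁ (clip-tends 1ℚ (positive⁻¹ 1ℚ)) , λ {k} K≤k f g c h →
        let h′ = λ b → near-difference (h b) ; s = small (proj₂ (clip-tends 1ℚ (positive⁻¹ 1ℚ)) K≤k) in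
        near (≤-by (+-nonneg (≤⇒0≤- (near-* (proj₁ s) (h′ true))) (≤⇒0≤- (near-* (proj₂ s) (h′ false))))
               (lem₁ (seq p k) (f true) (f false) (g true) (g false) c))
             (≤-by (+-nonneg (≤⇒0≤- (near-* (proj₁ s) (near-difference (near-sym (h true)))))
               (≤⇒0≤- (near-* (proj₂ s) (near-difference (near-sym (h false))))))
               (lem₁ (seq p k) (g true) (g false) (f true) (f false) c))
    ; close = λ δ 0<δ → proj₁ (clip-tends (½ * δ) (half-positive 0<δ)) , λ {k} K≤k f h →
        let d  = near-difference (proj₂ (clip-tends (½ * δ) (half-positive 0<δ)) K≤k)
            d′ = near-difference (near-sym (proj₂ (clip-tends (½ * δ) (half-positive 0<δ)) K≤k))
            r  = near-difference (near-trans (h true) (near-sym (h false))) in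
        near (≤-by (≤⇒0≤- (near-* d r)) (lem₂ (seq p k) (clip (seq p k)) (f true) (f false) δ))
             (≤-by (≤⇒0≤- (near-* d′ r)) (lem₃ (seq p k) (clip (seq p k)) (f true) (f false) δ))
    }
    where
    lem₁ : ∀ p a b a′ b′ c → p * a′ + ((1ℚ + - p) * b′ + 0ℚ) + ι 4 * c - (p * a + ((1ℚ + - p) * b + 0ℚ)) ≡
      (1ℚ + 1ℚ) * c - p * (a - a′) + ((1ℚ + 1ℚ) * c - (1ℚ - p) * (b - b′))
    lem₁ = solve-∀ ℚ-ring
    lem₂ : ∀ p q a b δ → q * a + (1ℚ - q) * b + δ - (p * a + ((1ℚ + - p) * b + 0ℚ)) ≡ ½ * δ * (1ℚ + 1ℚ) -
      (p - q) * (a - b)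
    lem₂ = solve-∀ ℚ-ring
    lem₃ : ∀ p q a b δ → p * a + ((1ℚ + - p) * b + 0ℚ) + δ - (q * a + (1ℚ - q) * b) ≡ ½ * δ * (1ℚ + 1ℚ) -
      (q - p) * (a - b)
    lem₃ = solve-∀ ℚ-ring
    small : ∀ {x} → Near 1ℚ x (clip x) → Near (1ℚ + 1ℚ) x 0ℚ × Near (1ℚ + 1ℚ) (1ℚ - x) 0ℚ
    small {x} (near lo hi) =
      near (≤-by (+-nonneg (≤⇒0≤- lo) (≤⇒0≤- (clip≤1 x))) (lem₄ x (clip x)))
           (≤-by (+-nonneg (≤⇒0≤- hi) (+-nonneg (0≤clip x) 0≤1)) (lem₅ x (clip x))) ,
      near (≤-by (+-nonneg (≤⇒0≤- hi) (0≤clip x)) (lem₆ x (clip x)))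
           (≤-by (+-nonneg (≤⇒0≤- lo) (+-nonneg (≤⇒0≤- (clip≤1 x)) 0≤1)) (lem₇ x (clip x)))
      where
      lem₄ : ∀ x y → 0ℚ + (1ℚ + 1ℚ) - x ≡ y + 1ℚ - x + (1ℚ - y)
      lem₄ = solve-∀ ℚ-ring
      lem₅ : ∀ x y → x + (1ℚ + 1ℚ) - 0ℚ ≡ x + 1ℚ - y + (y + 1ℚ)
      lem₅ = solve-∀ ℚ-ring
      lem₆ : ∀ x y → 0ℚ + (1ℚ + 1ℚ) - (1ℚ - x) ≡ x + 1ℚ - y + y
      lem₆ = solve-∀ ℚ-ring
      lem₇ : ∀ x y → 1ℚ - x + (1ℚ + 1ℚ) - 0ℚ ≡ y + 1ℚ - x + (1ℚ - y + 1ℚ)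
      lem₇ = solve-∀ ℚ-ring

  approx-gnp : ∀ n → Approx (gnp n p) (λ k → graphE (edgeLaw k) n)
  approx-gnp zero    = approx-pure empty
  approx-gnp (suc n) = approx-map (uncurry extend) (approx-⊗ (approx-iid approx-bernoulli n) (approx-gnp n))

  approx-randomInstance : ∀ n → Approx (randomInstance n p) (λ k → graphE (edgeLaw k) n ⊛ signsE n)
  approx-randomInstance n = approx-⊗ (approx-gnp n) (approx-iid approx-uniformSign n)

-- Real hypotheses reduced to the rational theorem

toℚᵘ-ι : ∀ n → toℚᵘ (ι n) ℚᵘ.≃ mkℚᵘ (ℤ.+ n) 0
toℚᵘ-ι zero    = ℚᵘP.≃-refl
toℚᵘ-ι (suc n) = ℚᵘP.≃-trans (ℚP.toℚᵘ-homo-+ 1ℚ (ι n)) (ℚᵘP.≃-trans (ℚᵘP.+-congʳ (toℚᵘ 1ℚ) (toℚᵘ-ι n))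
  (ℚᵘ.*≡* (cong (ℤ._* 1ℤ) (cong (λ z → 1ℤ ℤ.+ z) (ℤP.*-identityʳ (ℤ.+ n))))))

ι≡/1 : ∀ n → ι n ≡ ℤ.+ n ℚ./ 1
ι≡/1 n = ℚP.toℚᵘ-injective (ℚᵘP.≃-trans (toℚᵘ-ι n) (ℚᵘP.≃-sym (ℚP.toℚᵘ-fromℚᵘ (mkℚᵘ (ℤ.+ n) 0))))

archimedean : ∀ x → Σ[ N ∈ ℕ ] x ≤ ι N
archimedean (ℚ.mkℚ z d-1 _) = ℤ.∣ z ∣ , ℚP.toℚᵘ-cancel-≤
  (ℚᵘP.≤-respʳ-≃ (ℚᵘP.≃-sym (toℚᵘ-ι ℤ.∣ z ∣)) (ℚᵘ.*≤* (bound z)))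
  where
  bound : ∀ z → z ℤ.* 1ℤ ℤ.≤ ℤ.+ ℤ.∣ z ∣ ℤ.* ℤ.+ suc d-1
  bound (ℤ.+ k)  = subst₂ ℤ._≤_ (sym (ℤP.*-identityʳ (ℤ.+ k))) (ℤP.pos-* k (suc d-1)) (ℤ.+≤+ (ℕP.m≤m*n k (suc d-1)))
  bound -[1+ k ] = ℤP.≤-trans (ℤP.≤-reflexive (ℤP.*-identityʳ -[1+ k ]))
    (ℤP.≤-trans ℤ.-≤+ (ℤP.≤-reflexive (ℤP.pos-* (suc k) (suc d-1))))

invSqrtSeq-nonneg : ∀ n i → 0ℚ ≤ invSqrtSeq n i
invSqrtSeq-nonneg n i = nonNegative⁻¹ (invSqrtSeq n i) {{ℚP.normalize-nonNeg ⌊ suc i /√ n ⌋ (suc i)}}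

module _ (ε : ℝ) (ε>0 : 0ℝ <ℝ ε) where

  δ₀ : ℚ
  δ₀ = proj₁ ε>0

  0<δ₀ : 0ℚ ℚ.< δ₀
  0<δ₀ = proj₁ (proj₂ ε>0)

  δ₀≤ε : ∃[ K ] (∀ {i} → K ℕ.≤ i → 0ℚ + δ₀ ≤ seq ε i)
  δ₀≤ε = proj₂ (proj₂ ε>0)

  scaled : Σ[ N ∈ ℕ ] (1 ℕ.≤ N × 1ℚ ≤ ι N * δ₀)
  scaled = from (inverse δ₀ 0<δ₀)
    where
    from : Σ[ i ∈ ℚ ] (0ℚ ≤ i × δ₀ * i ≡ 1ℚ) → Σ[ N ∈ ℕ ] (1 ℕ.≤ N × 1ℚ ≤ ι N * δ₀)
    from (i , _ , δi≡1) = suc (proj₁ (archimedean i)) , ℕ.s≤s ℕ.z≤n ,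
      ≤-trans (≤-reflexive (trans (sym δi≡1) (*-comm δ₀ i)))
        (*-monoʳ δ₀ (<⇒≤ 0<δ₀) (≤-trans (proj₂ (archimedean i)) (ι-mono (ℕP.n≤1+n (proj₁ (archimedean i))))))

  N : ℕ
  N = proj₁ scaled

  1≤N : 1 ℕ.≤ N
  1≤N = proj₁ (proj₂ scaled)

  1≤Nδ₀ : 1ℚ ≤ ι N * δ₀
  1≤Nδ₀ = proj₂ (proj₂ scaled)

  θ : ℚ
  θ = ι (threshold N)

  1≤θ : 1ℚ ≤ θ
  1≤θ = ι-mono {1} (ℕP.≤-trans (ℕ.s≤s ℕ.z≤n) (combine≥₁ 216 576 (192 ℕ.* Π) N))

  0<θ : 0ℚ ℚ.< θ
  0<θ = <-≤-trans (positive⁻¹ 1ℚ) 1≤θ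

  0<4θ : 0ℚ ℚ.< ι 4 * θ
  0<4θ = 0<* (0<ι 3) 0<θ

  module _ (n : ℕ) .{{_ : NonZero n}} (n₀<n : 24 ℕ.* N ℕ.* (24 ℕ.* N) < n)
           (p : ℝ) (0≤p : 0ℝ ≤ℝ p) (p≤1 : p ≤ℝ 1ℝ) (λ≤p : fromℚ (ι 4 * θ) *ℝ invSqrt n ≤ℝ p) where

    ν : ℚ
    ν = ι n

    0<ν : 0ℚ ℚ.< ν
    0<ν = <-≤-trans (0<ι 0) (ι-mono {1} (ℕP.≤-trans (ℕ.s≤s ℕ.z≤n) n₀<n))

    inverse-ν : Σ[ u ∈ ℚ ] (0ℚ ≤ u × ν * u ≡ 1ℚ)
    inverse-ν = inverse ν 0<ν

    -- 1/(2n), a tolerance fixed before the index is chosen, yet below the approximations of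
    -- n^(-1/2) from some index on.
    u : ℚ
    u = ½ * proj₁ inverse-ν

    νu≡½ : ν * u ≡ ½
    νu≡½ = trans (lem ν (proj₁ inverse-ν)) (cong (½ *_) (proj₂ (proj₂ inverse-ν)))
      where
      lem : ∀ v i → v * (½ * i) ≡ ½ * (v * i)
      lem = solve-∀ ℚ-ring

    0≤u : 0ℚ ≤ u
    0≤u = *-nonneg 0≤½ (proj₁ (proj₂ inverse-ν))

    0<u : 0ℚ ℚ.< u
    0<u with u ℚP.≤? 0ℚ
    ... | no ¬p = ≰⇒> ¬p
    ... | yes h = ⊥-elim (ℚP.<⇒≢ (positive⁻¹ ½)
      (trans (sym (*-zeroʳ ν)) (trans (cong (ν *_) (≤-antisym 0≤u h)) νu≡½)))

    u≤½ : u ≤ ½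
    u≤½ = ≤-trans (≤-reflexive (sym (*-identityˡ u))) (≤-trans
      (*-monoʳ u 0≤u (ι-mono {1} (ℕP.≤-trans (ℕ.s≤s ℕ.z≤n) n₀<n))) (≤-reflexive νu≡½))

    -- Here t²n ≥ ½ and u ≤ t. Halving 4θ to 2θ pays for the tolerance and for the clipping at 1.
    -- Then 4θ²t²n ≥ 2θ² ≥ θ, so θ itself can serve in λ in place of its square root.
    clip-threshold : ∀ t P → 0ℚ ≤ t → Near ½ (t * t * ν) 1ℚ → ι 4 * θ * t ≤ P + u → P ≤ 1ℚ + ½ → θ ≤ clip P *
      clip P * ν
    clip-threshold t P 0≤t (near _ 1≤) 4θt≤ P≤ = begin
      θ
        ≤⟨ ≤-by (+-nonneg (+-nonneg (*-nonneg (ι-nonneg (threshold N)) (≤⇒0≤- 1≤θ))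
          (*-nonneg (*-nonneg θ²≥0 0≤2) (≤⇒0≤- 1≤))) (square-nonneg θ)) (lem₁ θ t ν) ⟩
      ι 2 * θ * t * (ι 2 * θ * t) * ν
        ≤⟨ *-monoʳ ν (ι-nonneg n) (*-mono 2θt≥0 (0≤clip P) 2θt≤ 2θt≤) ⟩
      clip P * clip P * ν ∎
      where
      open ℚP.≤-Reasoning
      θ²≥0 : 0ℚ ≤ ι 2 * (θ * θ)
      θ²≥0 = *-nonneg (ι-nonneg 2) (square-nonneg θ)
      2θt≥0 : 0ℚ ≤ ι 2 * θ * t
      2θt≥0 = *-nonneg (*-nonneg (ι-nonneg 2) (ι-nonneg (threshold N))) 0≤t
      lem₁ : ∀ θ t ν → ι 2 * θ * t * (ι 2 * θ * t) * ν - θ ≡ θ * (θ - 1ℚ) + ι 2 * (θ * θ) * 2ℚ *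
        (t * t * ν + ½ - 1ℚ) + θ * θ
      lem₁ = solve-∀ ℚ-ring
      2θt≤ : ι 2 * θ * t ≤ clip P
      2θt≤ = ≤clip 2θt≤P 2θt≤1
        where
        u≤t : u ≤ t
        u≤t = ℚP.≮⇒≥ λ t<u → <-irrefl refl (<-≤-trans (positive⁻¹ (½ * ½)) (¼≤0 (t²ν≤ (<⇒≤ t<u))))
          where
          lem : ∀ x y → 0ℚ - ½ * ½ ≡ x + ½ - 1ℚ + (y - x) + (½ * ½ - y)
          lem = solve-∀ ℚ-ring
          lem₂ : ∀ u v → u * u * v ≡ v * u * u
          lem₂ = solve-∀ ℚ-ring
          t²ν≤ : t ≤ u → t * t * ν ≤ ½ * u
          t²ν≤ t≤u = ≤-trans (*-monoʳ ν (ι-nonneg n) (*-mono 0≤t 0≤u t≤u t≤u))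
            (≤-reflexive (trans (lem₂ u ν) (cong (_* u) νu≡½)))
          ¼≤0 : t * t * ν ≤ ½ * u → ½ * ½ ≤ 0ℚ
          ¼≤0 h = ≤-by (+-nonneg (+-nonneg (≤⇒0≤- 1≤) (≤⇒0≤- h)) (≤⇒0≤- (*-monoˡ ½ 0≤½ u≤½)))
            (lem (t * t * ν) (½ * u))
        2θt≤P : ι 2 * θ * t ≤ P
        2θt≤P = ≤-by (+-nonneg (≤⇒0≤- 4θt≤)
          (+-nonneg (≤⇒0≤- u≤t) (+-nonneg (*-nonneg (*-nonneg 0≤2 (≤⇒0≤- 1≤θ)) 0≤t) 0≤t))) (lem θ t P u)
          where
          lem : ∀ θ t P u → P - ι 2 * θ * t ≡ P + u - ι 4 * θ * t + (t - u + ((1ℚ + 1ℚ) * (θ - 1ℚ) * t + t))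
          lem = solve-∀ ℚ-ring
        2θt≤1 : ι 2 * θ * t ≤ 1ℚ
        2θt≤1 = ≤-by (+-nonneg (*-nonneg 0≤½ (≤⇒0≤- 4θt≤))
          (+-nonneg (*-nonneg 0≤½ (≤⇒0≤- P≤)) (*-nonneg 0≤½ (≤⇒0≤- u≤½)))) (lem θ t P u)
          where
          lem : ∀ θ t P u → 1ℚ - ι 2 * θ * t ≡ ½ * (P + u - ι 4 * θ * t) + (½ * (1ℚ + ½ - P) + ½ * (½ - u))
          lem = solve-∀ ℚ-ring

    isqrt-near : ∃[ K ] (∀ {i} → K ℕ.≤ i → Near ½ (invSqrtSeq n i * invSqrtSeq n i * ν) 1ℚ)
    isqrt-near = proj₁ limit , λ {i} K≤i →
        subst (λ v → Near ½ (invSqrtSeq n i * invSqrtSeq n i * v) 1ℚ) (sym (ι≡/1 n)) (from-abs (proj₂ limit K≤i))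
      where
      limit = invSqrt-square n ½ (positive⁻¹ ½)
      from-abs : ∀ {x y c} → ∣ x - y ∣ ≤ c → Near c x y
      from-abs {x} {y} {c} h = near
        (≤-by (≤⇒0≤- (≤-trans (p≤∣p∣ (x - y)) h)) (lem₁ x y c))
        (≤-by (≤⇒0≤- (≤-trans (p≤∣p∣ (- (x - y))) (≤-trans (≤-reflexive (ℚP.∣-p∣≡∣p∣ (x - y))) h))) (lem₂ x y c))
        where
        p≤∣p∣ : ∀ p → p ≤ ∣ p ∣
        p≤∣p∣ p with ≤-total 0ℚ p
        ... | inj₁ 0≤p = ≤-reflexive (sym (ℚP.0≤p⇒∣p∣≡p 0≤p))
        ... | inj₂ p≤0 = ≤-trans p≤0 (ℚP.0≤∣p∣ p)
        lem₁ : ∀ x y c → y + c - x ≡ c - (x - y)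
        lem₁ = solve-∀ ℚ-ring
        lem₂ : ∀ x y c → x + c - y ≡ c - (- (x - y))
        lem₂ = solve-∀ ℚ-ring

    event : Graph n × Vec Sign n → ℚ
    event GS = ind (unanimousAfter? 4 GS)

    event-near : ∀ GS → Near 1ℚ (event GS) 0ℚ
    event-near GS = near (≤-trans (ind≤1 (unanimousAfter? 4 GS)) (≤-reflexive (sym (+-identityˡ 1ℚ))))
      (+-nonneg (ind-nonneg (unanimousAfter? 4 GS)) 0≤1)

    approx : Approx (randomInstance n p) (λ k → graphE (edgeLaw p 0≤p p≤1 k) n ⊛ signsE n)
    approx = approx-randomInstance p 0≤p p≤1 n

    -- The rational theorem is applied at each late index to the clipped approximation of p; its
    -- constants depend on N alone, hence not on the index.
    unanimity-limit : 1ℝ -ℝ ε ≤ℝ ℙ (randomInstance n p) (unanimousAfter? 4)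
    unanimity-limit δ 0<δ = K₁ ℕ.⊔ (K₂ ℕ.⊔ (K₃ ℕ.⊔ (K₄ ℕ.⊔ K₅))) , λ {i} K≤i →
      let h₂ = ℕP.m⊔n≤o⇒n≤o K₁ (K₂ ℕ.⊔ (K₃ ℕ.⊔ (K₄ ℕ.⊔ K₅))) K≤i
          h₃ = ℕP.m⊔n≤o⇒n≤o K₂ (K₃ ℕ.⊔ (K₄ ℕ.⊔ K₅)) h₂
          h₄ = ℕP.m⊔n≤o⇒n≤o K₃ (K₄ ℕ.⊔ K₅) h₃
      in at i
           (proj₂ isqrt-near (ℕP.m⊔n≤o⇒m≤o K₁ (K₂ ℕ.⊔ (K₃ ℕ.⊔ (K₄ ℕ.⊔ K₅))) K≤i))
           (proj₂ (λ≤p u 0<u) (ℕP.m⊔n≤o⇒m≤o K₂ (K₃ ℕ.⊔ (K₄ ℕ.⊔ K₅)) h₂))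
           (proj₂ (p≤1 ½ (positive⁻¹ ½)) (ℕP.m⊔n≤o⇒m≤o K₃ (K₄ ℕ.⊔ K₅) h₃))
           (proj₂ δ₀≤ε (ℕP.m⊔n≤o⇒m≤o K₄ K₅ h₄))
           (proj₂ (close approx δ 0<δ) (ℕP.m⊔n≤o⇒n≤o K₄ K₅ h₄) event event-near)
      where
      K₁ = proj₁ isqrt-near
      K₂ = proj₁ (λ≤p u 0<u)
      K₃ = proj₁ (p≤1 ½ (positive⁻¹ ½))
      K₄ = proj₁ δ₀≤ε
      K₅ = proj₁ (close approx δ 0<δ)
      at : ∀ i → Near ½ (invSqrtSeq n i * invSqrtSeq n i * ν) 1ℚ → ι 4 * θ * invSqrtSeq n i ≤ seq p i + u → seq
        p i ≤ 1ℚ + ½ →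
        0ℚ + δ₀ ≤ seq ε i → Near δ (mean (randomInstance n p) i event)
          (𝔼 (graphE (edgeLaw p 0≤p p≤1 i) n ⊛ signsE n) event) →
        1ℚ + - seq ε i ≤ seq (ℙ (randomInstance n p) (unanimousAfter? 4)) i + δ
      at i t-near λt≤ P≤ δ₀≤ closeness = begin
        1ℚ + - seq ε i
          ≤⟨ +-monoʳ-≤ 1ℚ (neg-antimono-≤ (≤-trans (≤-reflexive (sym (+-identityˡ δ₀))) δ₀≤)) ⟩
        1ℚ - δ₀
          ≤⟨ ≤-by (≤⇒0≤- failure≤) (lem δ₀ E) ⟩
        E
          ≤⟨ above closeness ⟩
        mean (randomInstance n p) i event + δ
          ≡⟨ cong (_+ δ) (ℙ-mean (randomInstance n p) (unanimousAfter? 4) i) ⟨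
        seq (ℙ (randomInstance n p) (unanimousAfter? 4)) i + δ ∎
        where
        open ℚP.≤-Reasoning
        E = 𝔼 (graphE (edgeLaw p 0≤p p≤1 i) n ⊛ signsE n) event
        lem : ∀ d e → e - (1ℚ - d) ≡ d - (1ℚ - e)
        lem = solve-∀ ℚ-ring
        0<N : 0ℚ ℚ.< ι N
        0<N = <-≤-trans (positive⁻¹ 1ℚ) (ι-mono {1} 1≤N)
        failure≤ : 1ℚ - E ≤ δ₀
        failure≤ = *-cancelˡ-≤ (ι N) 0<N (≤-trans
          (RationalTheorem.unanimity N 1≤N n n₀<n (clip (seq p i)) (0≤clip (seq p i)) (clip≤1 (seq p i))
            (clip-threshold (invSqrtSeq n i) (seq p i) (invSqrtSeq-nonneg n i) t-near λt≤ P≤))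
          1≤Nδ₀)

theorem1p1 : (ε : ℝ) → 0ℝ <ℝ ε → ε ≤ℝ 1ℝ →
    Σ[ lam ∈ ℝ ] 0ℝ <ℝ lam × (Σ[ n₀ ∈ ℕ ]
    ((n : ℕ) → .{{_ : NonZero n}} → n₀ < n →
    (p : ℝ) → 0ℝ ≤ℝ p → p ≤ℝ 1ℝ → lam *ℝ invSqrt n ≤ℝ p →
    1ℝ -ℝ ε ≤ℝ ℙ (randomInstance n p) (unanimousAfter? 4)))
theorem1p1 ε ε>0 _ =
  fromℚ (ι 4 * θ ε ε>0) ,
  (ι 4 * θ ε ε>0 , 0<4θ ε ε>0 , 0 , λ _ → ≤-reflexive (+-identityˡ (ι 4 * θ ε ε>0))) ,
  24 ℕ.* N ε ε>0 ℕ.* (24 ℕ.* N ε ε>0) ,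
  λ n n₀<n p 0≤p p≤1 λ≤p → unanimity-limit ε ε>0 n n₀<n p 0≤p p≤1 λ≤p
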